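{- The semifields isotopic to some $B(2,m,s,0,t)$ with $s\notin\{0,m\}$ and $t$ legitimate are precisely the finite semifields of characteristic $2$ which are quadratic (i.e. two-dimensional) over their left nucleus and quadratic over their right nucleus.
   Context: A (finite) presemifield is a finite additive abelian group with a multiplication that is distributive on both sides over addition and has no zero divisors; it is a semifield if it also has a multiplicative identity. Two presemifields $(F,+,*)$ and $(F,+,\circ)$ are isotopic if there are additive bijections $\alpha_1,\alpha_2,\beta$ with $\beta(\alpha_1(x)*\alpha_2(y))=x\circ y$ for all $x,y$. The left nucleus of a semifield $(F,+,*)$ is the set of $x$ with $x*(y*w)=(x*y)*w$ for all $y,w$; the right nucleus is the set of $w$ with $x*(y*w)=(x*y)*w$ for all $x,y$. For $m\ge 1$, $L=GF(2^m)$, $0\le s<2m$ and $\sigma=2^s$, a quadruple $t=[p_1,p_2,p_3,p_4]\in L^4$ is legitimate if $p_1\neq0$ and $p_1X^{\sigma+1}+p_2X^{\sigma}+p_3X+p_4$ has no root in $L$. $B(2,m,s,0,t)$ is the presemifield on $L\times L$ with multiplication $$(a,b)\circ(c,d)=(p_1ac^{\sigma}+p_2bc^{\sigma}+p_3ad^{\sigma}+p_4bd^{\sigma},\ ad+bc).$$ -}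

module Defs where

open import Algebra.Bundles using (CommutativeRing; NonAssociativeRing)
open import Algebra.Bundles.Raw using (RawGroup; RawRing; RawRingWithoutOne)
import Algebra.Construct.DirectProduct as DirectProduct
import Algebra.Definitions as AlgebraDefinitions
import Algebra.Definitions.RawMonoid as RawMonoidDefinitions
import Algebra.Definitions.RawSemiring as RawSemiringDefinitions
open import Algebra.Morphism.Structures using (module GroupMorphisms)
open import Data.Fin.Base using (Fin)
open import Data.Nat.Base as ℕ using (ℕ)
open import Data.Product.Base using (∃-syntax; Σ-syntax; _×_; _,_)
open import Data.Sum.Base using (_⊎_)
open import Data.Vec.Functional using (Vector)
open import Function.Bundles using (Inverse)
open import Level using (Level; _⊔_) renaming (suc to lsuc)
open import Relation.Binary.Bundles using (Setoid)
open import Relation.Binary.PropositionalEquality.Properties using (setoid)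
open import Relation.Nullary.Negation.Core using (¬_)

private
  variable
    a b c ℓ ℓ₁ ℓ₂ : Level

HasSize : Setoid c ℓ → ℕ → Set (c ⊔ ℓ)
HasSize A n = Inverse A (setoid (Fin n))

IsFinite : Setoid c ℓ → Set (c ⊔ ℓ)
IsFinite A = ∃[ n ] HasSize A n

-- Since a finite setoid has decidable equality, the negative hypothesis
-- in `invertible` has its usual force.
record FiniteField c ℓ (q : ℕ) : Set (lsuc (c ⊔ ℓ)) where
  field
    commutativeRing : CommutativeRing c ℓ

  open CommutativeRing commutativeRing public
  open AlgebraDefinitions _≈_ using (Invertible)

  field
    1≉0        : 1# ≉ 0#
    invertible : ∀ x → x ≉ 0# → Invertible 1# _*_ x
    size       : HasSize (CommutativeRing.setoid commutativeRing) q

-- Finiteness is part of the definition. `1≉0` excludes the zero ring, which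
-- would otherwise have vacuously no zero divisors.
record Semifield c ℓ : Set (lsuc (c ⊔ ℓ)) where
  field
    nonAssociativeRing : NonAssociativeRing c ℓ

  open NonAssociativeRing nonAssociativeRing public

  field
    1≉0            : ¬ (1# ≈ 0#)
    noZeroDivisors : ∀ x y → x * y ≈ 0# → x ≈ 0# ⊎ y ≈ 0#
    finite         : IsFinite (NonAssociativeRing.setoid nonAssociativeRing)

  rawRingWithoutOne : RawRingWithoutOne c ℓ
  rawRingWithoutOne = record
    { _≈_ = _≈_ ; _+_ = _+_ ; _*_ = _*_ ; -_ = -_ ; 0# = 0# }

-- Only the operations enter, so isotopy is defined for raw structures; an
-- isotopism carries the presemifield laws from one side to the other.
record Isotopic (R : RawRingWithoutOne a ℓ₁) (S : RawRingWithoutOne b ℓ₂)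
       : Set (a ⊔ b ⊔ ℓ₁ ⊔ ℓ₂) where
  private
    module R = RawRingWithoutOne R
    module S = RawRingWithoutOne S
    module S→R = GroupMorphisms S.+-rawGroup R.+-rawGroup
    module R→S = GroupMorphisms R.+-rawGroup S.+-rawGroup

  field
    α₁ α₂ : S.Carrier → R.Carrier
    β     : R.Carrier → S.Carrier
    α₁-isGroupIsomorphism : S→R.IsGroupIsomorphism α₁
    α₂-isGroupIsomorphism : S→R.IsGroupIsomorphism α₂
    β-isGroupIsomorphism  : R→S.IsGroupIsomorphism β
    isotopism : ∀ x y → β (α₁ x R.* α₂ y) S.≈ (x S.* y)

module _ (S : Semifield c ℓ) where
  open Semifield S
  open RawMonoidDefinitions (RawRingWithoutOne.+-rawMonoid rawRingWithoutOne)
    using (sum) renaming (_×_ to _·_)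

  record HasCharacteristic (n : ℕ) : Set ℓ where
    field
      positive : 0 ℕ.< n
      n·1≈0    : n · 1# ≈ 0#
      minimal  : ∀ k → 0 ℕ.< k → k ℕ.< n → ¬ (k · 1# ≈ 0#)

  InLeftNucleus : Carrier → Set (c ⊔ ℓ)
  InLeftNucleus x = ∀ y w → x * (y * w) ≈ (x * y) * w

  InRightNucleus : Carrier → Set (c ⊔ ℓ)
  InRightNucleus w = ∀ x y → x * (y * w) ≈ (x * y) * w

  -- The semifield is a left vector space over its left nucleus and a right
  -- vector space over its right nucleus.
  record IsLeftNuclearBasis {n : ℕ} (e : Vector Carrier n) : Set (c ⊔ ℓ) where
    field
      spanning    : ∀ x → Σ[ k ∈ Vector Carrier n ] (∀ i → InLeftNucleus (k i)) ×
                    (sum (λ i → k i * e i) ≈ x)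
      independent : ∀ (k : Vector Carrier n) → (∀ i → InLeftNucleus (k i)) →
                    sum (λ i → k i * e i) ≈ 0# → ∀ i → k i ≈ 0#

  record IsRightNuclearBasis {n : ℕ} (e : Vector Carrier n) : Set (c ⊔ ℓ) where
    field
      spanning    : ∀ x → Σ[ k ∈ Vector Carrier n ] (∀ i → InRightNucleus (k i)) ×
                    (sum (λ i → e i * k i) ≈ x)
      independent : ∀ (k : Vector Carrier n) → (∀ i → InRightNucleus (k i)) →
                    sum (λ i → e i * k i) ≈ 0# → ∀ i → k i ≈ 0#

  HasLeftNuclearDimension : ℕ → Set (c ⊔ ℓ)
  HasLeftNuclearDimension n = Σ[ e ∈ Vector Carrier n ] IsLeftNuclearBasis e

  HasRightNuclearDimension : ℕ → Set (c ⊔ ℓ)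
  HasRightNuclearDimension n = Σ[ e ∈ Vector Carrier n ] IsRightNuclearBasis e

record Quadruple (A : Set a) : Set a where
  constructor [_,_,_,_]
  field
    p₁ p₂ p₃ p₄ : A

module _ (m : ℕ) (L : FiniteField c ℓ (2 ℕ.^ m)) (s : ℕ) where
  open FiniteField L
  open RawSemiringDefinitions (RawRing.rawSemiring (CommutativeRing.rawRing commutativeRing))
    using (_^_)

  private
    σ : ℕ
    σ = 2 ℕ.^ s

    L⁺ : RawGroup c ℓ
    L⁺ = RawRing.+-rawGroup (CommutativeRing.rawRing commutativeRing)

    module L² = RawGroup (DirectProduct.rawGroup L⁺ L⁺)

  record Legitimate (t : Quadruple Carrier) : Set (c ⊔ ℓ) where
    open Quadruple t
    field
      p₁≉0   : p₁ ≉ 0#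
      noRoot : ∀ x → p₁ * x ^ (σ ℕ.+ 1) + p₂ * x ^ σ + p₃ * x + p₄ ≉ 0#

  -- The operations of B(2,m,s,0,t), where L = GF(2^m) and σ = 2^s.
  B : Quadruple Carrier → RawRingWithoutOne c ℓ
  B [ p₁ , p₂ , p₃ , p₄ ] = record
    { Carrier = L².Carrier
    ; _≈_     = L²._≈_
    ; _+_     = L²._∙_
    ; _*_     = λ (a , b) (c , d) →
        ( p₁ * a * c ^ σ + p₂ * b * c ^ σ + p₃ * a * d ^ σ + p₄ * b * d ^ σ
        , a * d + b * c
        )
    ; -_      = L²._⁻¹
    ; 0#      = L².ε
    }

{-# OPTIONS --safe #-}

-- In B(2,m,s,0,t) the scalars λ act on the left by diag(λ, λ) and on the right by diag(λ^σ, λ), which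
-- yields copies of L in both nuclei. If one nucleus were larger, the semifield would be associative,
-- hence a field by Wedderburn's theorem, in which both copies of L consist of the roots of X^q - X;
-- then σ would be trivial on L.
--
-- Conversely, by Wedderburn's theorem and counting, the nuclei are fields of the same order q = 2^m.
-- Right multiplications by the right nucleus are commuting linear maps over L, the left nucleus, and
-- are diagonalizable because X^q - X splits over L with simple roots. The eigenvalues on a common
-- eigenbasis w₁, w₂ are two isomorphisms onto L, which differ by a power σ of the Frobenius map. If
-- σ = 1, then S is two-dimensional over a central subfield, hence associative. Otherwise a suitable
-- basis of S over the right nucleus turns the second coordinate of the product into ad + bc, and the
-- first one is then p₁ac^σ + p₂bc^σ + p₃ad^σ + p₄bd^σ.
--
-- For Wedderburn's theorem, let E be a maximal commutative subfield of the skew field D. If D ≠ E, the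
-- same diagonalization yields w ∉ E with w u = u^(2^s) w for all u ∈ E; surjectivity of the norm
-- map of E allows one to achieve w^k = 1, so that w - 1 is a zero divisor.
module Submission where

open import Defs
open import Algebra.Bundles using (AbelianGroup; CommutativeRing; CommutativeSemigroup; NonAssociativeRing; Ring)
open import Algebra.Bundles.Raw using (RawRing; RawRingWithoutOne)
open import Algebra.Module.Bundles using (LeftModule)
import Algebra.Module.Construct.TensorUnit as TensorUnit
import Algebra.Morphism.RingMonomorphism as RingMonomorphism
open import Algebra.Morphism.Structures using (IsGroupIsomorphism; IsRingMonomorphism)
import Algebra.Properties.CommutativeMonoid.Sum as SumProperties
import Algebra.Properties.CommutativeSemigroup as CommutativeSemigroupProperties
import Algebra.Properties.CommutativeSemiring.Exp as CommutativeExp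
import Algebra.Properties.Group as GroupProperties
import Algebra.Properties.Semiring.Exp as Exp
import Algebra.Properties.Semiring.Mult as SemiringMult
import Algebra.Properties.Semiring.Sum as SemiringSum
open import Data.Empty using (⊥)
open import Data.Fin.Base using (Fin; zero; suc; combine; fromℕ<; punchIn; punchOut; remQuot; toℕ)
open import Data.Fin.Permutation using (Permutation; permutation; _⟨$⟩ʳ_; ↔⇒≡)
open import Data.Fin.Properties using (*↔×; <⇒notInjective; all?; any?; combine-remQuot; punchIn-injective; punchInᵢ≢i; punchOut-injective; remQuot-combine; toℕ-fromℕ<; toℕ<n) renaming (_≟_ to _≟ᶠ_)
open import Data.List.Base using (List; []; _∷_)
open import Data.List.Relation.Unary.All as All using (All; []; _∷_)
open import Data.Nat.Base as ℕ using (ℕ; zero; suc; z≤n; s≤s)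
open import Data.Nat.DivMod using (_/_; _%_; m≡m%n+[m/n]*n; m%n<n)
open import Data.Nat.GeneralisedArithmetic using (fold)
open import Data.Nat.Induction using (<-rec)
import Data.Nat.Properties as ℕₚ
open import Data.Nat.Tactic.RingSolver using (solve-∀)
open import Data.Product.Base using (∃; ∃-syntax; Σ-syntax; _×_; _,_; proj₁; proj₂; swap; uncurry)
open import Data.Product.Relation.Binary.Pointwise.NonDependent using (×-setoid)
open import Data.Sum.Base as Sum using (_⊎_; inj₁; inj₂)
open import Data.Vec.Functional using (Vector; removeAt; replicate)
open import Function.Base using (_∘_; _on_; flip; id)
open import Function.Bundles using (Inverse; _⇔_; mk⇔)
import Function.Construct.Identity as Identity
open import Function.Definitions using (Congruent; Injective)
open import Level using (Level; 0ℓ; _⊔_)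
open import Relation.Binary.Bundles using (Setoid)
import Relation.Binary.Construct.On as On
open import Relation.Binary.Definitions using (_Respects_; tri<; tri≈; tri>) renaming (Decidable to Decidable₂)
open import Relation.Binary.PropositionalEquality.Core as ≡ using (_≡_; _≢_)
open import Relation.Binary.PropositionalEquality.Properties using () renaming (setoid to ≡-setoid)
import Relation.Binary.Reasoning.Setoid as SetoidReasoning
open import Relation.Nullary using (¬_; Dec; yes; no; contradiction)
open import Relation.Nullary.Decidable using (¬?; decidable-stable; map′)
open import Relation.Unary using (Pred; Decidable)

-- Two counting principles carry the argument: an injection between finite sets of equal size is
-- onto, and a polynomial function with n coefficients whose values at n distinct points lie in a
-- submodule takes all its values there. As coefficients may be vectors, the second principle yields
-- bounds on exponents, eigenvectors outside a given submodule, and the zero-divisor contradiction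
-- in Wedderburn's theorem alike.
--
-- The obstacle is that the two nuclei are fields with no isomorphism given beforehand. The
-- eigenvalues on a common eigenvector supply one, and comparing two of these leaves an automorphism
-- σ of `L`, which has to be recognized as a power map. The sums of σ(x) x^e over all x do this:
-- they cannot all vanish, and a nonzero one forces σ(v) = v^(-e) for v ≠ 0.
--
-- Right nuclei are handled as left nuclei of the opposite semifield. Starting from the nuclei, one
-- obtains 0 < s < m; starting from an isotopism, an s between m and 2m is lowered by m, because the
-- m-th power of the Frobenius map is the identity on `L`.

private
  variable
    a b c ℓ ℓ₁ ℓ₂ mᵥ ℓᵥ p : Level

-- Finite setoids

-- If `y` were missed, it could be punched out of the codomain, leaving an injection into a smaller
-- set.
finInjective⇒surjective : ∀ {n} {f : Fin n → Fin n} → Injective _≡_ _≡_ f → ∀ y → ∃[ x ] f x ≡ y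
finInjective⇒surjective {suc n} {f} inj y with any? (λ x → f x ≟ᶠ y)
... | yes r = r
... | no ¬r = contradiction
  (λ {i} {j} eq → inj (punchOut-injective (avoid i) (avoid j) eq))
  (<⇒notInjective {f = λ x → punchOut (avoid x)} (ℕₚ.n<1+n n))
  where
  avoid : ∀ x → y ≢ f x
  avoid x eq = ¬r (x , ≡.sym eq)

module HasSizeProperties {A : Setoid a ℓ} {n} (size : HasSize A n) where
  open Setoid A
  open Inverse size

  from∘to : ∀ x → from (to x) ≈ x
  from∘to = strictlyInverseʳ

  to∘from : ∀ i → to (from i) ≡ i
  to∘from = strictlyInverseˡ

  to-injective : ∀ {x y} → to x ≡ to y → x ≈ y
  to-injective {x} {y} eq = trans (sym (from∘to x)) (trans (from-cong eq) (from∘to y))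

  from-injective : ∀ {i j} → from i ≈ from j → i ≡ j
  from-injective {i} {j} eq = ≡.trans (≡.sym (to∘from i)) (≡.trans (to-cong eq) (to∘from j))

  infix 4 _≟_
  _≟_ : Decidable₂ _≈_
  x ≟ y = map′ to-injective to-cong (to x ≟ᶠ to y)

  module _ {P : Pred Carrier p} (resp : P Respects _≈_) (P? : Decidable P) where

    ∀? : Dec (∀ x → P x)
    ∀? = map′ (λ h x → resp (from∘to x) (h (to x))) (λ h i → h (from i)) (all? (λ i → P? (from i)))

    ∃? : Dec (∃ P)
    ∃? = map′ (λ (i , p) → from i , p) (λ (x , p) → to x , resp (sym (from∘to x)) p)
              (any? (λ i → P? (from i)))

module _ {A : Setoid a ℓ₁} {B : Setoid b ℓ₂} where
  private
    module A = Setoid A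
    module B = Setoid B

  module _ {n} (sizeA : HasSize A n) where
    private module HA = HasSizeProperties sizeA

    hasSize-bijection : (f : A.Carrier → B.Carrier) → Congruent A._≈_ B._≈_ f →
      Injective A._≈_ B._≈_ f → (∀ y → ∃[ x ] f x B.≈ y) → HasSize B n
    hasSize-bijection f cong-f inj surj = record
      { to        = λ y → sA.to (g y)
      ; from      = λ i → f (sA.from i)
      ; to-cong   = λ {x} {y} eq → sA.to-cong
          (inj (B.trans (proj₂ (surj x)) (B.trans eq (B.sym (proj₂ (surj y))))))
      ; from-cong = λ { ≡.refl → B.refl }
      ; inverse   =
          (λ { {i} eq → ≡.trans (sA.to-cong (inj (B.trans (proj₂ (surj _)) eq))) (HA.to∘from i) })
        , (λ { {y} ≡.refl → B.trans (cong-f (HA.from∘to (g y))) (proj₂ (surj y)) })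
      }
      where
      module sA = Inverse sizeA
      g : B.Carrier → A.Carrier
      g y = proj₁ (surj y)

    -- The source of inverses, coordinates and dual bases below: injectivity comes from cancellation
    -- or independence, and the sizes agree.
    injective⇒surjective : HasSize B n → (f : A.Carrier → B.Carrier) →
      Injective A._≈_ B._≈_ f → ∀ y → ∃[ x ] f x B.≈ y
    injective⇒surjective sizeB f inj y =
      let i , eq = finInjective⇒surjective
                     {f = λ i → sB.to (f (sA.from i))}
                     (λ eq → HA.from-injective (inj (HB.to-injective eq))) (sB.to y)
      in sA.from i , HB.to-injective eq
      where
      module sA = Inverse sizeA
      module sB = Inverse sizeB
      module HB = HasSizeProperties sizeB

    hasSize-× : ∀ {m} → HasSize B m → HasSize (×-setoid A B) (n ℕ.* m)
    hasSize-× {m} sizeB = record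
      { to        = λ (x , y) → combine (sA.to x) (sB.to y)
      ; from      = λ k → let i , j = remQuot {n} m k in sA.from i , sB.from j
      ; to-cong   = λ (eq₁ , eq₂) → ≡.cong₂ combine (sA.to-cong eq₁) (sB.to-cong eq₂)
      ; from-cong = λ { ≡.refl → A.refl , B.refl }
      ; inverse   =
          (λ { {k} (eq₁ , eq₂) → ≡.trans
               (≡.cong₂ combine (≡.trans (sA.to-cong eq₁) (HA.to∘from _)) (≡.trans (sB.to-cong eq₂) (HB.to∘from _)))
               (Inverse.strictlyInverseʳ (*↔× {n} {m}) k) })
        , (λ { {x , y} ≡.refl → let eq = Inverse.strictlyInverseˡ (*↔× {n} {m}) (sA.to x , sB.to y) in
                A.trans (sA.from-cong (≡.cong proj₁ eq)) (HA.from∘to x)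
              , B.trans (sB.from-cong (≡.cong proj₂ eq)) (HB.from∘to y) })
      }
      where
      module sA = Inverse sizeA
      module sB = Inverse sizeB
      module HB = HasSizeProperties sizeB

hasSize-unique : ∀ {A : Setoid a ℓ} {m n} → HasSize A m → HasSize A n → m ≡ n
hasSize-unique {A = A} sm sn = ↔⇒≡ record
  { to        = λ i → N.to (M.from i)
  ; from      = λ j → M.to (N.from j)
  ; to-cong   = ≡.cong _
  ; from-cong = ≡.cong _
  ; inverse   = (λ { ≡.refl → ≡.trans (N.to-cong (HM.from∘to _)) (HN.to∘from _) })
              , (λ { ≡.refl → ≡.trans (M.to-cong (HN.from∘to _)) (HM.to∘from _) })
  }
  where
  module M = Inverse sm
  module N = Inverse sn
  module HM = HasSizeProperties sm
  module HN = HasSizeProperties sn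

-- Polynomial functions

-- Coefficients lie in a module over the field: the eigenvector argument needs polynomials with
-- coefficients R^i v, and Wedderburn's theorem needs coefficients in the skew field.
module PolynomialFunctions {q} (L : FiniteField c ℓ q)
  (M : LeftModule (CommutativeRing.ring (FiniteField.commutativeRing L)) mᵥ ℓᵥ) where

  open FiniteField L hiding (zero)
  open LeftModule M
  open import Algebra.Properties.Semiring.Exp (CommutativeRing.semiring commutativeRing) using (_^_)
  open SetoidReasoning ≈ᴹ-setoid
  open GroupProperties (Ring.+-group (CommutativeRing.ring commutativeRing)) using (x∙y⁻¹≈ε⇒x≈y)

  record IsSubmodule (W : Pred Carrierᴹ p) : Set (c ⊔ mᵥ ⊔ ℓᵥ ⊔ p) where
    field
      resp      : W Respects _≈ᴹ_
      0-closed  : W 0ᴹ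
      +-closed  : ∀ {u v} → W u → W v → W (u +ᴹ v)
      *ₗ-closed : ∀ a {v} → W v → W (a *ₗ v)

    cancel : ∀ {u v} → W u → W (u +ᴹ v) → W v
    cancel {u} {v} wu wuv = resp lemma (+-closed (*ₗ-closed (- 1#) wu) wuv)
      where
      lemma : (- 1#) *ₗ u +ᴹ (u +ᴹ v) ≈ᴹ v
      lemma = begin
        (- 1#) *ₗ u +ᴹ (u +ᴹ v)        ≈⟨ +ᴹ-assoc _ _ _ ⟨
        ((- 1#) *ₗ u +ᴹ u) +ᴹ v        ≈⟨ +ᴹ-congʳ (+ᴹ-congˡ (*ₗ-identityˡ u)) ⟨
        ((- 1#) *ₗ u +ᴹ 1# *ₗ u) +ᴹ v  ≈⟨ +ᴹ-congʳ (*ₗ-distribʳ _ _ _) ⟨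
        (- 1# + 1#) *ₗ u +ᴹ v          ≈⟨ +ᴹ-congʳ (*ₗ-congʳ (-‿inverseˡ 1#)) ⟩
        0# *ₗ u +ᴹ v                   ≈⟨ +ᴹ-congʳ (*ₗ-zeroˡ u) ⟩
        0ᴹ +ᴹ v                        ≈⟨ +ᴹ-identityˡ v ⟩
        v                              ∎

    unscale : ∀ {a v} → a ≉ 0# → W (a *ₗ v) → W v
    unscale {a} {v} a≉0 w = resp
      (≈ᴹ-trans (≈ᴹ-sym (*ₗ-assoc _ _ _)) (≈ᴹ-trans (*ₗ-congʳ (proj₁ (proj₂ (invertible a a≉0)))) (*ₗ-identityˡ v)))
      (*ₗ-closed (proj₁ (invertible a a≉0)) w)

  zero-isSubmodule : IsSubmodule (_≈ᴹ 0ᴹ)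
  zero-isSubmodule = record
    { resp      = λ eq p → ≈ᴹ-trans (≈ᴹ-sym eq) p
    ; 0-closed  = ≈ᴹ-refl
    ; +-closed  = λ p q → ≈ᴹ-trans (+ᴹ-cong p q) (+ᴹ-identityˡ 0ᴹ)
    ; *ₗ-closed = λ a p → ≈ᴹ-trans (*ₗ-congˡ p) (*ₗ-zeroʳ a)
    }

  -- n is the number of coefficients, so that the degree is less than n.
  data IsPolynomial : ℕ → (Carrier → Carrierᴹ) → Set (c ⊔ mᵥ ⊔ ℓᵥ) where
    nil  : ∀ {f} → (∀ t → f t ≈ᴹ 0ᴹ) → IsPolynomial 0 f
    cons : ∀ {n f g} v → IsPolynomial n g → (∀ t → f t ≈ᴹ v +ᴹ t *ₗ g t) → IsPolynomial (suc n) f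

  isPolynomial-cong : ∀ {n f g} → (∀ t → f t ≈ᴹ g t) → IsPolynomial n f → IsPolynomial n g
  isPolynomial-cong eq (nil p)      = nil (λ t → ≈ᴹ-trans (≈ᴹ-sym (eq t)) (p t))
  isPolynomial-cong eq (cons v q p) = cons v q (λ t → ≈ᴹ-trans (≈ᴹ-sym (eq t)) (p t))

  isPolynomial-0 : ∀ n {f} → (∀ t → f t ≈ᴹ 0ᴹ) → IsPolynomial n f
  isPolynomial-0 zero    p = nil p
  isPolynomial-0 (suc n) p = cons 0ᴹ (isPolynomial-0 n (λ t → ≈ᴹ-refl)) λ t →
    ≈ᴹ-trans (p t) (≈ᴹ-sym (≈ᴹ-trans (+ᴹ-congˡ (*ₗ-zeroʳ t)) (+ᴹ-identityˡ 0ᴹ)))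

  isPolynomial-weaken : ∀ {n k f} → n ℕ.≤ k → IsPolynomial n f → IsPolynomial k f
  isPolynomial-weaken {k = k} z≤n (nil p)        = isPolynomial-0 k p
  isPolynomial-weaken (s≤s n≤k)   (cons v q p)   = cons v (isPolynomial-weaken n≤k q) p

  isPolynomial-shift : ∀ {n f} → IsPolynomial n f → IsPolynomial (suc n) (λ t → t *ₗ f t)
  isPolynomial-shift q = cons 0ᴹ q (λ t → ≈ᴹ-sym (+ᴹ-identityˡ _))

  isPolynomial-monomial : ∀ k v → IsPolynomial (suc k) (λ t → (t ^ k) *ₗ v)
  isPolynomial-monomial zero v = cons v (nil (λ t → ≈ᴹ-refl)) λ t →
    ≈ᴹ-trans (*ₗ-identityˡ v) (≈ᴹ-sym (≈ᴹ-trans (+ᴹ-congˡ (*ₗ-zeroʳ t)) (+ᴹ-identityʳ v)))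
  isPolynomial-monomial (suc k) v =
    isPolynomial-cong (λ t → ≈ᴹ-sym (*ₗ-assoc _ _ _)) (isPolynomial-shift (isPolynomial-monomial k v))

  isPolynomial-+ : ∀ {n f g} → IsPolynomial n f → IsPolynomial n g → IsPolynomial n (λ t → f t +ᴹ g t)
  isPolynomial-+ (nil p) (nil q) = nil (λ t → ≈ᴹ-trans (+ᴹ-cong (p t) (q t)) (+ᴹ-identityˡ 0ᴹ))
  isPolynomial-+ (cons {g = f′} u p eqf) (cons {g = g′} v q eqg) = cons (u +ᴹ v) (isPolynomial-+ p q) λ t → begin
    _                                            ≈⟨ +ᴹ-cong (eqf t) (eqg t) ⟩
    (u +ᴹ t *ₗ f′ t) +ᴹ (v +ᴹ t *ₗ g′ t)         ≈⟨ +ᴹ-assoc _ _ _ ⟩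
    u +ᴹ (t *ₗ f′ t +ᴹ (v +ᴹ t *ₗ g′ t))         ≈⟨ +ᴹ-congˡ (+ᴹ-assoc _ _ _) ⟨
    u +ᴹ ((t *ₗ f′ t +ᴹ v) +ᴹ t *ₗ g′ t)         ≈⟨ +ᴹ-congˡ (+ᴹ-congʳ (+ᴹ-comm _ _)) ⟩
    u +ᴹ ((v +ᴹ t *ₗ f′ t) +ᴹ t *ₗ g′ t)         ≈⟨ +ᴹ-congˡ (+ᴹ-assoc _ _ _) ⟩
    u +ᴹ (v +ᴹ (t *ₗ f′ t +ᴹ t *ₗ g′ t))         ≈⟨ +ᴹ-assoc _ _ _ ⟨
    (u +ᴹ v) +ᴹ (t *ₗ f′ t +ᴹ t *ₗ g′ t)         ≈⟨ +ᴹ-congˡ (*ₗ-distribˡ _ _ _) ⟨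
    (u +ᴹ v) +ᴹ t *ₗ (f′ t +ᴹ g′ t)              ∎

  -- Synthetic division on the Horner form: from `h t = h a + (t - a) k t` follows
  -- `v + t h t = f a + (t - a) (h a + t k t)`.
  isPolynomial-divide : ∀ {n f} → IsPolynomial (suc n) f → ∀ a →
    ∃[ g ] IsPolynomial n g × (∀ t → f t ≈ᴹ f a +ᴹ (t - a) *ₗ g t)
  isPolynomial-divide {f = f} (cons {g = h} v (nil p) eq) a = (λ _ → 0ᴹ) , nil (λ _ → ≈ᴹ-refl) , λ t → begin
    f t                        ≈⟨ f≈v t ⟩
    v                          ≈⟨ f≈v a ⟨
    f a                        ≈⟨ +ᴹ-identityʳ _ ⟨
    f a +ᴹ 0ᴹ                  ≈⟨ +ᴹ-congˡ (*ₗ-zeroʳ _) ⟨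
    f a +ᴹ (t - a) *ₗ 0ᴹ       ∎
    where
    f≈v : ∀ t → f t ≈ᴹ v
    f≈v t = begin
      f t             ≈⟨ eq t ⟩
      v +ᴹ t *ₗ h t   ≈⟨ +ᴹ-congˡ (*ₗ-congˡ (p t)) ⟩
      v +ᴹ t *ₗ 0ᴹ    ≈⟨ +ᴹ-congˡ (*ₗ-zeroʳ t) ⟩
      v +ᴹ 0ᴹ         ≈⟨ +ᴹ-identityʳ v ⟩
      v               ∎
  isPolynomial-divide {suc n} {f} (cons {g = h} v q@(cons _ _ _) eq) a
    with k , kpoly , keq ← isPolynomial-divide q a =
    (λ t → h a +ᴹ t *ₗ k t) , cons (h a) kpoly (λ _ → ≈ᴹ-refl) , λ t → begin
    f t                                                  ≈⟨ eq t ⟩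
    v +ᴹ t *ₗ h t                                        ≈⟨ +ᴹ-congˡ (*ₗ-congˡ (keq t)) ⟩
    v +ᴹ t *ₗ (h a +ᴹ (t - a) *ₗ k t)                    ≈⟨ +ᴹ-congˡ (*ₗ-distribˡ _ _ _) ⟩
    v +ᴹ (t *ₗ h a +ᴹ t *ₗ (t - a) *ₗ k t)               ≈⟨ +ᴹ-congˡ (+ᴹ-cong (*ₗ-congʳ (split t)) (exchange t)) ⟩
    v +ᴹ ((a + (t - a)) *ₗ h a +ᴹ (t - a) *ₗ t *ₗ k t)   ≈⟨ +ᴹ-congˡ (+ᴹ-congʳ (*ₗ-distribʳ _ _ _)) ⟩
    v +ᴹ ((a *ₗ h a +ᴹ (t - a) *ₗ h a) +ᴹ (t - a) *ₗ t *ₗ k t) ≈⟨ +ᴹ-congˡ (+ᴹ-assoc _ _ _) ⟩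
    v +ᴹ (a *ₗ h a +ᴹ ((t - a) *ₗ h a +ᴹ (t - a) *ₗ t *ₗ k t)) ≈⟨ +ᴹ-assoc _ _ _ ⟨
    (v +ᴹ a *ₗ h a) +ᴹ ((t - a) *ₗ h a +ᴹ (t - a) *ₗ t *ₗ k t) ≈⟨ +ᴹ-cong (≈ᴹ-sym (eq a)) (≈ᴹ-sym (*ₗ-distribˡ _ _ _)) ⟩
    f a +ᴹ (t - a) *ₗ (h a +ᴹ t *ₗ k t)                  ∎
    where
    split : ∀ t → t ≈ a + (t - a)
    split t = trans (sym (trans (+-congˡ (-‿inverseˡ a)) (+-identityʳ t)))
                    (trans (sym (+-assoc t (- a) a)) (+-comm _ a))
    exchange : ∀ t {w} → t *ₗ (t - a) *ₗ w ≈ᴹ (t - a) *ₗ t *ₗ w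
    exchange t = ≈ᴹ-trans (≈ᴹ-sym (*ₗ-assoc _ _ _)) (≈ᴹ-trans (*ₗ-congʳ (*-comm _ _)) (*ₗ-assoc _ _ _))

  module _ {W : Pred Carrierᴹ p} (W-isSubmodule : IsSubmodule W) where
    open IsSubmodule W-isSubmodule

    -- Roots are counted modulo `W`. After the factor `t - x₀` is split off, the quotient has its
    -- values at the other points in `W`, because `t - x₀` is invertible there. For `W = 0` this is
    -- the usual bound; other `W` serve to find vectors outside `W`.
    tooManyRoots : ∀ {n f} → IsPolynomial n f → (x : Vector Carrier n) → (∀ {i j} → x i ≈ x j → i ≡ j) →
                   (∀ i → W (f (x i))) → ∀ t → W (f t)
    tooManyRoots (nil p) x inj root t = resp (≈ᴹ-sym (p t)) 0-closed
    tooManyRoots {suc n} {f} fpoly@(cons _ _ _) x inj root t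
      with g , gpoly , eq ← isPolynomial-divide fpoly (x zero) =
      resp (≈ᴹ-sym (eq t)) (+-closed (root zero) (*ₗ-closed _
        (tooManyRoots gpoly (x ∘ suc) (suc-inj ∘ inj) groot t)))
      where
      suc-inj : ∀ {i j : Fin n} → suc i ≡ suc j → i ≡ j
      suc-inj _≡_.refl = _≡_.refl
      groot : ∀ i → W (g (x (suc i)))
      groot i = unscale (λ eq₀ → contradiction (inj (x∙y⁻¹≈ε⇒x≈y _ _ eq₀)) λ ())
        (cancel (root zero) (resp (eq (x (suc i))) (root (suc i))))

-- Finite fields

parity : ∀ n → ∃[ k ] (n ≡ k ℕ.+ k ⊎ n ≡ suc (k ℕ.+ k))
parity zero = 0 , inj₁ ≡.refl
parity (suc n) with parity n
... | k , inj₁ ≡.refl = k , inj₂ ≡.refl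
... | k , inj₂ ≡.refl = suc k , inj₁ (≡.cong suc (≡.sym (ℕₚ.+-suc k k)))

2^≡1+pred : ∀ m → 2 ℕ.^ m ≡ suc (ℕ.pred (2 ℕ.^ m))
2^≡1+pred m = ≡.sym (ℕₚ.suc-pred (2 ℕ.^ m) {{ℕₚ.m^n≢0 2 m}})

distinct⇒1≤ : ∀ {k} {i j : Fin (suc k)} → i ≢ j → 1 ℕ.≤ k
distinct⇒1≤ {zero}  {zero} {zero} i≢j = contradiction ≡.refl i≢j
distinct⇒1≤ {suc k} i≢j = s≤s z≤n

-- `n` is the order of the multiplicative group. Keeping `q ≡ suc n` as an equation allows `q` to be
-- `2 ^ m`.
module FieldProperties {q} (L : FiniteField c ℓ q) {n} (q≡1+n : q ≡ suc n) where
  open FiniteField L hiding (zero)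
  open Exp semiring public
  open CommutativeExp commutativeSemiring public using (^-distrib-*)
  open SetoidReasoning setoid
  open PolynomialFunctions L TensorUnit.leftModule public

  size′ : HasSize setoid (suc n)
  size′ = ≡.subst (HasSize setoid) q≡1+n size

  open HasSizeProperties size′ public using (_≟_)
  private
    module E = Inverse size′
    module H = HasSizeProperties size′
    module Σ* = SumProperties *-commutativeMonoid
    module Σ+ = SumProperties +-commutativeMonoid

  infix 30 _⁻¹⟨_⟩
  _⁻¹⟨_⟩ : ∀ x → x ≉ 0# → Carrier
  x ⁻¹⟨ x≉0 ⟩ = proj₁ (invertible x x≉0)

  inverseˡ : ∀ {x} (x≉0 : x ≉ 0#) → x ⁻¹⟨ x≉0 ⟩ * x ≈ 1#
  inverseˡ x≉0 = proj₁ (proj₂ (invertible _ x≉0))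

  inverseʳ : ∀ {x} (x≉0 : x ≉ 0#) → x * x ⁻¹⟨ x≉0 ⟩ ≈ 1#
  inverseʳ x≉0 = proj₂ (proj₂ (invertible _ x≉0))

  *-cancelˡ : ∀ {x y z} → x ≉ 0# → x * y ≈ x * z → y ≈ z
  *-cancelˡ {x} {y} {z} x≉0 eq = begin
    y                        ≈⟨ *-identityˡ y ⟨
    1# * y                   ≈⟨ *-congʳ (inverseˡ x≉0) ⟨
    x ⁻¹⟨ x≉0 ⟩ * x * y      ≈⟨ *-assoc _ _ _ ⟩
    x ⁻¹⟨ x≉0 ⟩ * (x * y)    ≈⟨ *-congˡ eq ⟩
    x ⁻¹⟨ x≉0 ⟩ * (x * z)    ≈⟨ *-assoc _ _ _ ⟨
    x ⁻¹⟨ x≉0 ⟩ * x * z      ≈⟨ *-congʳ (inverseˡ x≉0) ⟩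
    1# * z                   ≈⟨ *-identityˡ z ⟩
    z                        ∎

  *-nonZero : ∀ {x y} → x ≉ 0# → y ≉ 0# → x * y ≉ 0#
  *-nonZero x≉0 y≉0 eq = y≉0 (*-cancelˡ x≉0 (trans eq (sym (zeroʳ _))))

  ^-nonZero : ∀ {x} k → x ≉ 0# → x ^ k ≉ 0#
  ^-nonZero zero    x≉0 = 1≉0
  ^-nonZero (suc k) x≉0 = *-nonZero x≉0 (^-nonZero k x≉0)

  0^ : ∀ {k} → 1 ℕ.≤ k → 0# ^ k ≈ 0#
  0^ (s≤s _) = zeroˡ _

  1^ : ∀ k → 1# ^ k ≈ 1#
  1^ zero    = refl
  1^ (suc k) = trans (*-identityˡ _) (1^ k)

  avoiding : Carrier → Vector Carrier n
  avoiding a i = E.from (punchIn (E.to a) i)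

  avoiding-injective : ∀ a {i j} → avoiding a i ≈ avoiding a j → i ≡ j
  avoiding-injective a eq = punchIn-injective (E.to a) _ _ (H.from-injective eq)

  avoiding-≉ : ∀ a i → avoiding a i ≉ a
  avoiding-≉ a i eq = punchInᵢ≢i (E.to a) i (≡.trans (≡.sym (H.to∘from _)) (E.to-cong eq))

  -- Leaving out `a` keeps exactly `n` points. The gain is the value at `a`, chosen in each use so
  -- that it is visibly nonzero.
  vanishing : ∀ {f k} a → IsPolynomial k f → k ℕ.≤ n → (∀ x → x ≉ a → f x ≈ 0#) → ∀ x → f x ≈ 0#
  vanishing a fpoly k≤n root = tooManyRoots zero-isSubmodule (isPolynomial-weaken k≤n fpoly)
    (avoiding a) (avoiding-injective a) (λ i → root _ (avoiding-≉ a i))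

  1≤n : 1 ℕ.≤ n
  1≤n = distinct⇒1≤ (1≉0 ∘ H.to-injective)

  private
    permute : (f g : Carrier → Carrier) → (∀ {x y} → x ≈ y → f x ≈ f y) → (∀ {x y} → x ≈ y → g x ≈ g y) →
              (∀ x → f (g x) ≈ x) → (∀ x → g (f x) ≈ x) → Permutation (suc n) (suc n)
    permute f g f-cong g-cong fg gf = permutation (λ i → E.to (f (E.from i))) (λ i → E.to (g (E.from i)))
      (λ i → ≡.trans (E.to-cong (trans (f-cong (H.from∘to _)) (fg _))) (H.to∘from i))
      (λ i → ≡.trans (E.to-cong (trans (g-cong (H.from∘to _)) (gf _))) (H.to∘from i))

    scaling : ∀ {u} → u ≉ 0# → Permutation (suc n) (suc n)
    scaling {u} u≉0 = permute (u *_) (u ⁻¹⟨ u≉0 ⟩ *_) *-congˡ *-congˡ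
      (λ x → trans (sym (*-assoc _ _ _)) (trans (*-congʳ (inverseʳ u≉0)) (*-identityˡ x)))
      (λ x → trans (sym (*-assoc _ _ _)) (trans (*-congʳ (inverseˡ u≉0)) (*-identityˡ x)))

    scaling-from : ∀ {u} (u≉0 : u ≉ 0#) i → E.from (scaling u≉0 ⟨$⟩ʳ i) ≈ u * E.from i
    scaling-from u≉0 i = H.from∘to _

  -- The product of the nonzero elements is invariant under multiplication by `u`. To work with one
  -- product over the whole carrier, `g` replaces 0 by 1, and `h` supplies the factor `u` away from
  -- 0 and 1 at 0.
  fermat : ∀ {u} → u ≉ 0# → u ^ n ≈ 1#
  fermat {u} u≉0 = *-cancelˡ ∏g≉0 (begin
    ∏g * u ^ n            ≈⟨ *-comm _ _ ⟩
    u ^ n * ∏g            ≈⟨ *-congʳ ∏h ⟨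
    Σ*.sum h * ∏g         ≈⟨ Σ*.∑-distrib-+ h (g ∘ E.from) ⟨
    Σ*.sum (λ i → h i * g (E.from i))  ≈⟨ Σ*.sum-cong-≋ shifted ⟨
    Σ*.sum (λ i → g (E.from (scaling u≉0 ⟨$⟩ʳ i)))  ≈⟨ Σ*.sum-permute (g ∘ E.from) (scaling u≉0) ⟨
    ∏g                    ≈⟨ *-identityʳ _ ⟨
    ∏g * 1#               ∎)
    where
    g : Carrier → Carrier
    g x with x ≟ 0#
    ... | yes _ = 1#
    ... | no  _ = x
    h′ : Carrier → Carrier
    h′ x with x ≟ 0#
    ... | yes _ = 1#
    ... | no  _ = u
    h : Vector Carrier (suc n)
    h i = h′ (E.from i)
    g≉0 : ∀ x → g x ≉ 0#
    g≉0 x with x ≟ 0#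
    ... | yes _  = 1≉0
    ... | no x≉0 = x≉0
    g-shift : ∀ x y → y ≈ u * x → g y ≈ h′ x * g x
    g-shift x y eq with x ≟ 0# | y ≟ 0#
    ... | yes _   | yes _   = sym (*-identityˡ _)
    ... | yes x≈0 | no y≉0  = contradiction (trans eq (trans (*-congˡ x≈0) (zeroʳ u))) y≉0
    ... | no x≉0  | yes y≈0 = contradiction (trans (sym eq) y≈0) (*-nonZero u≉0 x≉0)
    ... | no _    | no _    = eq
    shifted : ∀ i → g (E.from (scaling u≉0 ⟨$⟩ʳ i)) ≈ h i * g (E.from i)
    shifted i = g-shift _ _ (scaling-from u≉0 i)
    ∏g : Carrier
    ∏g = Σ*.sum (g ∘ E.from)
    ∏-nonZero : ∀ {k} (f : Vector Carrier k) → (∀ i → f i ≉ 0#) → Σ*.sum f ≉ 0#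
    ∏-nonZero {zero}  f f≉0 = 1≉0
    ∏-nonZero {suc k} f f≉0 = *-nonZero (f≉0 zero) (∏-nonZero (f ∘ suc) (f≉0 ∘ suc))
    ∏g≉0 : ∏g ≉ 0#
    ∏g≉0 = ∏-nonZero (g ∘ E.from) (λ i → g≉0 (E.from i))
    h′0 : ∀ x → x ≈ 0# → h′ x ≈ 1#
    h′0 x x≈0 with x ≟ 0#
    ... | yes _  = refl
    ... | no x≉0 = contradiction x≈0 x≉0
    h′u : ∀ x → x ≉ 0# → h′ x ≈ u
    h′u x x≉0 with x ≟ 0#
    ... | yes x≈0 = contradiction x≈0 x≉0
    ... | no _    = refl
    ∏h : Σ*.sum h ≈ u ^ n
    ∏h = begin
      Σ*.sum h                                     ≈⟨ Σ*.sum-remove {i = E.to 0#} h ⟩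
      h (E.to 0#) * Σ*.sum (removeAt h (E.to 0#))  ≈⟨ *-cong (h′0 _ (H.from∘to 0#))
                                                       (Σ*.sum-cong-≋ (λ i → h′u _ (avoiding-≉ 0# i))) ⟩
      1# * Σ*.sum (replicate n u)                  ≈⟨ *-identityˡ _ ⟩
      Σ*.sum (replicate n u)                       ≈⟨ Σ*.sum-replicate n ⟩
      u ^ n                                        ∎

  ^q : ∀ u → u ^ suc n ≈ u
  ^q u with u ≟ 0#
  ... | yes u≈0 = trans (*-congʳ u≈0) (trans (zeroˡ _) (sym u≈0))
  ... | no u≉0  = trans (*-congˡ (fermat u≉0)) (*-identityʳ u)

  module _ where
    open SemiringMult semiring using (×1-homo-*) renaming (_×_ to _·_)

    -- Adding 1 permutes the elements, so their sum does not change when `suc n` ones are added to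
    -- it.
    size·1≈0 : suc n · 1# ≈ 0#
    size·1≈0 = trans (sym (Σ+.sum-replicate (suc n)))
      (identityʳ-unique total (Σ+.sum (replicate (suc n) 1#)) (begin
        total + Σ+.sum (replicate (suc n) 1#)           ≈⟨ Σ+.∑-distrib-+ E.from (replicate (suc n) 1#) ⟨
        Σ+.sum (λ i → E.from i + 1#)                    ≈⟨ Σ+.sum-cong-≋ (λ i → H.from∘to (E.from i + 1#)) ⟨
        Σ+.sum (λ i → E.from (shift ⟨$⟩ʳ i))            ≈⟨ Σ+.sum-permute E.from shift ⟨
        total                                           ∎))
      where
      open import Algebra.Properties.Group (Ring.+-group (CommutativeRing.ring commutativeRing))
        using (identityʳ-unique)
      total : Carrier
      total = Σ+.sum E.from
      shift : Permutation (suc n) (suc n)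
      shift = permute (_+ 1#) (_+ - 1#) +-congʳ +-congʳ
        (λ x → trans (+-assoc _ _ _) (trans (+-congˡ (-‿inverseˡ 1#)) (+-identityʳ x)))
        (λ x → trans (+-assoc _ _ _) (trans (+-congˡ (-‿inverseʳ 1#)) (+-identityʳ x)))

    -- If 2 were nonzero, so would be its power `2 ^ m`, against `size·1≈0`.
    1+1≈0 : ∀ m → q ≡ 2 ℕ.^ m → 1# + 1# ≈ 0#
    1+1≈0 m q≡2^m with (1# + 1#) ≟ 0#
    ... | yes eq = eq
    ... | no neq = contradiction
      (≡.subst (λ k → k · 1# ≈ 0#) (≡.trans (≡.sym q≡1+n) q≡2^m) size·1≈0) (2^·1≉0 m)
      where
      2^·1≉0 : ∀ k → (2 ℕ.^ k) · 1# ≉ 0#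
      2^·1≉0 zero    eq = 1≉0 (trans (sym (+-identityʳ 1#)) eq)
      2^·1≉0 (suc k) eq = *-nonZero (neq ∘ trans (+-congˡ (sym (+-identityʳ 1#)))) (2^·1≉0 k)
        (trans (sym (×1-homo-* 2 (2 ℕ.^ k))) eq)

  -- The polynomial x^k - 1 has at most `n` coefficients, so vanishing at all nonzero elements would
  -- force it to vanish at 0, where it is -1.
  ¬pow≈1 : ∀ {k} → 1 ℕ.≤ k → k ℕ.< n → ¬ (∀ x → x ≉ 0# → x ^ k ≈ 1#)
  ¬pow≈1 {k} 1≤k k<n all1 = 1≉0 (begin
    1#                  ≈⟨ -‿involutive 1# ⟨
    - - 1#              ≈⟨ -‿cong minus1 ⟩
    - 0#                ≈⟨ -0#≈0# ⟩
    0#                  ∎)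
    where
    open import Algebra.Properties.Ring (CommutativeRing.ring commutativeRing) using (-‿involutive; -0#≈0#)
    f : Carrier → Carrier
    f x = x ^ k * 1# + 1# * (- 1#)
    f-poly : IsPolynomial (suc k) f
    f-poly = isPolynomial-+ (isPolynomial-monomial k 1#)
      (isPolynomial-weaken (s≤s z≤n) (isPolynomial-monomial 0 (- 1#)))
    minus1 : - 1# ≈ 0#
    minus1 = begin
      - 1#                        ≈⟨ *-identityˡ _ ⟨
      1# * - 1#                   ≈⟨ +-identityˡ _ ⟨
      0# + 1# * - 1#              ≈⟨ +-congʳ (trans (*-identityʳ _) (0^ 1≤k)) ⟨
      f 0#                        ≈⟨ vanishing 0# f-poly k<n (λ x x≉0 →
                                       trans (+-cong (trans (*-identityʳ _) (all1 x x≉0)) (*-identityˡ _)) (-‿inverseʳ 1#)) 0# ⟩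
      0#                          ∎

  ¬frobenius≈id : ∀ {s} → 1 ℕ.≤ s → 2 ℕ.^ s ℕ.< q → ¬ (∀ x → x ^ (2 ℕ.^ s) ≈ x)
  ¬frobenius≈id {s} 1≤s 2^s<q all = ¬pow≈1 {ℕ.pred (2 ℕ.^ s)} 1≤k k<n λ x x≉0 →
    *-cancelˡ x≉0 (trans (trans (^-congʳ x sk) (all x)) (sym (*-identityʳ x)))
    where
    sk : suc (ℕ.pred (2 ℕ.^ s)) ≡ 2 ℕ.^ s
    sk = ≡.sym (2^≡1+pred s)
    1≤k : 1 ℕ.≤ ℕ.pred (2 ℕ.^ s)
    1≤k = ℕₚ.pred-mono-≤ (ℕₚ.^-monoʳ-≤ 2 1≤s)
    k<n : ℕ.pred (2 ℕ.^ s) ℕ.< n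
    k<n = ℕ.s≤s⁻¹ (≡.subst₂ ℕ._<_ (≡.sym sk) q≡1+n 2^s<q)

  -- Additive powers, automorphisms and roots in characteristic 2

  module Char2 (m : ℕ) (q≡2^m : q ≡ 2 ℕ.^ m) where

    x+x≈0 : ∀ x → x + x ≈ 0#
    x+x≈0 x = begin
      x + x            ≈⟨ +-cong (*-identityˡ x) (*-identityˡ x) ⟨
      1# * x + 1# * x  ≈⟨ distribʳ x 1# 1# ⟨
      (1# + 1#) * x    ≈⟨ *-congʳ (1+1≈0 m q≡2^m) ⟩
      0# * x           ≈⟨ zeroˡ x ⟩
      0#               ∎

    +≈0⇒≈ : ∀ {x y} → x + y ≈ 0# → x ≈ y
    +≈0⇒≈ {x} {y} eq = begin
      x            ≈⟨ +-identityʳ x ⟨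
      x + 0#       ≈⟨ +-congˡ (x+x≈0 y) ⟨
      x + (y + y)  ≈⟨ +-assoc _ _ _ ⟨
      (x + y) + y  ≈⟨ +-congʳ eq ⟩
      0# + y       ≈⟨ +-identityˡ y ⟩
      y            ∎

    ≈⇒+≈0 : ∀ {x y} → x ≈ y → x + y ≈ 0#
    ≈⇒+≈0 eq = trans (+-congʳ eq) (x+x≈0 _)

    square-+ : ∀ x y → (x + y) * (x + y) ≈ x * x + y * y
    square-+ x y = begin
      (x + y) * (x + y)                      ≈⟨ distribʳ _ _ _ ⟩
      x * (x + y) + y * (x + y)              ≈⟨ +-cong (distribˡ _ _ _) (distribˡ _ _ _) ⟩
      (x * x + x * y) + (y * x + y * y)      ≈⟨ +-assoc _ _ _ ⟩
      x * x + (x * y + (y * x + y * y))      ≈⟨ +-congˡ (+-assoc _ _ _) ⟨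
      x * x + ((x * y + y * x) + y * y)      ≈⟨ +-congˡ (+-congʳ (≈⇒+≈0 (*-comm x y))) ⟩
      x * x + (0# + y * y)                   ≈⟨ +-congˡ (+-identityˡ _) ⟩
      x * x + y * y                          ∎

    square-injective : ∀ {x y} → x * x ≈ y * y → x ≈ y
    square-injective {x} {y} eq with (x + y) ≟ 0#
    ... | yes x+y≈0 = +≈0⇒≈ x+y≈0
    ... | no x+y≉0  = contradiction (trans (square-+ x y) (≈⇒+≈0 eq)) (*-nonZero x+y≉0 x+y≉0)

    frobenius-+ : ∀ s x y → (x + y) ^ (2 ℕ.^ s) ≈ x ^ (2 ℕ.^ s) + y ^ (2 ℕ.^ s)
    frobenius-+ zero    x y = trans (*-identityʳ _) (sym (+-cong (*-identityʳ x) (*-identityʳ y)))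
    frobenius-+ (suc s) x y = begin
      (x + y) ^ (2 ℕ.* 2 ℕ.^ s)                                        ≈⟨ double (x + y) ⟩
      (x + y) ^ (2 ℕ.^ s) * (x + y) ^ (2 ℕ.^ s)                        ≈⟨ *-cong (frobenius-+ s x y) (frobenius-+ s x y) ⟩
      (x ^ (2 ℕ.^ s) + y ^ (2 ℕ.^ s)) * (x ^ (2 ℕ.^ s) + y ^ (2 ℕ.^ s))  ≈⟨ square-+ _ _ ⟩
      x ^ (2 ℕ.^ s) * x ^ (2 ℕ.^ s) + y ^ (2 ℕ.^ s) * y ^ (2 ℕ.^ s)    ≈⟨ +-cong (double x) (double y) ⟨
      x ^ (2 ℕ.* 2 ℕ.^ s) + y ^ (2 ℕ.* 2 ℕ.^ s)                        ∎
      where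
      double : ∀ z → z ^ (2 ℕ.* 2 ℕ.^ s) ≈ z ^ (2 ℕ.^ s) * z ^ (2 ℕ.^ s)
      double z = trans (^-homo-* z (2 ℕ.^ s) _) (*-congˡ (^-congʳ z (ℕₚ.+-identityʳ (2 ℕ.^ s))))

    private
      -- 1 + x + ... + x^(k-1) in Horner form; `1# * 1#` is the shape that
      -- `isPolynomial-monomial 0 1#` produces.
      geometric : ℕ → Carrier → Carrier
      geometric zero    x = 0#
      geometric (suc k) x = 1# * 1# + x * geometric k x

      geometric-poly : ∀ k → IsPolynomial k (geometric k)
      geometric-poly zero    = nil (λ _ → refl)
      geometric-poly (suc k) = isPolynomial-+
        (isPolynomial-weaken (s≤s z≤n) (isPolynomial-monomial 0 1#)) (isPolynomial-shift (geometric-poly k))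

      geometric-sum : ∀ k x → (x + 1#) * geometric k x ≈ x ^ k + 1#
      geometric-sum zero    x = trans (zeroʳ _) (sym (x+x≈0 1#))
      geometric-sum (suc k) x = begin
        (x + 1#) * (1# * 1# + x * geometric k x)           ≈⟨ distribˡ _ _ _ ⟩
        (x + 1#) * (1# * 1#) + (x + 1#) * (x * geometric k x)
          ≈⟨ +-cong (trans (*-congˡ (*-identityˡ 1#)) (*-identityʳ _))
                    (trans (sym (*-assoc _ _ _)) (trans (*-congʳ (*-comm _ _)) (trans (*-assoc _ _ _) (*-congˡ (geometric-sum k x))))) ⟩
        (x + 1#) + x * (x ^ k + 1#)                        ≈⟨ +-congˡ (trans (distribˡ _ _ _) (+-congˡ (*-identityʳ x))) ⟩
        (x + 1#) + (x * x ^ k + x)                         ≈⟨ +-comm _ _ ⟩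
        (x * x ^ k + x) + (x + 1#)                         ≈⟨ +-assoc _ _ _ ⟩
        x * x ^ k + (x + (x + 1#))                         ≈⟨ +-congˡ (+-assoc _ _ _) ⟨
        x * x ^ k + ((x + x) + 1#)                         ≈⟨ +-congˡ (trans (+-congʳ (x+x≈0 x)) (+-identityˡ 1#)) ⟩
        x * x ^ k + 1#                                     ∎

      geometric-1 : ∀ k → geometric (suc (k ℕ.+ k)) 1# ≈ 1#
      geometric-1 zero    = trans (+-cong (*-identityˡ 1#) (zeroʳ 1#)) (+-identityʳ 1#)
      geometric-1 (suc k) = trans (step (k ℕ.+ suc k))
        (≡.subst (λ j → geometric j 1# ≈ 1#) (≡.sym (ℕₚ.+-suc k k)) (geometric-1 k))
        where
        step : ∀ j → geometric (suc (suc j)) 1# ≈ geometric j 1#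
        step j = begin
          1# * 1# + 1# * (1# * 1# + 1# * geometric j 1#)
            ≈⟨ +-cong (*-identityˡ 1#) (trans (*-identityˡ _) (+-cong (*-identityˡ 1#) (*-identityˡ _))) ⟩
          1# + (1# + geometric j 1#)   ≈⟨ +-assoc _ _ _ ⟨
          (1# + 1#) + geometric j 1#   ≈⟨ +-congʳ (x+x≈0 1#) ⟩
          0# + geometric j 1#          ≈⟨ +-identityˡ _ ⟩
          geometric j 1#               ∎

    [x+1]^-poly : ∀ k → IsPolynomial (suc k) (λ x → (x + 1#) ^ k)
    [x+1]^-poly zero    = isPolynomial-cong (λ _ → *-identityˡ 1#) (isPolynomial-monomial 0 1#)
    [x+1]^-poly (suc k) = isPolynomial-cong
      (λ x → sym (trans (distribʳ _ _ _) (+-congˡ (*-identityˡ _))))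
      (isPolynomial-+ (isPolynomial-shift ([x+1]^-poly k)) (isPolynomial-weaken (ℕₚ.n≤1+n _) ([x+1]^-poly k)))

    -- An odd power j > 1 is not additive: otherwise (x + 1)^(j-1) = 1 + x + … + x^(j-1)
    -- for x ≠ 1, hence also for x = 1, where it reads 0 = j.
    additivePower : ∀ j → 1 ℕ.≤ j → j ℕ.≤ n → (∀ x y → (x + y) ^ j ≈ x ^ j + y ^ j) → ∃[ s ] j ≡ 2 ℕ.^ s
    additivePower = <-rec _ step
      where
      step : ∀ j → (∀ {i} → i ℕ.< j → 1 ℕ.≤ i → i ℕ.≤ n → (∀ x y → (x + y) ^ i ≈ x ^ i + y ^ i) → ∃[ s ] i ≡ 2 ℕ.^ s) →
             1 ℕ.≤ j → j ℕ.≤ n → (∀ x y → (x + y) ^ j ≈ x ^ j + y ^ j) → ∃[ s ] j ≡ 2 ℕ.^ s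
      step j rec 1≤j j≤n add with parity j
      ... | zero  , inj₁ ≡.refl = contradiction 1≤j λ ()
      -- Squaring is additive and injective, so additivity passes from an even exponent to its half.
      ... | suc k , inj₁ ≡.refl =
        let s , eq = rec (s≤s (ℕₚ.m≤n+m (suc k) k)) (s≤s z≤n) (ℕₚ.≤-trans (ℕₚ.m≤m+n (suc k) (suc k)) j≤n)
                       (λ x y → square-injective (begin
                          (x + y) ^ suc k * (x + y) ^ suc k      ≈⟨ ^-homo-* (x + y) (suc k) (suc k) ⟨
                          (x + y) ^ (suc k ℕ.+ suc k)            ≈⟨ add x y ⟩
                          x ^ (suc k ℕ.+ suc k) + y ^ (suc k ℕ.+ suc k)
                            ≈⟨ +-cong (^-homo-* x (suc k) (suc k)) (^-homo-* y (suc k) (suc k)) ⟩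
                          x ^ suc k * x ^ suc k + y ^ suc k * y ^ suc k  ≈⟨ square-+ _ _ ⟨
                          (x ^ suc k + y ^ suc k) * (x ^ suc k + y ^ suc k) ∎))
        in suc s , ≡.trans (≡.cong (λ i → i ℕ.+ i) eq) (≡.cong (2 ℕ.^ s ℕ.+_) (≡.sym (ℕₚ.+-identityʳ _)))
      ... | zero  , inj₂ ≡.refl = 0 , ≡.refl
      ... | suc k , inj₂ ≡.refl = contradiction (begin
            1#                                                  ≈⟨ +-identityˡ 1# ⟨
            0# + 1#                                             ≈⟨ +-cong (trans (^-congˡ (suc k ℕ.+ suc k) (x+x≈0 1#)) (zeroˡ _)) (geometric-1 (suc k)) ⟨
            f 1#                                                ≈⟨ vanishing 1# f-poly j≤n f-root 1# ⟩
            0#                                                  ∎) 1≉0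
        where
        f : Carrier → Carrier
        f x = (x + 1#) ^ (suc k ℕ.+ suc k) + geometric (suc (suc k ℕ.+ suc k)) x
        f-poly : IsPolynomial (suc (suc k ℕ.+ suc k)) f
        f-poly = isPolynomial-+ ([x+1]^-poly (suc k ℕ.+ suc k)) (geometric-poly (suc (suc k ℕ.+ suc k)))
        f-root : ∀ x → x ≉ 1# → f x ≈ 0#
        f-root x x≉1 = *-cancelˡ {x + 1#} (x≉1 ∘ +≈0⇒≈) (begin
          (x + 1#) * f x                        ≈⟨ distribˡ _ _ _ ⟩
          (x + 1#) ^ j + (x + 1#) * geometric j x  ≈⟨ +-cong (trans (add x 1#) (+-congˡ (1^ j))) (geometric-sum j x) ⟩
          (x ^ j + 1#) + (x ^ j + 1#)           ≈⟨ x+x≈0 _ ⟩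
          0#                                    ≈⟨ zeroʳ _ ⟨
          (x + 1#) * 0#                         ∎)

    module _ (σ : Carrier → Carrier) (σ-cong : ∀ {x y} → x ≈ y → σ x ≈ σ y)
             (σ-+ : ∀ x y → σ (x + y) ≈ σ x + σ y) (σ-* : ∀ x y → σ (x * y) ≈ σ x * σ y) (σ-1 : σ 1# ≈ 1#) where

      private
        σ-0 : σ 0# ≈ 0#
        σ-0 = trans (σ-cong (sym (x+x≈0 0#))) (trans (σ-+ 0# 0#) (x+x≈0 _))

        -- Orthogonality of characters: the substitution of `v x` for `x` multiplies the sum by
        -- `σ v * v ^ e`. If the sum is nonzero, this factor is 1 for every nonzero `v`, and `σ` is
        -- a power map there.
        powerSum : ℕ → Carrier
        powerSum e = Σ+.sum (λ i → σ (E.from i) * E.from i ^ e)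

        powerSum-shift : ∀ e {v} → v ≉ 0# → powerSum e ≈ σ v * v ^ e * powerSum e
        powerSum-shift e {v} v≉0 = begin
          powerSum e
            ≈⟨ Σ+.sum-permute (λ i → σ (E.from i) * E.from i ^ e) (scaling v≉0) ⟩
          Σ+.sum (λ i → σ (E.from (scaling v≉0 ⟨$⟩ʳ i)) * E.from (scaling v≉0 ⟨$⟩ʳ i) ^ e)
            ≈⟨ Σ+.sum-cong-≋ (λ i → termwise (E.from i) (scaling-from v≉0 i)) ⟩
          Σ+.sum (λ i → (σ v * v ^ e) * (σ (E.from i) * E.from i ^ e))
            ≈⟨ SemiringSum.*-distribˡ-sum semiring (σ v * v ^ e) (λ i → σ (E.from i) * E.from i ^ e) ⟨
          σ v * v ^ e * powerSum e ∎
          where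
          termwise : ∀ x {y} → y ≈ v * x → σ y * y ^ e ≈ (σ v * v ^ e) * (σ x * x ^ e)
          termwise x {y} eq = begin
            σ y * y ^ e                      ≈⟨ *-cong (trans (σ-cong eq) (σ-* v x)) (trans (^-congˡ e eq) (^-distrib-* v x e)) ⟩
            (σ v * σ x) * (v ^ e * x ^ e)    ≈⟨ *-assoc _ _ _ ⟩
            σ v * (σ x * (v ^ e * x ^ e))    ≈⟨ *-congˡ (trans (sym (*-assoc _ _ _)) (trans (*-congʳ (*-comm _ _)) (*-assoc _ _ _))) ⟩
            σ v * (v ^ e * (σ x * x ^ e))    ≈⟨ *-assoc _ _ _ ⟨
            (σ v * v ^ e) * (σ x * x ^ e)    ∎

        -- If all power sums up to exponent `n` vanished, `σ` would be orthogonal to every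
        -- polynomial function with at most `suc n` coefficients. The exponent `e` collects the
        -- factors x peeled off the Horner form.
        sum-poly : (∀ e → e ℕ.≤ n → powerSum e ≈ 0#) → ∀ {k f} → IsPolynomial k f → ∀ e → e ℕ.+ k ℕ.≤ suc n →
                   Σ+.sum (λ i → σ (E.from i) * E.from i ^ e * f (E.from i)) ≈ 0#
        sum-poly ps {f = f} (nil p) e e≤ = trans
          (Σ+.sum-cong-≋ {suc n} {λ i → σ (E.from i) * E.from i ^ e * f (E.from i)} {replicate (suc n) 0#}
            (λ i → trans (*-congˡ (p (E.from i))) (zeroʳ _)))
          (Σ+.sum-replicate-zero (suc n))
        sum-poly ps {suc k} {f = f} (cons {g = g} v q p) e e≤ = begin
          Σ+.sum (λ i → σ (E.from i) * E.from i ^ e * f (E.from i))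
            ≈⟨ Σ+.sum-cong-≋ (λ i → termwise (E.from i)) ⟩
          Σ+.sum (λ i → σ (E.from i) * E.from i ^ e * v + σ (E.from i) * E.from i ^ suc e * g (E.from i))
            ≈⟨ Σ+.∑-distrib-+ (λ i → σ (E.from i) * E.from i ^ e * v) (λ i → σ (E.from i) * E.from i ^ suc e * g (E.from i)) ⟩
          Σ+.sum (λ i → σ (E.from i) * E.from i ^ e * v) + Σ+.sum (λ i → σ (E.from i) * E.from i ^ suc e * g (E.from i))
            ≈⟨ +-cong (sym (SemiringSum.*-distribʳ-sum semiring v (λ i → σ (E.from i) * E.from i ^ e))) (sum-poly ps q (suc e) (≡.subst (ℕ._≤ suc n) (ℕₚ.+-suc e k) e≤)) ⟩
          powerSum e * v + 0#   ≈⟨ +-identityʳ _ ⟩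
          powerSum e * v        ≈⟨ *-congʳ (ps e (ℕ.s≤s⁻¹ (ℕₚ.≤-trans (≡.subst (suc e ℕ.≤_) (≡.sym (ℕₚ.+-suc e k)) (s≤s (ℕₚ.m≤m+n e k))) e≤))) ⟩
          0# * v                ≈⟨ zeroˡ v ⟩
          0#                    ∎
          where
          termwise : ∀ x → σ x * x ^ e * f x ≈ σ x * x ^ e * v + σ x * x ^ suc e * g x
          termwise x = trans (*-congˡ (p x)) (trans (distribˡ _ _ _) (+-congˡ (begin
            σ x * x ^ e * (x * g x)    ≈⟨ *-assoc _ _ _ ⟨
            σ x * x ^ e * x * g x      ≈⟨ *-congʳ (trans (*-assoc _ _ _) (*-congˡ (*-comm _ _))) ⟩
            σ x * (x * x ^ e) * g x    ∎)))

        -- The test function is the indicator function of 1.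
        nonzeroPowerSum : ∃[ e ] e ℕ.≤ n × powerSum e ≉ 0#
        nonzeroPowerSum with any? {n = suc n} (λ i → ¬? (powerSum (toℕ i) ≟ 0#))
        ... | yes (i , ps≉0) = toℕ i , ℕ.s≤s⁻¹ (toℕ<n i) , ps≉0
        ... | no none = contradiction (begin
            1#                                            ≈⟨ σf1 ⟨
            σ 1# * 1# ^ 0 * f 1#                          ≈⟨ F-cong (H.from∘to 1#) ⟨
            F (E.from (E.to 1#))                          ≈⟨ +-identityʳ _ ⟨
            F (E.from (E.to 1#)) + 0#                     ≈⟨ +-congˡ (trans (Σ+.sum-cong-≋ (λ i → F≉1 (avoiding-≉ 1# i))) (Σ+.sum-replicate-zero n)) ⟨
            F (E.from (E.to 1#)) + Σ+.sum (removeAt (F ∘ E.from) (E.to 1#))  ≈⟨ Σ+.sum-remove {i = E.to 1#} (F ∘ E.from) ⟨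
            Σ+.sum (λ i → F (E.from i))                   ≈⟨ sum-poly allZero f-poly 0 ℕₚ.≤-refl ⟩
            0#                                            ∎) 1≉0
          where
          allZero : ∀ e → e ℕ.≤ n → powerSum e ≈ 0#
          allZero e e≤n with powerSum e ≟ 0#
          ... | yes eq = eq
          ... | no neq = contradiction (fromℕ< (s≤s e≤n) ,
            ≡.subst (λ k → powerSum k ≉ 0#) (≡.sym (toℕ-fromℕ< (s≤s e≤n))) neq) none
          f F : Carrier → Carrier
          f x = 1# * 1# + (x + 1#) ^ n
          F x = σ x * x ^ 0 * f x
          f-poly : IsPolynomial (suc n) f
          f-poly = isPolynomial-+ (isPolynomial-weaken (s≤s z≤n) (isPolynomial-monomial 0 1#)) ([x+1]^-poly n)
          F-cong : ∀ {x y} → x ≈ y → F x ≈ F y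
          F-cong eq = *-cong (*-congʳ (σ-cong eq)) (+-congˡ (^-congˡ n (+-congʳ eq)))
          F≉1 : ∀ {x} → x ≉ 1# → F x ≈ 0#
          F≉1 x≉1 = trans (*-congˡ (trans (+-cong (*-identityˡ 1#) (fermat (x≉1 ∘ +≈0⇒≈))) (x+x≈0 1#))) (zeroʳ _)
          σf1 : F 1# ≈ 1#
          σf1 = trans (*-cong (trans (*-identityʳ _) σ-1)
            (trans (+-cong (*-identityˡ 1#) (trans (^-congˡ n (x+x≈0 1#)) (0^ 1≤n))) (+-identityʳ 1#))) (*-identityˡ 1#)

      automorphism≈frobenius : ∃[ s ] s ℕ.< m × (∀ v → σ v ≈ v ^ (2 ℕ.^ s))
      automorphism≈frobenius with nonzeroPowerSum
      ... | e , e≤n , ps≉0 = finish (exponent e e≤n unit)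
        where
        unit : ∀ {v} → v ≉ 0# → σ v * v ^ e ≈ 1#
        unit v≉0 = *-cancelˡ ps≉0 (trans (*-comm _ _) (trans (sym (powerSum-shift e v≉0)) (sym (*-identityʳ _))))
        exponent : ∀ e → e ℕ.≤ n → (∀ {v} → v ≉ 0# → σ v * v ^ e ≈ 1#) →
                   ∃[ j ] 1 ℕ.≤ j × j ℕ.≤ n × (∀ {v} → v ≉ 0# → σ v ≈ v ^ j)
        exponent e e≤n unit with ℕₚ.m≤n⇒m<n∨m≡n e≤n
        ... | inj₁ e<n = n ℕ.∸ e , ℕₚ.m<n⇒0<n∸m e<n , ℕₚ.m∸n≤m n e , λ {v} v≉0 →
          *-cancelˡ (^-nonZero e v≉0) (begin
            v ^ e * σ v            ≈⟨ *-comm _ _ ⟩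
            σ v * v ^ e            ≈⟨ unit v≉0 ⟩
            1#                     ≈⟨ fermat v≉0 ⟨
            v ^ n                  ≈⟨ ^-congʳ v (ℕₚ.m+[n∸m]≡n e≤n) ⟨
            v ^ (e ℕ.+ (n ℕ.∸ e))  ≈⟨ ^-homo-* v e _ ⟩
            v ^ e * v ^ (n ℕ.∸ e)  ∎)
        -- Here `n ∸ e` is 0, which `additivePower` does not admit; on nonzero elements the exponent
        -- `n` gives the same function.
        ... | inj₂ ≡.refl = n , 1≤n , ℕₚ.≤-refl , λ {v} v≉0 → begin
            σ v                    ≈⟨ *-identityʳ _ ⟨
            σ v * 1#               ≈⟨ *-congˡ (fermat v≉0) ⟨
            σ v * v ^ n            ≈⟨ unit v≉0 ⟩
            1#                     ≈⟨ fermat v≉0 ⟨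
            v ^ n                  ∎
        finish : ∃[ j ] 1 ℕ.≤ j × j ℕ.≤ n × (∀ {v} → v ≉ 0# → σ v ≈ v ^ j) →
                 ∃[ s ] s ℕ.< m × (∀ v → σ v ≈ v ^ (2 ℕ.^ s))
        finish (j , 1≤j , j≤n , σ≈) =
          let s , j≡2^s = additivePower j 1≤j j≤n (λ x y →
                trans (sym (σ≈′ (x + y))) (trans (σ-+ x y) (+-cong (σ≈′ x) (σ≈′ y))))
          in s , s<m s j≡2^s , λ v → trans (σ≈′ v) (^-congʳ v j≡2^s)
          where
          σ≈′ : ∀ v → σ v ≈ v ^ j
          σ≈′ v with v ≟ 0#
          ... | yes v≈0 = trans (σ-cong v≈0) (trans σ-0 (sym (trans (^-congˡ j v≈0) (0^ 1≤j))))
          ... | no v≉0  = σ≈ v≉0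
          s<m : ∀ s → j ≡ 2 ℕ.^ s → s ℕ.< m
          s<m s eq = ℕₚ.≰⇒> λ m≤s → ℕₚ.<⇒≱ (s≤s j≤n)
            (≡.subst₂ ℕ._≤_ (≡.trans (≡.sym q≡2^m) q≡1+n) (≡.sym eq) (ℕₚ.^-monoʳ-≤ 2 m≤s))

    private
      -- The quotient of (x^N)^k - a^k by x^N - a, in Horner form with respect to x^N.
      homogeneousGeometric : ℕ → Carrier → ℕ → Carrier → Carrier
      homogeneousGeometric N a zero    x = 0#
      homogeneousGeometric N a (suc k) x = 1# * a ^ k + x ^ N * homogeneousGeometric N a k x

      isPolynomial-shift^ : ∀ j {k f} → IsPolynomial k f → IsPolynomial (j ℕ.+ k) (λ x → x ^ j * f x)
      isPolynomial-shift^ zero    fpoly = isPolynomial-cong (λ _ → sym (*-identityˡ _)) fpoly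
      isPolynomial-shift^ (suc j) fpoly =
        isPolynomial-cong (λ _ → sym (*-assoc _ _ _)) (isPolynomial-shift (isPolynomial-shift^ j fpoly))

      homogeneousGeometric-poly : ∀ {N} a → 1 ℕ.≤ N → ∀ k → IsPolynomial (k ℕ.* N) (homogeneousGeometric N a k)
      homogeneousGeometric-poly a 1≤N zero = nil (λ _ → refl)
      homogeneousGeometric-poly {N} a 1≤N (suc k) = isPolynomial-+
        (isPolynomial-weaken (ℕₚ.≤-trans 1≤N (ℕₚ.m≤m+n N (k ℕ.* N))) (isPolynomial-monomial 0 (a ^ k)))
        (isPolynomial-shift^ N (homogeneousGeometric-poly a 1≤N k))

      homogeneousGeometric-sum : ∀ N a k x → (x ^ N + a) * homogeneousGeometric N a k x ≈ (x ^ N) ^ k + a ^ k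
      homogeneousGeometric-sum N a zero    x = trans (zeroʳ _) (sym (x+x≈0 1#))
      homogeneousGeometric-sum N a (suc k) x = begin
        (X + a) * (1# * A + X * G)                     ≈⟨ distribˡ _ _ _ ⟩
        (X + a) * (1# * A) + (X + a) * (X * G)
          ≈⟨ +-cong (trans (*-congˡ (*-identityˡ A)) (distribʳ _ _ _))
                    (trans (sym (*-assoc _ _ _)) (trans (*-congʳ (*-comm _ _)) (trans (*-assoc _ _ _) (*-congˡ (homogeneousGeometric-sum N a k x))))) ⟩
        (X * A + a * A) + X * (X ^ k + A)              ≈⟨ +-congˡ (distribˡ _ _ _) ⟩
        (X * A + a * A) + (X * X ^ k + X * A)          ≈⟨ +-comm _ _ ⟩
        (X * X ^ k + X * A) + (X * A + a * A)          ≈⟨ +-assoc _ _ _ ⟩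
        X * X ^ k + (X * A + (X * A + a * A))          ≈⟨ +-congˡ (+-assoc _ _ _) ⟨
        X * X ^ k + ((X * A + X * A) + a * A)          ≈⟨ +-congˡ (trans (+-congʳ (x+x≈0 _)) (+-identityˡ _)) ⟩
        X * X ^ k + a * A                              ∎
        where
        X A G : Carrier
        X = x ^ N
        A = a ^ k
        G = homogeneousGeometric N a k x

    -- If a had no N-th root, then (x^(q-1) - a^((q-1)/N)) / (x^N - a), which is a polynomial
    -- of degree less than q - 1, would vanish at all x ≠ 0.
    root : ∀ {N k a} → n ≡ suc k ℕ.* N → 1 ℕ.≤ N → a ≉ 0# → a ^ suc k ≈ 1# → ∃[ e ] e ≉ 0# × e ^ N ≈ a
    root {N} {k} {a} n≡ 1≤N a≉0 a^≈1 with any? (λ i → avoiding 0# i ^ N ≟ a)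
    ... | yes (i , eq) = avoiding 0# i , avoiding-≉ 0# i , eq
    ... | no none = contradiction (begin
        a ^ k                                  ≈⟨ +-identityʳ _ ⟨
        a ^ k + 0#                             ≈⟨ +-cong (*-identityˡ _) (trans (*-congʳ (0^ 1≤N)) (zeroˡ _)) ⟨
        homogeneousGeometric N a (suc k) 0#    ≈⟨ tooManyRoots zero-isSubmodule
          (≡.subst (λ j → IsPolynomial j G) (≡.sym n≡) (homogeneousGeometric-poly a 1≤N (suc k)))
          (avoiding 0#) (avoiding-injective 0#) G-root 0# ⟩
        0#                                     ∎) (^-nonZero k a≉0)
      where
      G : Carrier → Carrier
      G = homogeneousGeometric N a (suc k)
      G-root : ∀ i → G (avoiding 0# i) ≈ 0#
      G-root i = *-cancelˡ {x ^ N + a} (λ eq → none (i , +≈0⇒≈ eq)) (begin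
        (x ^ N + a) * G x          ≈⟨ homogeneousGeometric-sum N a (suc k) x ⟩
        (x ^ N) ^ suc k + a ^ suc k  ≈⟨ +-cong x^≈1 a^≈1 ⟩
        1# + 1#                    ≈⟨ x+x≈0 1# ⟩
        0#                         ≈⟨ zeroʳ _ ⟨
        (x ^ N + a) * 0#           ∎)
        where
        x : Carrier
        x = avoiding 0# i
        x^≈1 : (x ^ N) ^ suc k ≈ 1#
        x^≈1 = trans (^-assocʳ x N (suc k)) (trans (^-congʳ x (≡.trans (ℕₚ.*-comm N (suc k)) (≡.sym n≡))) (fermat (avoiding-≉ 0# i)))

-- Simultaneous eigenvectors and elementary abelian 2-groups

module Eigenvectors {q} (L : FiniteField c ℓ q) {n} (q≡1+n : q ≡ suc n)
  (M : LeftModule (CommutativeRing.ring (FiniteField.commutativeRing L)) mᵥ ℓᵥ) where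

  open FiniteField L using (Carrier; _≈_; _*_; _≉_; 0#; 1#; *-comm)
  open FieldProperties L q≡1+n using (_^_; _⁻¹⟨_⟩; inverseˡ; fermat; avoiding; avoiding-injective; avoiding-≉; 1≤n)
  open PolynomialFunctions L M
  open LeftModule M
  open SetoidReasoning ≈ᴹ-setoid

  record IsLinear (R : Carrierᴹ → Carrierᴹ) : Set (c ⊔ ℓ ⊔ mᵥ ⊔ ℓᵥ) where
    field
      cong   : ∀ {u v} → u ≈ᴹ v → R u ≈ᴹ R v
      +-homo : ∀ u v → R (u +ᴹ v) ≈ᴹ R u +ᴹ R v
      *-homo : ∀ a v → R (a *ₗ v) ≈ᴹ a *ₗ R v

    0-homo : R 0ᴹ ≈ᴹ 0ᴹ
    0-homo = begin
      R 0ᴹ              ≈⟨ cong (*ₗ-zeroˡ 0ᴹ) ⟨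
      R (0# *ₗ 0ᴹ)      ≈⟨ *-homo 0# 0ᴹ ⟩
      0# *ₗ R 0ᴹ        ≈⟨ *ₗ-zeroˡ _ ⟩
      0ᴹ                ∎

  open IsLinear

  Commute : (R R′ : Carrierᴹ → Carrierᴹ) → Set (mᵥ ⊔ ℓᵥ)
  Commute R R′ = ∀ v → R (R′ v) ≈ᴹ R′ (R v)

  IsEigenvector : (R : Carrierᴹ → Carrierᴹ) → Carrier → Carrierᴹ → Set ℓᵥ
  IsEigenvector R k v = R v ≈ᴹ k *ₗ v

  isPolynomial-map : ∀ {R} → IsLinear R → ∀ {k f} → IsPolynomial k f → IsPolynomial k (R ∘ f)
  isPolynomial-map {R} lin (nil p) = nil (λ t → ≈ᴹ-trans (cong lin (p t)) (0-homo lin))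
  isPolynomial-map {R} lin (cons v q p) = cons (R v) (isPolynomial-map lin q) λ t →
    ≈ᴹ-trans (cong lin (p t)) (≈ᴹ-trans (+-homo lin _ _) (+ᴹ-congˡ (*-homo lin _ _)))

  -- truncated k v t = v + t R v + … + t^(k-1) R^(k-1) v. If t^k = 1 and R^k v = v, then t R permutes
  -- the terms cyclically.
  module _ {R : Carrierᴹ → Carrierᴹ} (R-linear : IsLinear R) where

    truncated : ℕ → Carrierᴹ → Carrier → Carrierᴹ
    truncated zero    v t = 0ᴹ
    truncated (suc k) v t = 1# *ₗ v +ᴹ t *ₗ R (truncated k v t)

    truncated-poly : ∀ k v → IsPolynomial k (truncated k v)
    truncated-poly zero    v = nil (λ _ → ≈ᴹ-refl)
    truncated-poly (suc k) v = isPolynomial-+ (isPolynomial-weaken (s≤s z≤n) (isPolynomial-monomial 0 v))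
      (isPolynomial-shift (isPolynomial-map R-linear (truncated-poly k v)))

    -- Both sides are v + t R v + ... + t^k R^k v, with either the last or the first term split off.
    truncated-next : ∀ k v t → truncated k v t +ᴹ (t ^ k) *ₗ fold v R k ≈ᴹ v +ᴹ t *ₗ R (truncated k v t)
    truncated-next zero v t = begin
      0ᴹ +ᴹ 1# *ₗ v         ≈⟨ +ᴹ-comm _ _ ⟩
      1# *ₗ v +ᴹ 0ᴹ         ≈⟨ +ᴹ-cong (*ₗ-identityˡ v) (≈ᴹ-sym (≈ᴹ-trans (*ₗ-congˡ (0-homo R-linear)) (*ₗ-zeroʳ t))) ⟩
      v +ᴹ t *ₗ R 0ᴹ        ∎
    truncated-next (suc k) v t = begin
      (1# *ₗ v +ᴹ t *ₗ R w) +ᴹ (t * t ^ k) *ₗ R r    ≈⟨ +ᴹ-assoc _ _ _ ⟩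
      1# *ₗ v +ᴹ (t *ₗ R w +ᴹ (t * t ^ k) *ₗ R r)    ≈⟨ +ᴹ-congˡ (+ᴹ-congˡ (*ₗ-assoc _ _ _)) ⟩
      1# *ₗ v +ᴹ (t *ₗ R w +ᴹ t *ₗ (t ^ k) *ₗ R r)   ≈⟨ +ᴹ-congˡ (*ₗ-distribˡ _ _ _) ⟨
      1# *ₗ v +ᴹ t *ₗ (R w +ᴹ (t ^ k) *ₗ R r)        ≈⟨ +ᴹ-congˡ (*ₗ-congˡ (+ᴹ-congˡ (*-homo R-linear _ _))) ⟨
      1# *ₗ v +ᴹ t *ₗ (R w +ᴹ R ((t ^ k) *ₗ r))      ≈⟨ +ᴹ-congˡ (*ₗ-congˡ (+-homo R-linear _ _)) ⟨
      1# *ₗ v +ᴹ t *ₗ R (w +ᴹ (t ^ k) *ₗ r)          ≈⟨ +ᴹ-congˡ (*ₗ-congˡ (cong R-linear (truncated-next k v t))) ⟩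
      1# *ₗ v +ᴹ t *ₗ R (v +ᴹ t *ₗ R w)              ≈⟨ +ᴹ-cong (*ₗ-identityˡ v) (*ₗ-congˡ (cong R-linear (+ᴹ-congʳ (≈ᴹ-sym (*ₗ-identityˡ v))))) ⟩
      v +ᴹ t *ₗ R (1# *ₗ v +ᴹ t *ₗ R w)              ∎
      where
      w r : Carrierᴹ
      w = truncated k v t
      r = fold v R k

    truncated-0 : ∀ {k} v → 1 ℕ.≤ k → truncated k v 0# ≈ᴹ v
    truncated-0 v (s≤s _) = ≈ᴹ-trans (+ᴹ-cong (*ₗ-identityˡ v) (*ₗ-zeroˡ _)) (+ᴹ-identityʳ v)

    truncated-eigenvector : ∀ {v t} (t≉0 : t ≉ 0#) → fold v R n ≈ᴹ v →
      IsEigenvector R (t ⁻¹⟨ t≉0 ⟩) (truncated n v t)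
    truncated-eigenvector {v} {t} t≉0 period = begin
      R w                          ≈⟨ *ₗ-identityˡ _ ⟨
      1# *ₗ R w                    ≈⟨ *ₗ-congʳ (inverseˡ t≉0) ⟨
      (t ⁻¹⟨ t≉0 ⟩ * t) *ₗ R w     ≈⟨ *ₗ-assoc _ _ _ ⟩
      t ⁻¹⟨ t≉0 ⟩ *ₗ t *ₗ R w      ≈⟨ *ₗ-congˡ w≈tRw ⟨
      t ⁻¹⟨ t≉0 ⟩ *ₗ w             ∎
      where
      open import Algebra.Properties.AbelianGroup +ᴹ-abelianGroup using (∙-cancelˡ)
      w : Carrierᴹ
      w = truncated n v t
      w≈tRw : w ≈ᴹ t *ₗ R w
      w≈tRw = ∙-cancelˡ v _ _ (begin
        v +ᴹ w                         ≈⟨ +ᴹ-comm _ _ ⟩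
        w +ᴹ v                         ≈⟨ +ᴹ-congˡ (≈ᴹ-trans (*ₗ-cong (fermat t≉0) period) (*ₗ-identityˡ v)) ⟨
        w +ᴹ (t ^ n) *ₗ fold v R n     ≈⟨ truncated-next n v t ⟩
        v +ᴹ t *ₗ R w                  ∎)

    truncated-preserves : ∀ {R′} → IsLinear R′ → Commute R′ R → ∀ k {v a} t →
      IsEigenvector R′ a v → IsEigenvector R′ a (truncated k v t)
    truncated-preserves lin comm zero {a = a} t eig = ≈ᴹ-trans (0-homo lin) (≈ᴹ-sym (*ₗ-zeroʳ a))
    truncated-preserves {R′} lin comm (suc k) {v} {a} t eig = begin
      R′ (1# *ₗ v +ᴹ t *ₗ R w)         ≈⟨ +-homo lin _ _ ⟩
      R′ (1# *ₗ v) +ᴹ R′ (t *ₗ R w)    ≈⟨ +ᴹ-cong (*-homo lin _ _) (*-homo lin _ _) ⟩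
      1# *ₗ R′ v +ᴹ t *ₗ R′ (R w)      ≈⟨ +ᴹ-cong (*ₗ-congˡ eig) (*ₗ-congˡ (comm w)) ⟩
      1# *ₗ a *ₗ v +ᴹ t *ₗ R (R′ w)    ≈⟨ +ᴹ-congˡ (*ₗ-congˡ (cong R-linear (truncated-preserves lin comm k t eig))) ⟩
      1# *ₗ a *ₗ v +ᴹ t *ₗ R (a *ₗ w)  ≈⟨ +ᴹ-congˡ (*ₗ-congˡ (*-homo R-linear _ _)) ⟩
      1# *ₗ a *ₗ v +ᴹ t *ₗ a *ₗ R w    ≈⟨ +ᴹ-cong (exchange 1# v) (exchange t (R w)) ⟩
      a *ₗ 1# *ₗ v +ᴹ a *ₗ t *ₗ R w    ≈⟨ *ₗ-distribˡ _ _ _ ⟨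
      a *ₗ (1# *ₗ v +ᴹ t *ₗ R w)       ∎
      where
      w : Carrierᴹ
      w = truncated k v t
      exchange : ∀ b u → b *ₗ a *ₗ u ≈ᴹ a *ₗ b *ₗ u
      exchange b u = ≈ᴹ-trans (≈ᴹ-sym (*ₗ-assoc _ _ _)) (≈ᴹ-trans (*ₗ-congʳ (*-comm b a)) (*ₗ-assoc _ _ _))

  module _ {W : Pred Carrierᴹ p} (W-isSubmodule : IsSubmodule W) (W? : Decidable W) where

    -- The truncated sums at the `n` nonzero values of `t` satisfy the eigenvector equation. If all
    -- of them lay in `W`, then so would the value at `t = 0`, which is `v`. Being built from `v` by
    -- `R`, they keep the eigenvalues of `v` under operators that commute with `R`.
    eigenvector : ∀ {R} → IsLinear R → ∀ {v} → fold v R n ≈ᴹ v → ¬ W v →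
      ∃[ w ] ¬ W w × (∃[ k ] IsEigenvector R k w) ×
      (∀ {R′ a} → IsLinear R′ → Commute R′ R → IsEigenvector R′ a v → IsEigenvector R′ a w)
    eigenvector {R} R-linear {v} period v∉W
      with any? (λ i → ¬? (W? (truncated R-linear n v (avoiding 0# i))))
    ... | yes (i , w∉W) = _ , w∉W , (_ , truncated-eigenvector R-linear (avoiding-≉ 0# i) period) ,
      λ lin comm → truncated-preserves R-linear lin comm n (avoiding 0# i)
    ... | no none = contradiction
      (IsSubmodule.resp W-isSubmodule (truncated-0 R-linear v 1≤n)
        (tooManyRoots W-isSubmodule (truncated-poly R-linear n v) (avoiding 0#) (avoiding-injective 0#)
          (λ i → decidable-stable (W? _) (λ w∉W → none (i , w∉W))) 0#)) v∉W

    -- The alternative in the hypothesis fits multiplication by a field element u, for which u = 0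
    -- or u^n = 1. Each operator refines the eigenvector found for the others while staying outside
    -- `W`.
    simultaneousEigenvector : ∀ {k} (R : Fin k → Carrierᴹ → Carrierᴹ) → (∀ i → IsLinear (R i)) →
      (∀ i j → Commute (R i) (R j)) →
      (∀ i → (∀ v → R i v ≈ᴹ 0ᴹ) ⊎ (∀ v → fold v (R i) n ≈ᴹ v)) → ∀ {v} → ¬ W v →
      ∃[ w ] ¬ W w × (∀ i → ∃[ a ] IsEigenvector (R i) a w)
    simultaneousEigenvector {zero} R lin comm period {v} v∉W = v , v∉W , λ ()
    simultaneousEigenvector {suc k} R lin comm period v∉W
      with simultaneousEigenvector (R ∘ suc) (lin ∘ suc) (λ i j → comm (suc i) (suc j)) (period ∘ suc) v∉W
    ... | w , w∉W , eig with period zero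
    ... | inj₁ R≈0 = w , w∉W , λ where
      zero    → 0# , ≈ᴹ-trans (R≈0 w) (≈ᴹ-sym (*ₗ-zeroˡ w))
      (suc i) → eig i
    ... | inj₂ per with w′ , w′∉W , eig₀ , preserve ← eigenvector (lin zero) (per w) w∉W = w′ , w′∉W , λ where
      zero    → eig₀
      (suc i) → proj₁ (eig i) , preserve (lin (suc i)) (comm (suc i) zero) (proj₂ (eig i))

-- Orders of elementary abelian 2-groups

HasExponentTwo : AbelianGroup c ℓ → Set (c ⊔ ℓ)
HasExponentTwo G = ∀ x → x ∙ x ≈ ε
  where open AbelianGroup G

module ElementaryTwoGroup (G : AbelianGroup c ℓ) (x∙x≈ε : HasExponentTwo G)
  (_≟_ : Decidable₂ (AbelianGroup._≈_ G)) where

  open AbelianGroup G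
  open SetoidReasoning setoid

  record Subgroup {k} (f : Vector Carrier k) : Set (c ⊔ ℓ) where
    field
      exponent  : ℕ
      element   : Vector Carrier (2 ℕ.^ exponent)
      injective : ∀ {i j} → element i ≈ element j → i ≡ j
      ε-closed  : ∃[ l ] element l ≈ ε
      ∙-closed  : ∀ i j → ∃[ l ] element l ≈ element i ∙ element j
      contains  : ∀ i → ∃[ l ] element l ≈ f i

  cancel : ∀ x y → x ∙ (x ∙ y) ≈ y
  cancel x y = trans (sym (assoc x x y)) (trans (∙-congʳ (x∙x≈ε x)) (identityˡ y))

  -- `Fin 2 × Fin N` indexes H and the coset x H, which are disjoint since x is not in H. As x has
  -- order 2, their union is again a subgroup, of twice the order.
  adjoin : ∀ {k} (f : Vector Carrier (suc k)) (H : Subgroup (f ∘ suc)) →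
    ¬ (∃[ l ] Subgroup.element H l ≈ f zero) → Subgroup f
  adjoin {k} f H x∉H = record
    { exponent  = suc (exponent H)
    ; element   = λ i → e (remQuot N i)
    ; injective = λ {i} {j} eq → ≡.trans (≡.sym (combine-remQuot {2} N i))
        (≡.trans (≡.cong (uncurry combine) (e-injective (remQuot {2} N i) (remQuot N j) eq)) (combine-remQuot {2} N j))
    ; ε-closed  = lift (zero , proj₁ (ε-closed H)) (proj₂ (ε-closed H))
    ; ∙-closed  = λ i j → let (b , eq) = e-closed (remQuot N i) (remQuot N j) in lift b eq
    ; contains  = λ where
        zero    → lift (suc zero , proj₁ (ε-closed H)) (trans (∙-congˡ (proj₂ (ε-closed H))) (identityʳ x))
        (suc i) → lift (zero , proj₁ (contains H i)) (proj₂ (contains H i))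
    }
    where
    open Subgroup
    N = 2 ℕ.^ exponent H
    x = f zero
    e : Fin 2 × Fin N → Carrier
    e (zero  , j) = element H j
    e (suc _ , j) = x ∙ element H j
    lift : ∀ b {y} → e b ≈ y → ∃[ l ] e (remQuot N l) ≈ y
    lift (i , j) eq = combine i j , trans (reflexive (≡.cong e (remQuot-combine {2} {N} i j))) eq
    x∈H : ∀ {i j} → x ∙ element H i ≈ element H j → ∃[ l ] element H l ≈ x
    x∈H {i} {j} eq = let l , leq = ∙-closed H i j in l , (begin
      element H l                      ≈⟨ leq ⟩
      element H i ∙ element H j        ≈⟨ ∙-congˡ eq ⟨
      element H i ∙ (x ∙ element H i)  ≈⟨ ∙-congˡ (comm _ _) ⟩
      element H i ∙ (element H i ∙ x)  ≈⟨ cancel _ _ ⟩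
      x                                ∎)
    e-injective : ∀ b b′ → e b ≈ e b′ → b ≡ b′
    e-injective (zero , i) (zero , j) eq = ≡.cong (zero ,_) (injective H eq)
    e-injective (zero , i) (suc _ , j) eq = contradiction (x∈H (sym eq)) x∉H
    e-injective (suc _ , i) (zero , j) eq = contradiction (x∈H eq) x∉H
    e-injective (suc zero , i) (suc zero , j) eq = ≡.cong (suc zero ,_)
      (injective H (trans (sym (cancel x _)) (trans (∙-congˡ eq) (cancel x _))))
    e-closed : ∀ b b′ → ∃[ d ] e d ≈ e b ∙ e b′
    e-closed (zero , i) (zero , j) = let l , eq = ∙-closed H i j in (zero , l) , eq
    e-closed (zero , i) (suc _ , j) = let l , eq = ∙-closed H i j in (suc zero , l) ,
      trans (∙-congˡ eq) (trans (sym (assoc _ _ _)) (trans (∙-congʳ (comm _ _)) (assoc _ _ _)))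
    e-closed (suc _ , i) (zero , j) = let l , eq = ∙-closed H i j in (suc zero , l) ,
      trans (∙-congˡ eq) (sym (assoc _ _ _))
    e-closed (suc _ , i) (suc _ , j) = let l , eq = ∙-closed H i j in (zero , l) , trans eq (begin
      element H i ∙ element H j              ≈⟨ cancel x _ ⟨
      x ∙ (x ∙ (element H i ∙ element H j))  ≈⟨ ∙-congˡ (assoc _ _ _) ⟨
      x ∙ ((x ∙ element H i) ∙ element H j)  ≈⟨ ∙-congˡ (∙-congʳ (comm _ _)) ⟩
      x ∙ ((element H i ∙ x) ∙ element H j)  ≈⟨ ∙-congˡ (assoc _ _ _) ⟩
      x ∙ (element H i ∙ (x ∙ element H j))  ≈⟨ assoc _ _ _ ⟨
      (x ∙ element H i) ∙ (x ∙ element H j)  ∎)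

  subgroup : ∀ {k} (f : Vector Carrier k) → Subgroup f
  subgroup {zero} f = record
    { exponent = 0 ; element = λ _ → ε ; injective = λ { {zero} {zero} _ → ≡.refl }
    ; ε-closed = zero , refl ; ∙-closed = λ _ _ → zero , sym (identityˡ ε) ; contains = λ () }
  subgroup {suc k} f with subgroup (f ∘ suc)
  ... | H with any? (λ l → Subgroup.element H l ≟ f zero)
  ... | no x∉H  = adjoin f H x∉H
  ... | yes x∈H = record
    { Subgroup H ; contains = λ { zero → x∈H ; (suc i) → Subgroup.contains H i } }

  abstract
    -- The list `f` may contain repetitions: an element already present leaves the subgroup
    -- unchanged, and any other one doubles it.
    hasSize-2^ : ∀ {k} (f : Vector Carrier k) → (∀ x → ∃[ i ] f i ≈ x) → ∃[ m ] HasSize setoid (2 ℕ.^ m)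
    hasSize-2^ f surj = exponent , hasSize-bijection (Identity.inverse (≡-setoid _)) element
      (λ { ≡.refl → refl }) injective
      (λ x → let i , eq = surj x ; l , leq = contains i in l , trans leq eq)
      where open Subgroup (subgroup f)

-- Semifields of characteristic 2

-- The right nucleus of `S` is the left nucleus of `opposite S`, so every result on nuclei is proved
-- for one side only.
opposite : Semifield c ℓ → Semifield c ℓ
opposite S = record
  { nonAssociativeRing = record
    { Carrier = Carrier ; _≈_ = _≈_ ; _+_ = _+_ ; _*_ = flip _*_ ; -_ = -_ ; 0# = 0# ; 1# = 1#
    ; isNonAssociativeRing = record
      { +-isAbelianGroup = +-isAbelianGroup
      ; *-cong = flip *-cong ; *-identity = *-identityʳ , *-identityˡ ; distrib = swap distrib ; zero = swap (Semifield.zero S) }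
    }
  ; 1≉0 = 1≉0
  ; noZeroDivisors = λ x y → Sum.swap ∘ noZeroDivisors y x
  ; finite = finite
  }
  where open Semifield S hiding (zero)

IsCharTwo : Semifield c ℓ → Set (c ⊔ ℓ)
IsCharTwo S = ∀ x → x + x ≈ 0#
  where open Semifield S hiding (zero)

IsAssociative : Semifield c ℓ → Set (c ⊔ ℓ)
IsAssociative S = ∀ x y z → (x * y) * z ≈ x * (y * z)
  where open Semifield S

IsCommutative : Semifield c ℓ → Set (c ⊔ ℓ)
IsCommutative S = ∀ x y → x * y ≈ y * x
  where open Semifield S

module SemifieldProperties (S : Semifield c ℓ) (x+x≈0 : IsCharTwo S) where
  open Semifield S hiding (zero)
  open SetoidReasoning setoid
  open HasSizeProperties (proj₂ finite) public using (_≟_; ∀?; ∃?)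

  +≈0⇒≈ : ∀ {x y} → x + y ≈ 0# → x ≈ y
  +≈0⇒≈ {x} {y} eq = begin
    x            ≈⟨ +-identityʳ x ⟨
    x + 0#       ≈⟨ +-congˡ (x+x≈0 y) ⟨
    x + (y + y)  ≈⟨ +-assoc _ _ _ ⟨
    (x + y) + y  ≈⟨ +-congʳ eq ⟩
    0# + y       ≈⟨ +-identityˡ y ⟩
    y            ∎

  ≈⇒+≈0 : ∀ {x y} → x ≈ y → x + y ≈ 0#
  ≈⇒+≈0 eq = trans (+-congʳ eq) (x+x≈0 _)

  -x≈x : ∀ x → - x ≈ x
  -x≈x x = +≈0⇒≈ (-‿inverseˡ x)

  *-nonZero : ∀ {x y} → ¬ x ≈ 0# → ¬ y ≈ 0# → ¬ x * y ≈ 0#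
  *-nonZero x≉0 y≉0 = Sum.[ x≉0 , y≉0 ] ∘ noZeroDivisors _ _

  *-cancelˡ : ∀ {x y z} → ¬ x ≈ 0# → x * y ≈ x * z → y ≈ z
  *-cancelˡ x≉0 eq with noZeroDivisors _ _ (trans (distribˡ _ _ _) (≈⇒+≈0 eq))
  ... | inj₁ x≈0   = contradiction x≈0 x≉0
  ... | inj₂ y+z≈0 = +≈0⇒≈ y+z≈0

  *-cancelʳ : ∀ {x y z} → ¬ x ≈ 0# → y * x ≈ z * x → y ≈ z
  *-cancelʳ x≉0 eq with noZeroDivisors _ _ (trans (distribʳ _ _ _) (≈⇒+≈0 eq))
  ... | inj₁ y+z≈0 = +≈0⇒≈ y+z≈0
  ... | inj₂ x≈0   = contradiction x≈0 x≉0

  rightInverse : ∀ {x} → ¬ x ≈ 0# → ∃[ y ] x * y ≈ 1#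
  rightInverse {x} x≉0 = injective⇒surjective (proj₂ finite) (proj₂ finite) (x *_) (*-cancelˡ x≉0) 1#

  hasSize-2^ : ∃[ m ] HasSize setoid (2 ℕ.^ m)
  hasSize-2^ = ElementaryTwoGroup.hasSize-2^ +-abelianGroup x+x≈0 _≟_ (from) (λ x → to x , strictlyInverseʳ x)
    where open Inverse (proj₂ finite)

  -- In characteristic 2 closure under negation is automatic, and 0 is 1 + 1. Decidability is what
  -- makes the subset finite.
  record IsSubsemifield (P : Pred Carrier p) : Set (c ⊔ ℓ ⊔ p) where
    field
      resp     : P Respects _≈_
      P?       : Decidable P
      1-closed : P 1#
      +-closed : ∀ {x y} → P x → P y → P (x + y)
      *-closed : ∀ {x y} → P x → P y → P (x * y)

    0-closed : P 0#
    0-closed = resp (x+x≈0 1#) (+-closed 1-closed 1-closed)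

    semifield : Semifield (c ⊔ p) ℓ
    semifield = record
      { nonAssociativeRing = nonAssociativeRing′
      ; 1≉0 = 1≉0
      ; noZeroDivisors = λ x y → noZeroDivisors (proj₁ x) (proj₁ y)
      ; finite = let m , size = ElementaryTwoGroup.hasSize-2^ (NonAssociativeRing.+-abelianGroup nonAssociativeRing′)
                       (x+x≈0 ∘ proj₁) (λ x y → proj₁ x ≟ proj₁ y) enumerate enumerate-surjective
                 in _ , size
      }
      where
      module Finite = Inverse (proj₂ finite)
      nonAssociativeRing′ : NonAssociativeRing _ _
      nonAssociativeRing′ = record
        { Carrier = ∃ P
        ; _≈_ = _≈_ on proj₁
        ; _+_ = λ (x , px) (y , py) → x + y , +-closed px py
        ; _*_ = λ (x , px) (y , py) → x * y , *-closed px py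
        ; -_ = λ (x , px) → - x , resp (sym (-x≈x x)) px
        ; 0# = 0# , 0-closed
        ; 1# = 1# , 1-closed
        ; isNonAssociativeRing = record
          { +-isAbelianGroup = record
            { isGroup = record
              { isMonoid = record
                { isSemigroup = record
                  { isMagma = record { isEquivalence = On.isEquivalence proj₁ isEquivalence ; ∙-cong = +-cong }
                  ; assoc = λ x y z → +-assoc (proj₁ x) (proj₁ y) (proj₁ z) }
                ; identity = (λ x → +-identityˡ (proj₁ x)) , (λ x → +-identityʳ (proj₁ x)) }
              ; inverse = (λ x → -‿inverseˡ (proj₁ x)) , (λ x → -‿inverseʳ (proj₁ x))
              ; ⁻¹-cong = -‿cong }
            ; comm = λ x y → +-comm (proj₁ x) (proj₁ y) }
          ; *-cong = *-cong
          ; *-identity = (λ x → *-identityˡ (proj₁ x)) , (λ x → *-identityʳ (proj₁ x))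
          ; distrib = (λ x y z → distribˡ (proj₁ x) (proj₁ y) (proj₁ z)) , (λ x y z → distribʳ (proj₁ x) (proj₁ y) (proj₁ z))
          ; zero = (λ x → zeroˡ (proj₁ x)) , (λ x → zeroʳ (proj₁ x))
          }
        }
      -- Elements outside `P` are sent to 0, which turns the enumeration of the whole semifield into
      -- one of `P` with repetitions.
      truncate : ∀ x → ∃ P
      truncate x with P? x
      ... | yes px = x , px
      ... | no _   = 0# , 0-closed
      truncate-P : ∀ x → P x → proj₁ (truncate x) ≈ x
      truncate-P x px with P? x
      ... | yes _  = refl
      ... | no ¬px = contradiction px ¬px
      enumerate : Fin (proj₁ finite) → ∃ P
      enumerate i = truncate (Finite.from i)
      enumerate-surjective : ∀ (y : ∃ P) → ∃[ i ] proj₁ (enumerate i) ≈ proj₁ y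
      enumerate-surjective (x , px) = Finite.to x ,
        trans (truncate-P _ (resp (sym eq) px)) eq
        where
        eq : Finite.from (Finite.to x) ≈ x
        eq = Finite.strictlyInverseʳ x

  module Associative (*-assoc : IsAssociative S) where

    ring : Ring c ℓ
    ring = record
      { isRing = record
        { +-isAbelianGroup = +-isAbelianGroup
        ; *-cong = *-cong ; *-assoc = *-assoc ; *-identity = *-identityˡ , *-identityʳ ; distrib = distribˡ , distribʳ } }

    finiteField : IsCommutative S → ∀ {q} → HasSize setoid q → FiniteField c ℓ q
    finiteField *-comm size = record
      { commutativeRing = record { isCommutativeRing = record { isRing = Ring.isRing ring ; *-comm = *-comm } }
      ; 1≉0 = 1≉0
      ; invertible = λ x x≉0 → let y , xy≈1 = rightInverse x≉0 in y , trans (*-comm y x) xy≈1 , xy≈1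
      ; size = size
      }

-- Wedderburn's theorem in characteristic 2

-- 1 + b + ... + b^(i-1), the exponent of the norm map for an extension of degree i of a field with
-- b elements.
repunit : ℕ → ℕ → ℕ
repunit b zero    = 0
repunit b (suc i) = suc (repunit b i ℕ.* b)

repunit-sum : ∀ b i → suc (repunit (suc b) i ℕ.* b) ≡ suc b ℕ.^ i
repunit-sum b zero    = ≡.refl
repunit-sum b (suc i) = ≡.trans (lemma b (repunit (suc b) i)) (≡.cong (suc b ℕ.*_) (repunit-sum b i))
  where
  lemma : ∀ b r → suc (suc (r ℕ.* suc b) ℕ.* b) ≡ suc b ℕ.* suc (r ℕ.* b)
  lemma = solve-∀

module CommutingSubsets (D : Semifield c ℓ) (x+x≈0 : IsCharTwo D) (*-assoc : IsAssociative D) where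

  open Semifield D hiding (zero)
  open SemifieldProperties D x+x≈0
  open Associative *-assoc
  open SetoidReasoning setoid

  Commutes : Carrier → Carrier → Set ℓ
  Commutes x y = x * y ≈ y * x

  record IsSelfCentralizing (E : Pred Carrier (c ⊔ ℓ)) : Set (c ⊔ ℓ) where
    field
      isSubsemifield : IsSubsemifield E
      comm           : ∀ {x y} → E x → E y → Commutes x y
      maximal        : ∀ {z} → (∀ (y : ∃ E) → Commutes z (proj₁ y)) → E z

  -- A maximal commutative subfield is presented as the centralizer of a finite list, which makes
  -- membership decidable.
  Centralizes : List Carrier → Carrier → Set (c ⊔ ℓ)
  Centralizes X z = All (Commutes z) X

  centralizer-isSubsemifield : ∀ X → IsSubsemifield (Centralizes X)
  centralizer-isSubsemifield X = record
    { resp     = λ eq → All.map (λ p → trans (*-congʳ (sym eq)) (trans p (*-congˡ eq)))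
    ; P?       = λ z → All.all? (λ x → (z * x) ≟ (x * z)) X
    ; 1-closed = All.universal (λ x → trans (*-identityˡ x) (sym (*-identityʳ x))) X
    ; +-closed = λ p q → All.zipWith (λ (r , s) → trans (distribʳ _ _ _) (trans (+-cong r s) (sym (distribˡ _ _ _)))) (p , q)
    ; *-closed = λ p q → All.zipWith (λ (r , s) → trans (*-assoc _ _ _) (trans (*-congˡ s)
                   (trans (sym (*-assoc _ _ _)) (trans (*-congʳ r) (*-assoc _ _ _))))) (p , q)
    }

  -- The set X is chosen greedily: f i is added if it commutes with everything chosen before.
  maximalCommuting : ∀ {k} (f : Vector Carrier k) → ∃[ X ] All (Centralizes X) X ×
    (∀ i → Centralizes X (f i) → ∀ z → Centralizes X z → Commutes (f i) z)
  maximalCommuting {zero} f = [] , [] , λ ()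
  maximalCommuting {suc k} f with maximalCommuting (f ∘ suc)
  ... | X , inner , outer with IsSubsemifield.P? (centralizer-isSubsemifield X) (f zero)
  ... | yes fX = f zero ∷ X , (refl ∷ fX) ∷ All.zipWith (λ (p , q) → sym q ∷ p) (inner , fX) , λ where
    zero    _         z (p ∷ _) → sym p
    (suc i) (_ ∷ p) z (_ ∷ q) → outer i p z q
  ... | no ¬fX = X , inner , λ where
    zero    p → contradiction p ¬fX
    (suc i) → outer i

  open Inverse (proj₂ finite) using (to; from; strictlyInverseʳ)

  -- Every element occurs in the enumeration `from`, so any two elements that centralize X commute.
  -- Since X is contained in its centralizer, whatever commutes with the latter centralizes X.
  selfCentralizing : ∃[ E ] IsSelfCentralizing E
  selfCentralizing with X , inner , outer ← maximalCommuting from = Centralizes X , record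
    { isSubsemifield = centralizer-isSubsemifield X
    ; comm           = λ {x} {y} ex ey → trans (*-congʳ (sym (strictlyInverseʳ x)))
        (trans (outer (to x) (IsSubsemifield.resp (centralizer-isSubsemifield X) (sym (strictlyInverseʳ x)) ex) y ey)
          (*-congˡ (strictlyInverseʳ x)))
    ; maximal        = λ comm → All.map (λ e → comm (_ , e)) inner
    }

-- The skew field as a vector space over a self-centralizing subfield

module SelfCentralizing (D : Semifield c ℓ) (x+x≈0 : IsCharTwo D) (*-assoc : IsAssociative D)
  {E : Pred (Semifield.Carrier D) (c ⊔ ℓ)}
  (E-isSelfCentralizing : CommutingSubsets.IsSelfCentralizing D x+x≈0 *-assoc E) where

  open Semifield D hiding (zero)
  open SemifieldProperties D x+x≈0
  open Associative *-assoc
  open SetoidReasoning setoid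
  open Exp (Ring.semiring ring) using (_^_)
  open CommutingSubsets D x+x≈0 *-assoc using (module IsSelfCentralizing)
  open IsSelfCentralizing E-isSelfCentralizing using () renaming
    (isSubsemifield to E-isSubsemifield; comm to E-comm; maximal to E-maximal)
  open IsSubsemifield E-isSubsemifield using (resp; P?; +-closed; *-closed; 0-closed)

  private
    Eˢ : Semifield (c ⊔ ℓ) ℓ
    Eˢ = IsSubsemifield.semifield E-isSubsemifield
    module Eˢ = SemifieldProperties Eˢ (x+x≈0 ∘ proj₁)

  m : ℕ
  m = proj₁ Eˢ.hasSize-2^

  L : FiniteField (c ⊔ ℓ) ℓ (2 ℕ.^ m)
  L = Eˢ.Associative.finiteField (λ x y z → *-assoc (proj₁ x) (proj₁ y) (proj₁ z))
    (λ x y → E-comm (proj₂ x) (proj₂ y)) (proj₂ Eˢ.hasSize-2^)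

  n : ℕ
  n = ℕ.pred (2 ℕ.^ m)

  q≡1+n : 2 ℕ.^ m ≡ suc n
  q≡1+n = 2^≡1+pred m

  module L = FiniteField L
  module LP = FieldProperties L q≡1+n
  module L2 = LP.Char2 m ≡.refl
  open LP using () renaming (_^_ to _^ᴸ_)

  M : LeftModule (CommutativeRing.ring L.commutativeRing) c ℓ
  M = record
    { Carrierᴹ = Carrier ; _≈ᴹ_ = _≈_ ; _+ᴹ_ = _+_ ; _*ₗ_ = λ a v → proj₁ a * v ; 0ᴹ = 0# ; -ᴹ_ = -_
    ; isLeftModule = record
      { isLeftSemimodule = record
        { +ᴹ-isCommutativeMonoid = +-isCommutativeMonoid
        ; isPreleftSemimodule = record
          { *ₗ-cong = *-cong
          ; *ₗ-zeroˡ = zeroˡ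
          ; *ₗ-distribʳ = λ v a b → distribʳ v (proj₁ a) (proj₁ b)
          ; *ₗ-identityˡ = *-identityˡ
          ; *ₗ-assoc = λ a b v → *-assoc (proj₁ a) (proj₁ b) v
          ; *ₗ-zeroʳ = λ a → zeroʳ (proj₁ a)
          ; *ₗ-distribˡ = λ a → distribˡ (proj₁ a)
          }
        }
      ; -ᴹ‿cong = -‿cong
      ; -ᴹ‿inverse = -‿inverse
      }
    }

  module ML = PolynomialFunctions L M
  module EV = Eigenvectors L q≡1+n M

  Intertwines : ℕ → Carrier → Set (c ⊔ ℓ)
  Intertwines s w = ∀ (u : ∃ E) → w * proj₁ u ≈ proj₁ (u ^ᴸ (2 ℕ.^ s)) * w

  ^2^ : ∀ u a b → (u ^ᴸ (2 ℕ.^ a)) ^ᴸ (2 ℕ.^ b) L.≈ u ^ᴸ (2 ℕ.^ (b ℕ.+ a))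
  ^2^ u a b = trans (LP.^-assocʳ u (2 ℕ.^ a) (2 ℕ.^ b)) (LP.^-congʳ u
    (≡.trans (≡.sym (ℕₚ.^-distribˡ-+-* 2 a b)) (≡.cong (2 ℕ.^_) (ℕₚ.+-comm a b))))

  intertwines-* : ∀ {s t w z} → Intertwines s w → Intertwines t z → Intertwines (s ℕ.+ t) (w * z)
  intertwines-* {s} {t} {w} {z} iw iz u = begin
    (w * z) * proj₁ u                                      ≈⟨ *-assoc _ _ _ ⟩
    w * (z * proj₁ u)                                      ≈⟨ *-congˡ (iz u) ⟩
    w * (proj₁ (u ^ᴸ (2 ℕ.^ t)) * z)                       ≈⟨ *-assoc _ _ _ ⟨
    (w * proj₁ (u ^ᴸ (2 ℕ.^ t))) * z                       ≈⟨ *-congʳ (iw _) ⟩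
    (proj₁ ((u ^ᴸ (2 ℕ.^ t)) ^ᴸ (2 ℕ.^ s)) * w) * z        ≈⟨ *-assoc _ _ _ ⟩
    proj₁ ((u ^ᴸ (2 ℕ.^ t)) ^ᴸ (2 ℕ.^ s)) * (w * z)        ≈⟨ *-congʳ (^2^ u t s) ⟩
    proj₁ (u ^ᴸ (2 ℕ.^ (s ℕ.+ t))) * (w * z)               ∎

  intertwines-^ : ∀ {s w} → Intertwines s w → ∀ k → Intertwines (k ℕ.* s) (w ^ k)
  intertwines-^ iw zero u = trans (*-identityˡ _) (sym (trans (*-identityʳ _) (*-identityʳ _)))
  intertwines-^ {s} iw (suc k) = intertwines-* {s} {k ℕ.* s} iw (intertwines-^ {s} iw k)

  frobenius^m : ∀ u → u ^ᴸ (2 ℕ.^ m) L.≈ u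
  frobenius^m u = trans (LP.^-congʳ u q≡1+n) (LP.^q u)

  intertwines-m⇒E : ∀ {w} → Intertwines m w → E w
  intertwines-m⇒E iw = E-maximal λ u → trans (iw u) (*-congʳ (frobenius^m u))

  ^-nonZero : ∀ {x} k → ¬ x ≈ 0# → ¬ x ^ k ≈ 0#
  ^-nonZero zero    x≉0 = 1≉0
  ^-nonZero (suc k) x≉0 = *-nonZero x≉0 (^-nonZero k x≉0)

  ^-comm : ∀ x k → x * x ^ k ≈ x ^ k * x
  ^-comm x zero    = trans (*-identityʳ x) (sym (*-identityˡ x))
  ^-comm x (suc k) = trans (*-congˡ (^-comm x k)) (sym (*-assoc _ _ _))

  module _ {s k} (1≤s : 1 ℕ.≤ s) (2≤k : 2 ℕ.≤ k) (m≡ks : m ≡ k ℕ.* s) where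

    private
      Q⁻ : ℕ
      Q⁻ = ℕ.pred (2 ℕ.^ s)

      Q≡ : 2 ℕ.^ s ≡ suc Q⁻
      Q≡ = 2^≡1+pred s

      1≤Q⁻ : 1 ℕ.≤ Q⁻
      1≤Q⁻ = ℕₚ.pred-mono-≤ (ℕₚ.^-monoʳ-≤ 2 1≤s)

      norm : ℕ → ℕ
      norm = repunit (2 ℕ.^ s)

      norm-sum : ∀ i → suc (norm i ℕ.* Q⁻) ≡ 2 ℕ.^ (i ℕ.* s)
      norm-sum i = ≡.trans (≡.trans (≡.cong (λ b → suc (repunit b i ℕ.* Q⁻)) Q≡) (repunit-sum Q⁻ i))
        (≡.trans (≡.cong (ℕ._^ i) (≡.sym Q≡)) (≡.trans (ℕₚ.^-*-assoc 2 s i) (≡.cong (2 ℕ.^_) (ℕₚ.*-comm s i))))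

      n≡ : n ≡ Q⁻ ℕ.* norm k
      n≡ = ≡.trans (ℕₚ.suc-injective (≡.trans (≡.sym q≡1+n) (≡.trans (≡.cong (2 ℕ.^_) m≡ks) (≡.sym (norm-sum k)))))
                   (ℕₚ.*-comm (norm k) Q⁻)

      1≤norm : 1 ℕ.≤ norm k
      1≤norm = norm-pos 2≤k
        where
        norm-pos : ∀ {k} → 2 ℕ.≤ k → 1 ℕ.≤ norm k
        norm-pos (s≤s _) = s≤s z≤n

    -- y = e w, where e is a preimage of w^(-k) under the norm map of E over the fixed field of w.
    normalize : ∀ {w} → ¬ w ≈ 0# → Intertwines s w → ∃[ y ] ¬ y ≈ 0# × Intertwines s y × (y ^ k ≈ 1#)
    normalize {w} w≉0 iw = y , *-nonZero e≉0 w≉0 , iy , y^k≈1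
      where
      c̅ : ∃ E
      c̅ = w ^ k , intertwines-m⇒E (≡.subst (λ j → Intertwines j (w ^ k)) (≡.sym m≡ks) (intertwines-^ {s} iw k))
      c̅≉0 : ¬ (c̅ L.≈ L.0#)
      c̅≉0 = ^-nonZero k w≉0
      c̅^Q⁻≈1 : c̅ ^ᴸ Q⁻ L.≈ L.1#
      c̅^Q⁻≈1 = LP.*-cancelˡ {c̅} {c̅ ^ᴸ Q⁻} {L.1#} c̅≉0 (trans (trans (LP.^-congʳ c̅ (≡.sym Q≡)) c̅^Q≈c̅) (sym (L.*-identityʳ c̅)))
        where
        c̅^Q≈c̅ : c̅ ^ᴸ (2 ℕ.^ s) L.≈ c̅
        c̅^Q≈c̅ = *-cancelʳ w≉0 (trans (sym (iw c̅)) (^-comm w k))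
      d = c̅ LP.⁻¹⟨ c̅≉0 ⟩
      d^Q⁻≈1 : d ^ᴸ Q⁻ L.≈ L.1#
      d^Q⁻≈1 = begin
        proj₁ (d ^ᴸ Q⁻)                        ≈⟨ L.*-identityʳ (d ^ᴸ Q⁻) ⟨
        proj₁ (d ^ᴸ Q⁻ L.* L.1#)               ≈⟨ L.*-congˡ {d ^ᴸ Q⁻} {c̅ ^ᴸ Q⁻} {L.1#} c̅^Q⁻≈1 ⟨
        proj₁ (d ^ᴸ Q⁻ L.* c̅ ^ᴸ Q⁻)            ≈⟨ LP.^-distrib-* d c̅ Q⁻ ⟨
        proj₁ ((d L.* c̅) ^ᴸ Q⁻)                ≈⟨ LP.^-congˡ Q⁻ {d L.* c̅} {L.1#} (LP.inverseˡ {c̅} c̅≉0) ⟩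
        proj₁ (L.1# ^ᴸ Q⁻)                     ≈⟨ LP.1^ Q⁻ ⟩
        1#                                     ∎
      d≉0 : ¬ (d L.≈ L.0#)
      d≉0 d≈0 = 1≉0 (trans (sym (LP.inverseˡ {c̅} c̅≉0)) (trans (*-congʳ d≈0) (zeroˡ _)))
      -- `root` takes the cofactor of `norm k` in `n` as a successor, hence the detour through `j`.
      -- That cofactor is 2^s - 1, and d^(2^s - 1) = 1 because `w` commutes with its own power w^k.
      d-root : ∀ j → j ≡ Q⁻ → 1 ℕ.≤ j → ∃[ e ] ¬ (e L.≈ L.0#) × (e ^ᴸ norm k L.≈ d)
      d-root (suc j) j≡ _ = L2.root {norm k} {j} {d} (≡.trans n≡ (≡.cong (ℕ._* norm k) (≡.sym j≡)))
        1≤norm d≉0 (trans (LP.^-congʳ d j≡) d^Q⁻≈1)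
      e-root = d-root Q⁻ ≡.refl 1≤Q⁻
      e = proj₁ e-root
      e≉0 : ¬ proj₁ e ≈ 0#
      e≉0 = proj₁ (proj₂ e-root)
      y = proj₁ e * w
      iy : Intertwines s y
      iy u = begin
        (proj₁ e * w) * proj₁ u      ≈⟨ *-assoc _ _ _ ⟩
        proj₁ e * (w * proj₁ u)      ≈⟨ *-congˡ (iw u) ⟩
        proj₁ e * (proj₁ (u ^ᴸ (2 ℕ.^ s)) * w)  ≈⟨ *-assoc _ _ _ ⟨
        (proj₁ e * proj₁ (u ^ᴸ (2 ℕ.^ s))) * w  ≈⟨ *-congʳ (L.*-comm e (u ^ᴸ (2 ℕ.^ s))) ⟩
        (proj₁ (u ^ᴸ (2 ℕ.^ s)) * proj₁ e) * w  ≈⟨ *-assoc _ _ _ ⟩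
        proj₁ (u ^ᴸ (2 ℕ.^ s)) * (proj₁ e * w)  ∎
      -- Moving `w` past e^(norm i) raises the latter to the power 2^s, and 1 + 2^s norm i = norm (i
      -- + 1).
      y^ : ∀ i → y ^ i ≈ proj₁ (e ^ᴸ norm i) * w ^ i
      y^ zero = sym (*-identityˡ 1#)
      y^ (suc i) = begin
        (proj₁ e * w) * y ^ i                                    ≈⟨ *-assoc _ _ _ ⟩
        proj₁ e * (w * y ^ i)                                    ≈⟨ *-congˡ (*-congˡ (y^ i)) ⟩
        proj₁ e * (w * (proj₁ (e ^ᴸ norm i) * w ^ i))            ≈⟨ *-congˡ (*-assoc _ _ _) ⟨
        proj₁ e * ((w * proj₁ (e ^ᴸ norm i)) * w ^ i)            ≈⟨ *-congˡ (*-congʳ (iw _)) ⟩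
        proj₁ e * ((proj₁ ((e ^ᴸ norm i) ^ᴸ (2 ℕ.^ s)) * w) * w ^ i) ≈⟨ *-congˡ (*-assoc _ _ _) ⟩
        proj₁ e * (proj₁ ((e ^ᴸ norm i) ^ᴸ (2 ℕ.^ s)) * (w * w ^ i)) ≈⟨ *-assoc _ _ _ ⟨
        (proj₁ e * proj₁ ((e ^ᴸ norm i) ^ᴸ (2 ℕ.^ s))) * (w * w ^ i) ≈⟨ *-congʳ (*-congˡ (LP.^-assocʳ e (norm i) (2 ℕ.^ s))) ⟩
        proj₁ (e ^ᴸ norm (suc i)) * w ^ suc i                    ∎
      y^k≈1 : y ^ k ≈ 1#
      y^k≈1 = trans (y^ k) (trans (*-congʳ (proj₂ (proj₂ e-root))) (LP.inverseˡ {c̅} c̅≉0))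

    private
      -- As (y - 1) (1 + y + … + y^(k-1)) = y^k - 1, the second factor vanishes if y^k = 1 ≠ y. Moving
      -- u ∈ E through it from the right to the left yields Σ u^(Q^i) y^i = 0 with Q = 2^s. Divided
      -- by u, this is a polynomial in u of degree less than |E| - 1 with constant coefficient y^0 = 1.
      geometric : Carrier → ℕ → Carrier
      geometric y zero    = 0#
      geometric y (suc i) = geometric y i + y ^ i

      geometric-sum : ∀ y i → (y + 1#) * geometric y i ≈ y ^ i + 1#
      geometric-sum y zero    = trans (zeroʳ _) (sym (x+x≈0 1#))
      geometric-sum y (suc i) = begin
        (y + 1#) * (geometric y i + y ^ i)                ≈⟨ distribˡ _ _ _ ⟩
        (y + 1#) * geometric y i + (y + 1#) * y ^ i       ≈⟨ +-cong (geometric-sum y i) (trans (distribʳ _ _ _) (+-congˡ (*-identityˡ _))) ⟩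
        (y ^ i + 1#) + (y * y ^ i + y ^ i)                ≈⟨ +-comm _ _ ⟩
        (y * y ^ i + y ^ i) + (y ^ i + 1#)                ≈⟨ +-assoc _ _ _ ⟩
        y * y ^ i + (y ^ i + (y ^ i + 1#))                ≈⟨ +-congˡ (+-assoc _ _ _) ⟨
        y * y ^ i + ((y ^ i + y ^ i) + 1#)                ≈⟨ +-congˡ (trans (+-congʳ (x+x≈0 _)) (+-identityˡ 1#)) ⟩
        y * y ^ i + 1#                                    ∎

      quotient : Carrier → ℕ → ∃ E → Carrier
      quotient y zero    u = 0#
      quotient y (suc i) u = quotient y i u + proj₁ (u ^ᴸ ℕ.pred (2 ℕ.^ (i ℕ.* s))) * y ^ i

      quotient-scaled : ∀ {y} → Intertwines s y → ∀ i u → proj₁ u * quotient y i u ≈ geometric y i * proj₁ u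
      quotient-scaled iy zero u = trans (zeroʳ _) (sym (zeroˡ _))
      quotient-scaled {y} iy (suc i) u = begin
        proj₁ u * (quotient y i u + proj₁ (u ^ᴸ deg) * y ^ i)            ≈⟨ distribˡ _ _ _ ⟩
        proj₁ u * quotient y i u + proj₁ u * (proj₁ (u ^ᴸ deg) * y ^ i)  ≈⟨ +-cong (quotient-scaled iy i u) (sym (*-assoc _ _ _)) ⟩
        geometric y i * proj₁ u + proj₁ (u ^ᴸ suc deg) * y ^ i           ≈⟨ +-congˡ (*-congʳ (LP.^-congʳ u (≡.sym (2^≡1+pred (i ℕ.* s))))) ⟩
        geometric y i * proj₁ u + proj₁ (u ^ᴸ (2 ℕ.^ (i ℕ.* s))) * y ^ i  ≈⟨ +-congˡ (intertwines-^ {s} iy i u) ⟨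
        geometric y i * proj₁ u + y ^ i * proj₁ u                      ≈⟨ distribʳ _ _ _ ⟨
        (geometric y i + y ^ i) * proj₁ u                              ∎
        where deg = ℕ.pred (2 ℕ.^ (i ℕ.* s))

      quotient-poly : ∀ y i → i ℕ.≤ k → ML.IsPolynomial n (quotient y i)
      quotient-poly y zero    i≤k = ML.isPolynomial-0 n (λ _ → refl)
      quotient-poly y (suc i) i<k = ML.isPolynomial-+ (quotient-poly y i (ℕₚ.<⇒≤ i<k))
        (ML.isPolynomial-weaken bound (ML.isPolynomial-monomial (ℕ.pred (2 ℕ.^ (i ℕ.* s))) (y ^ i)))
        where
        bound : suc (ℕ.pred (2 ℕ.^ (i ℕ.* s))) ℕ.≤ n
        bound = ℕ.s≤s⁻¹ (≡.subst₂ ℕ._<_ (2^≡1+pred (i ℕ.* s))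
          (≡.trans (≡.cong (2 ℕ.^_) (≡.sym m≡ks)) q≡1+n)
          (ℕₚ.^-monoʳ-< 2 (s≤s (s≤s z≤n)) (ℕₚ.*-monoˡ-< s {{ℕ.>-nonZero 1≤s}} i<k)))

      quotient-0 : ∀ y i → quotient y (suc i) L.0# ≈ 1#
      quotient-0 y zero    = trans (+-identityˡ _) (*-identityˡ 1#)
      quotient-0 y (suc i) = trans (+-cong (quotient-0 y i) (trans (*-congʳ (LP.0^ exponent≥1)) (zeroˡ _))) (+-identityʳ 1#)
        where
        exponent≥1 : 1 ℕ.≤ ℕ.pred (2 ℕ.^ (suc i ℕ.* s))
        exponent≥1 = ℕₚ.pred-mono-≤ (ℕₚ.^-monoʳ-≤ 2 (ℕₚ.≤-trans 1≤s (ℕₚ.m≤m+n s (i ℕ.* s))))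

    ¬intertwines-period : ∀ {y} → Intertwines s y → ¬ y ≈ 1# → ¬ y ^ k ≈ 1#
    ¬intertwines-period {y} iy y≉1 y^k≈1 = 1≉0 (trans (sym (quotient-0′ k 2≤k))
      (ML.tooManyRoots ML.zero-isSubmodule (quotient-poly y k ℕₚ.≤-refl) (LP.avoiding L.0#)
        (LP.avoiding-injective L.0#) quotient-root L.0#))
      where
      quotient-0′ : ∀ k → 2 ℕ.≤ k → quotient y k L.0# ≈ 1#
      quotient-0′ (suc k) _ = quotient-0 y k
      geometric≈0 : geometric y k ≈ 0#
      geometric≈0 = *-cancelˡ {y + 1#} (y≉1 ∘ +≈0⇒≈)
        (trans (geometric-sum y k) (trans (+-congʳ y^k≈1) (trans (x+x≈0 1#) (sym (zeroʳ _)))))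
      quotient-root : ∀ i → quotient y k (LP.avoiding L.0# i) ≈ 0#
      quotient-root i = *-cancelˡ (LP.avoiding-≉ L.0# i) (trans (quotient-scaled iy k (LP.avoiding L.0# i))
        (trans (*-congʳ geometric≈0) (trans (zeroˡ _) (sym (zeroʳ _)))))

  -- Descent by the Euclidean algorithm. Let m = k s + r with r < s. Conjugation by w^k acts on E as
  -- the (k s)-th power of the Frobenius map, whose m-th power is trivial, so the inverse of w^k
  -- acts as the r-th power. This lowers s until it divides m, and then the norm argument applies.
  ¬intertwines : ∀ s → 1 ℕ.≤ s → s ℕ.< m → ∀ w → ¬ w ≈ 0# → ¬ Intertwines s w
  ¬intertwines = <-rec _ step
    where
    step : ∀ s → (∀ {r} → r ℕ.< s → 1 ℕ.≤ r → r ℕ.< m → ∀ w → ¬ w ≈ 0# → ¬ Intertwines r w) →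
           1 ℕ.≤ s → s ℕ.< m → ∀ w → ¬ w ≈ 0# → ¬ Intertwines s w
    step (suc s⁻) rec 1≤s s<m w w≉0 iw = go r ≡.refl
      where
      s = suc s⁻
      r = m % s
      k = m / s
      m≡ : m ≡ r ℕ.+ k ℕ.* s
      m≡ = m≡m%n+[m/n]*n m s
      go : ∀ r′ → r ≡ r′ → ⊥
      go zero r≡0 = let y , y≉0 , iy , y^k≈1 = normalize 1≤s 2≤k m≡ks w≉0 iw in
        ¬intertwines-period 1≤s 2≤k m≡ks iy (y≉1 iy) y^k≈1
        where
        m≡ks : m ≡ k ℕ.* s
        m≡ks = ≡.trans m≡ (≡.cong (ℕ._+ k ℕ.* s) r≡0)
        2≤k : 2 ℕ.≤ k
        2≤k = ℕₚ.≰⇒> λ k≤1 → ℕₚ.<⇒≱ s<m (≡.subst₂ ℕ._≤_ (≡.sym m≡ks) (ℕₚ.*-identityˡ s) (ℕₚ.*-monoˡ-≤ s k≤1))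
        y≉1 : ∀ {y} → Intertwines s y → ¬ y ≈ 1#
        y≉1 iy y≈1 = LP.¬frobenius≈id 1≤s (ℕₚ.^-monoʳ-< 2 (s≤s (s≤s z≤n)) s<m) λ u → sym (begin
          proj₁ u                           ≈⟨ *-identityˡ _ ⟨
          1# * proj₁ u                      ≈⟨ *-congʳ y≈1 ⟨
          _ * proj₁ u                       ≈⟨ iy u ⟩
          proj₁ (u ^ᴸ (2 ℕ.^ s)) * _        ≈⟨ *-congˡ y≈1 ⟩
          proj₁ (u ^ᴸ (2 ℕ.^ s)) * 1#       ≈⟨ *-identityʳ _ ⟩
          proj₁ (u ^ᴸ (2 ℕ.^ s))            ∎)
      go (suc r⁻) r≡ = rec (m%n<n m s) (≡.subst (1 ℕ.≤_) (≡.sym r≡) (s≤s z≤n)) (ℕₚ.<-trans (m%n<n m s) s<m) z z≉0 iz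
        where
        v = w ^ k
        v≉0 : ¬ v ≈ 0#
        v≉0 = ^-nonZero k w≉0
        z = proj₁ (rightInverse v≉0)
        vz≈1 : v * z ≈ 1#
        vz≈1 = proj₂ (rightInverse v≉0)
        z≉0 : ¬ z ≈ 0#
        z≉0 z≈0 = 1≉0 (trans (sym vz≈1) (trans (*-congˡ z≈0) (zeroʳ v)))
        iz : Intertwines r z
        iz u = *-cancelˡ v≉0 (begin
          v * (z * proj₁ u)                       ≈⟨ *-assoc _ _ _ ⟨
          (v * z) * proj₁ u                       ≈⟨ *-congʳ vz≈1 ⟩
          1# * proj₁ u                            ≈⟨ *-identityˡ _ ⟩
          proj₁ u                                 ≈⟨ frobenius^m u ⟨
          proj₁ (u ^ᴸ (2 ℕ.^ m))                  ≈⟨ LP.^-congʳ u (≡.cong (2 ℕ.^_) (≡.trans m≡ (ℕₚ.+-comm r _))) ⟩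
          proj₁ (u ^ᴸ (2 ℕ.^ (k ℕ.* s ℕ.+ r)))    ≈⟨ ^2^ u r (k ℕ.* s) ⟨
          proj₁ ((u ^ᴸ (2 ℕ.^ r)) ^ᴸ (2 ℕ.^ (k ℕ.* s)))  ≈⟨ *-identityʳ _ ⟨
          proj₁ ((u ^ᴸ (2 ℕ.^ r)) ^ᴸ (2 ℕ.^ (k ℕ.* s))) * 1#  ≈⟨ *-congˡ vz≈1 ⟨
          proj₁ ((u ^ᴸ (2 ℕ.^ r)) ^ᴸ (2 ℕ.^ (k ℕ.* s))) * (v * z)  ≈⟨ *-assoc _ _ _ ⟨
          (proj₁ ((u ^ᴸ (2 ℕ.^ r)) ^ᴸ (2 ℕ.^ (k ℕ.* s))) * v) * z  ≈⟨ *-congʳ (intertwines-^ {s} iw k (u ^ᴸ (2 ℕ.^ r))) ⟨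
          (v * proj₁ (u ^ᴸ (2 ℕ.^ r))) * z        ≈⟨ *-assoc _ _ _ ⟩
          v * (proj₁ (u ^ᴸ (2 ℕ.^ r)) * z)        ∎)

  rightMultiplication-period : ∀ (u : ∃ E) → (∀ v → v * proj₁ u ≈ 0#) ⊎ (∀ v → fold v (_* proj₁ u) n ≈ v)
  rightMultiplication-period u with proj₁ u ≟ 0#
  ... | yes u≈0 = inj₁ λ v → trans (*-congˡ u≈0) (zeroʳ v)
  ... | no u≉0  = inj₂ λ v → trans (iterate v n) (trans (*-congˡ (LP.fermat {u} u≉0)) (*-identityʳ v))
    where
    iterate : ∀ v k → fold v (_* proj₁ u) k ≈ v * proj₁ (u ^ᴸ k)
    iterate v zero    = sym (*-identityʳ v)
    iterate v (suc k) = begin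
      fold v (_* proj₁ u) k * proj₁ u       ≈⟨ *-congʳ (iterate v k) ⟩
      (v * proj₁ (u ^ᴸ k)) * proj₁ u        ≈⟨ *-assoc _ _ _ ⟩
      v * (proj₁ (u ^ᴸ k) * proj₁ u)        ≈⟨ *-congˡ (L.*-comm (u ^ᴸ k) u) ⟩
      v * proj₁ (u ^ᴸ suc k)                ∎

  rightMultiplication-comm : ∀ (u v : ∃ E) x → (x * proj₁ v) * proj₁ u ≈ (x * proj₁ u) * proj₁ v
  rightMultiplication-comm u v x = trans (*-assoc _ _ _) (trans (*-congˡ (L.*-comm v u)) (sym (*-assoc _ _ _)))

  rightMultiplication-linear : ∀ (u : ∃ E) → EV.IsLinear (_* proj₁ u)
  rightMultiplication-linear u = record
    { cong   = *-congʳ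
    ; +-homo = λ x y → distribʳ (proj₁ u) x y
    ; *-homo = λ a x → *-assoc (proj₁ a) x (proj₁ u)
    }

  E-isSubmodule : ML.IsSubmodule E
  E-isSubmodule = record
    { resp = resp ; 0-closed = 0-closed ; +-closed = +-closed ; *ₗ-closed = λ a → *-closed (proj₂ a) }

  ¬normalizer : ∀ {w} → ¬ E w → ¬ (∀ (u : ∃ E) → ∃[ a ] w * proj₁ u ≈ proj₁ {B = E} a * w)
  ¬normalizer {w} w∉E normalizes = absurd frob
    where
    w≉0 : ¬ w ≈ 0#
    w≉0 w≈0 = w∉E (resp (sym w≈0) 0-closed)
    σ : ∃ E → ∃ E
    σ u = proj₁ (normalizes u)
    σ-spec : ∀ u → w * proj₁ u ≈ proj₁ (σ u) * w
    σ-spec u = proj₂ (normalizes u)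
    frob = L2.automorphism≈frobenius σ
      (λ {x} {y} eq → *-cancelʳ w≉0 (trans (sym (σ-spec x)) (trans (*-congˡ eq) (σ-spec y))))
      (λ x y → *-cancelʳ w≉0 (trans (sym (σ-spec (x L.+ y))) (trans (distribˡ _ _ _)
        (trans (+-cong (σ-spec x) (σ-spec y)) (sym (distribʳ _ _ _))))))
      (λ x y → *-cancelʳ w≉0 (begin
        proj₁ (σ (x L.* y)) * w                ≈⟨ σ-spec (x L.* y) ⟨
        w * (proj₁ x * proj₁ y)                ≈⟨ *-assoc _ _ _ ⟨
        (w * proj₁ x) * proj₁ y                ≈⟨ *-congʳ (σ-spec x) ⟩
        (proj₁ (σ x) * w) * proj₁ y            ≈⟨ *-assoc _ _ _ ⟩
        proj₁ (σ x) * (w * proj₁ y)            ≈⟨ *-congˡ (σ-spec y) ⟩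
        proj₁ (σ x) * (proj₁ (σ y) * w)        ≈⟨ *-assoc _ _ _ ⟨
        (proj₁ (σ x) * proj₁ (σ y)) * w        ∎))
      (*-cancelʳ w≉0 (trans (sym (σ-spec L.1#)) (trans (*-identityʳ w) (sym (*-identityˡ w)))))
    absurd : ∃[ s ] s ℕ.< m × (∀ u → σ u L.≈ u ^ᴸ (2 ℕ.^ s)) → ⊥
    absurd (zero , _ , σ≈) = w∉E (E-maximal λ u →
      trans (σ-spec u) (trans (*-congʳ (σ≈ u)) (*-congʳ (*-identityʳ (proj₁ u)))))
    absurd (suc s , s<m , σ≈) = ¬intertwines (suc s) (s≤s z≤n) s<m w w≉0 λ u →
      trans (σ-spec u) (*-congʳ (σ≈ u))

  private
    module EI = Inverse L.size

    R : Fin (2 ℕ.^ m) → Carrier → Carrier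
    R i v = v * proj₁ (EI.from i)

    R-linear : ∀ i → EV.IsLinear (R i)
    R-linear i = rightMultiplication-linear (EI.from i)

    R-commute : ∀ i j → EV.Commute (R i) (R j)
    R-commute i j x = rightMultiplication-comm (EI.from i) (EI.from j) x

    R-period : ∀ i → (∀ v → R i v ≈ 0#) ⊎ (∀ v → fold v (R i) n ≈ v)
    R-period i = rightMultiplication-period (EI.from i)

  -- `E` itself is the submodule to be avoided: a common eigenvector w of the right multiplications
  -- by E satisfies w u ∈ E w for all u ∈ E, which `¬normalizer` excludes outside E.
  ¬¬E : ∀ v → ¬ ¬ E v
  ¬¬E v v∉E with w , w∉E , eigen ← EV.simultaneousEigenvector E-isSubmodule P? R R-linear R-commute R-period v∉E =
    ¬normalizer w∉E λ u → proj₁ (eigen (EI.to u)) ,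
      trans (*-congˡ (sym (EI.strictlyInverseʳ u))) (proj₂ (eigen (EI.to u)))

  total : ∀ v → E v
  total v = decidable-stable (P? v) (¬¬E v)

wedderburn : ∀ (D : Semifield c ℓ) → IsCharTwo D → IsAssociative D → IsCommutative D
wedderburn D x+x≈0 *-assoc x y with _ , self ← CommutingSubsets.selfCentralizing D x+x≈0 *-assoc =
  CommutingSubsets.IsSelfCentralizing.comm self (total x) (total y)
  where open SelfCentralizing D x+x≈0 *-assoc self

-- Scalars from the left nucleus

-- The elements of a nucleus come with proofs and live at the level of the semifield, whereas the
-- theorem asks for a field at level zero. Transport to `Fin q` achieves this and makes equality
-- propositional.
module OnFin {q} (K : FiniteField c ℓ q) where
  open FiniteField K
  open Inverse size
  open HasSizeProperties size

  rawRing′ : RawRing 0ℓ 0ℓ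
  rawRing′ = record
    { Carrier = Fin q
    ; _≈_ = _≡_
    ; _+_ = λ i j → to (from i + from j)
    ; _*_ = λ i j → to (from i * from j)
    ; -_  = λ i → to (- from i)
    ; 0#  = to 0#
    ; 1#  = to 1#
    }

  from-isRingMonomorphism : IsRingMonomorphism rawRing′ (CommutativeRing.rawRing commutativeRing) from
  from-isRingMonomorphism = record
    { isRingHomomorphism = record
      { isSemiringHomomorphism = record
        { isNearSemiringHomomorphism = record
          { +-isMonoidHomomorphism = record
            { isMagmaHomomorphism = record
              { isRelHomomorphism = record { cong = from-cong }
              ; homo = λ i j → from∘to _ }
            ; ε-homo = from∘to _ }
          ; *-homo = λ i j → from∘to _ }
        ; 1#-homo = from∘to _ }
      ; -‿homo = λ i → from∘to _ }
    ; injective = from-injective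
    }

  finiteField : FiniteField 0ℓ 0ℓ q
  finiteField = record
    { commutativeRing = record
      { isCommutativeRing = RingMonomorphism.isCommutativeRing from-isRingMonomorphism isCommutativeRing }
    ; 1≉0 = 1≉0 ∘ to-injective
    ; invertible = λ i i≢0 →
        let y , yx≈1 , xy≈1 = invertible (from i) (λ eq → i≢0 (≡.trans (≡.sym (to∘from i)) (to-cong eq)))
        in to y , to-cong (trans (*-congʳ (from∘to y)) yx≈1) , to-cong (trans (*-congˡ (from∘to y)) xy≈1)
    ; size = record { to = id ; from = id ; to-cong = id ; from-cong = id ; inverse = id , id }
    }

-- A copy of `L` inside the left nucleus, possibly a proper part of it. For `opposite S` the same
-- record describes scalars from the right nucleus.
record LeftScalars {q} (L : FiniteField a b q) (S : Semifield c ℓ) : Set (a ⊔ b ⊔ c ⊔ ℓ) where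
  private
    module L = FiniteField L
  open Semifield S
  field
    ι         : L.Carrier → Carrier
    ι-cong    : ∀ {a b} → a L.≈ b → ι a ≈ ι b
    ι-+       : ∀ a b → ι (a L.+ b) ≈ ι a + ι b
    ι-*       : ∀ a b → ι (a L.* b) ≈ ι a * ι b
    ι-1       : ι L.1# ≈ 1#
    ι-nucleus : ∀ a → InLeftNucleus S (ι a)

module ScalarProperties {q} {L : FiniteField a b q} {S : Semifield c ℓ} (x+x≈0 : IsCharTwo S)
  (Λ : LeftScalars L S) where

  private
    module L = FiniteField L
  open Semifield S hiding (zero)
  open SemifieldProperties S x+x≈0
  open LeftScalars Λ
  open SetoidReasoning setoid

  ι-0 : ι L.0# ≈ 0#
  ι-0 = begin
    ι L.0#                          ≈⟨ +-identityʳ _ ⟨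
    ι L.0# + 0#                     ≈⟨ +-congˡ (x+x≈0 _) ⟨
    ι L.0# + (ι L.0# + ι L.0#)      ≈⟨ +-congˡ (ι-+ _ _) ⟨
    ι L.0# + ι (L.0# L.+ L.0#)      ≈⟨ +-congˡ (ι-cong (L.+-identityˡ L.0#)) ⟩
    ι L.0# + ι L.0#                 ≈⟨ x+x≈0 _ ⟩
    0#                              ∎

  open HasSizeProperties L.size using () renaming (_≟_ to _≟ᴸ_; ∃? to ∃ᴸ?)

  ι-nonZero : ∀ {a} → a L.≉ L.0# → ¬ ι a ≈ 0#
  ι-nonZero {a} a≉0 ιa≈0 = let y , ya≈1 , _ = L.invertible a a≉0 in 1≉0 (begin
    1#             ≈⟨ ι-1 ⟨
    ι L.1#         ≈⟨ ι-cong ya≈1 ⟨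
    ι (y L.* a)    ≈⟨ ι-* y a ⟩
    ι y * ι a      ≈⟨ *-congˡ ιa≈0 ⟩
    ι y * 0#       ≈⟨ zeroʳ _ ⟩
    0#             ∎)

  ι≈0⇒≈0 : ∀ {a} → ι a ≈ 0# → a L.≈ L.0#
  ι≈0⇒≈0 {a} ιa≈0 with a ≟ᴸ L.0#
  ... | yes a≈0 = a≈0
  ... | no a≉0  = contradiction ιa≈0 (ι-nonZero a≉0)

  L-x+x≈0 : ∀ a → a L.+ a L.≈ L.0#
  L-x+x≈0 a = ι≈0⇒≈0 (trans (ι-+ a a) (x+x≈0 (ι a)))

  L-+≈0⇒≈ : ∀ {a b} → a L.+ b L.≈ L.0# → a L.≈ b
  L-+≈0⇒≈ {a} {b} eq = L.trans (L.sym (L.+-identityʳ a)) (L.trans (L.+-congˡ (L.sym (L-x+x≈0 b)))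
    (L.trans (L.sym (L.+-assoc a b b)) (L.trans (L.+-congʳ eq) (L.+-identityˡ b))))

  ι-injective : ∀ {a b} → ι a ≈ ι b → a L.≈ b
  ι-injective eq = L-+≈0⇒≈ (ι≈0⇒≈0 (trans (ι-+ _ _) (≈⇒+≈0 eq)))

  leftModule : LeftModule (CommutativeRing.ring L.commutativeRing) c ℓ
  leftModule = record
    { Carrierᴹ = Carrier ; _≈ᴹ_ = _≈_ ; _+ᴹ_ = _+_ ; _*ₗ_ = λ a v → ι a * v ; 0ᴹ = 0# ; -ᴹ_ = -_
    ; isLeftModule = record
      { isLeftSemimodule = record
        { +ᴹ-isCommutativeMonoid = +-isCommutativeMonoid
        ; isPreleftSemimodule = record
          { *ₗ-cong = λ eq eq′ → *-cong (ι-cong eq) eq′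
          ; *ₗ-zeroˡ = λ v → trans (*-congʳ ι-0) (zeroˡ v)
          ; *ₗ-distribʳ = λ v a b → trans (*-congʳ (ι-+ a b)) (distribʳ v (ι a) (ι b))
          ; *ₗ-identityˡ = λ v → trans (*-congʳ ι-1) (*-identityˡ v)
          ; *ₗ-assoc = λ a b v → trans (*-congʳ (ι-* a b)) (sym (ι-nucleus a (ι b) v))
          ; *ₗ-zeroʳ = λ a → zeroʳ (ι a)
          ; *ₗ-distribˡ = λ a → distribˡ (ι a)
          }
        }
      ; -ᴹ‿cong = -‿cong
      ; -ᴹ‿inverse = -‿inverse
      }
    }

  open PolynomialFunctions L leftModule using (IsSubmodule)
  open LeftModule leftModule using (*ₗ-assoc; *ₗ-distribʳ; *ₗ-distribˡ)

  Line : Carrier → Carrier → Set (a ⊔ ℓ)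
  Line f x = ∃[ a ] ι a * f ≈ x

  line? : ∀ f → Decidable (Line f)
  line? f x = ∃ᴸ? (λ eq p → trans (*-congʳ (ι-cong (L.sym eq))) p) (λ a → (ι a * f) ≟ x)

  line-isSubmodule : ∀ f → IsSubmodule (Line f)
  line-isSubmodule f = record
    { resp      = λ eq (a , p) → a , trans p eq
    ; 0-closed  = L.0# , trans (*-congʳ ι-0) (zeroˡ f)
    ; +-closed  = λ (a , p) (b , q) → a L.+ b , trans (*ₗ-distribʳ f a b) (+-cong p q)
    ; *ₗ-closed = λ d (a , p) → d L.* a , trans (*ₗ-assoc d a f) (*-congˡ p)
    }

  combination : (f e : Carrier) → L.Carrier × L.Carrier → Carrier
  combination f e (a , b) = ι a * f + ι b * e

  combination-cong : ∀ {f e a b a′ b′} → a L.≈ a′ → b L.≈ b′ → combination f e (a , b) ≈ combination f e (a′ , b′)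
  combination-cong eq eq′ = +-cong (*-congʳ (ι-cong eq)) (*-congʳ (ι-cong eq′))

  +-commutativeSemigroup : CommutativeSemigroup c ℓ
  +-commutativeSemigroup = record { isCommutativeSemigroup = +-isCommutativeSemigroup }

  open CommutativeSemigroupProperties +-commutativeSemigroup public using (interchange)

  combination-+ : ∀ {f e} a b a′ b′ →
    combination f e (a L.+ a′ , b L.+ b′) ≈ combination f e (a , b) + combination f e (a′ , b′)
  combination-+ {f} {e} a b a′ b′ =
    trans (+-cong (*ₗ-distribʳ f a a′) (*ₗ-distribʳ e b b′)) (interchange _ _ _ _)

  combination-* : ∀ {f e} d a b → ι d * combination f e (a , b) ≈ combination f e (d L.* a , d L.* b)
  combination-* {f} {e} d a b = trans (distribˡ _ _ _) (sym (+-cong (*ₗ-assoc d a f) (*ₗ-assoc d b e)))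

  Independent : Carrier → Carrier → Set (a ⊔ b ⊔ ℓ)
  Independent f e = ∀ a b → ι a * f + ι b * e ≈ 0# → a L.≈ L.0# × b L.≈ L.0#

  independent : ∀ {f e} → ¬ f ≈ 0# → ¬ Line f e → Independent f e
  independent {f} {e} f≉0 e∉Lf a b eq with b ≟ᴸ L.0#
  ... | yes b≈0 = a≈0 , b≈0
    where
    a≈0 : a L.≈ L.0#
    a≈0 with a ≟ᴸ L.0#
    ... | yes p  = p
    ... | no a≉0 = contradiction (begin
      ι a * f             ≈⟨ +-identityʳ _ ⟨
      ι a * f + 0#        ≈⟨ +-congˡ (trans (*-congʳ (trans (ι-cong b≈0) ι-0)) (zeroˡ e)) ⟨
      ι a * f + ι b * e   ≈⟨ eq ⟩
      0#                  ∎) (*-nonZero (ι-nonZero a≉0) f≉0)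
  ... | no b≉0 = contradiction (IsSubmodule.unscale (line-isSubmodule f) b≉0 (a , +≈0⇒≈ eq)) e∉Lf

  combination-injective : ∀ {f e} → Independent f e → ∀ {a b a′ b′} →
    combination f e (a , b) ≈ combination f e (a′ , b′) → a L.≈ a′ × b L.≈ b′
  combination-injective ind {a} {b} {a′} {b′} eq =
    let p , q = ind (a L.+ a′) (b L.+ b′) (trans (combination-+ a b a′ b′) (≈⇒+≈0 eq))
    in L-+≈0⇒≈ p , L-+≈0⇒≈ q

  spans : ∀ {f e} → Independent f e → HasSize setoid (q ℕ.* q) → ∀ x → ∃[ p ] combination f e p ≈ x
  spans ind size = injective⇒surjective {A = ×-setoid L.setoid L.setoid} (hasSize-× L.size L.size) size
    (combination _ _) (combination-injective ind)

module LeftNucleus (S : Semifield c ℓ) (x+x≈0 : IsCharTwo S) where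
  open Semifield S hiding (zero)
  open SemifieldProperties S x+x≈0
  open SetoidReasoning setoid

  isSubsemifield : IsSubsemifield (InLeftNucleus S)
  isSubsemifield = record
    { resp = λ eq h y w → trans (*-congʳ (sym eq)) (trans (h y w) (*-congʳ (*-congʳ eq)))
    ; P? = λ x → ∀? (λ eq h w → trans (*-congˡ (*-congʳ (sym eq))) (trans (h w) (*-congʳ (*-congˡ eq))))
        (λ y → ∀? (λ eq h → trans (*-congˡ (*-congˡ (sym eq))) (trans h (*-congˡ eq))) (λ w → (x * (y * w)) ≟ ((x * y) * w)))
    ; 1-closed = λ y w → trans (*-identityˡ _) (*-congʳ (sym (*-identityˡ y)))
    ; +-closed = λ {x} {x′} h h′ y w → begin
        (x + x′) * (y * w)               ≈⟨ distribʳ _ _ _ ⟩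
        x * (y * w) + x′ * (y * w)       ≈⟨ +-cong (h y w) (h′ y w) ⟩
        (x * y) * w + (x′ * y) * w       ≈⟨ distribʳ _ _ _ ⟨
        (x * y + x′ * y) * w             ≈⟨ *-congʳ (distribʳ _ _ _) ⟨
        ((x + x′) * y) * w               ∎
    ; *-closed = λ {x} {x′} h h′ y w → begin
        (x * x′) * (y * w)               ≈⟨ h x′ (y * w) ⟨
        x * (x′ * (y * w))               ≈⟨ *-congˡ (h′ y w) ⟩
        x * ((x′ * y) * w)               ≈⟨ h (x′ * y) w ⟩
        (x * (x′ * y)) * w               ≈⟨ *-congʳ (h x′ y) ⟩
        ((x * x′) * y) * w               ∎
    }

  private
    K : Semifield (c ⊔ ℓ) ℓ
    K = IsSubsemifield.semifield isSubsemifield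

    K-x+x≈0 : IsCharTwo K
    K-x+x≈0 x = x+x≈0 (proj₁ x)

    K-assoc : ∀ (x y z : ∃ (InLeftNucleus S)) → (proj₁ x * proj₁ y) * proj₁ z ≈ proj₁ x * (proj₁ y * proj₁ z)
    K-assoc x y z = sym (proj₂ x (proj₁ y) (proj₁ z))

    K-comm : ∀ (x y : ∃ (InLeftNucleus S)) → proj₁ x * proj₁ y ≈ proj₁ y * proj₁ x
    K-comm = wedderburn K K-x+x≈0 K-assoc

  scalars : ∃[ m ] Σ[ L ∈ FiniteField 0ℓ 0ℓ (2 ℕ.^ m) ] Σ[ Λ ∈ LeftScalars L S ]
            (∀ {x} → InLeftNucleus S x → ∃[ a ] LeftScalars.ι Λ a ≈ x)
  scalars with m , size ← SemifieldProperties.hasSize-2^ K K-x+x≈0 = m , OnFin.finiteField F , record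
      { ι         = λ i → proj₁ (from i)
      ; ι-cong    = λ { ≡.refl → refl }
      ; ι-+       = λ i j → strictlyInverseʳ (from i F.+ from j)
      ; ι-*       = λ i j → strictlyInverseʳ (from i F.* from j)
      ; ι-1       = strictlyInverseʳ F.1#
      ; ι-nucleus = λ i → proj₂ (from i)
      } , λ hx → to (_ , hx) , strictlyInverseʳ (_ , hx)
    where
    F : FiniteField (c ⊔ ℓ) ℓ (2 ℕ.^ m)
    F = SemifieldProperties.Associative.finiteField K K-x+x≈0 K-assoc K-comm size
    module F = FiniteField F
    open Inverse size

  hasSize-square : ∀ {q} {L : FiniteField a b q} (Λ : LeftScalars L S) →
    (∀ {x} → InLeftNucleus S x → ∃[ a ] LeftScalars.ι Λ a ≈ x) → HasLeftNuclearDimension S 2 →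
    HasSize setoid (q ℕ.* q)
  hasSize-square {L = L} Λ onto (e , basis) = hasSize-bijection {A = ×-setoid L.setoid L.setoid} (hasSize-× L.size L.size)
    (combination e₀ e₁) (λ (p , q) → combination-cong p q) (combination-injective ind)
    (λ x → let k , k-nucleus , eq = spanning x ; a , ιa≈k₀ = onto (k-nucleus zero) ; b , ιb≈k₁ = onto (k-nucleus (suc zero)) in
      (a , b) , trans (+-cong (*-congʳ ιa≈k₀) (trans (*-congʳ ιb≈k₁) (sym (+-identityʳ _)))) eq)
    where
    open IsLeftNuclearBasis basis
    module L = FiniteField L
    open LeftScalars Λ
    open ScalarProperties x+x≈0 Λ
    e₀ e₁ : Carrier
    e₀ = e zero
    e₁ = e (suc zero)
    pair : Carrier → Carrier → Vector Carrier 2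
    pair k₀ k₁ zero       = k₀
    pair k₀ k₁ (suc zero) = k₁
    ind : Independent e₀ e₁
    ind a b eq = ι≈0⇒≈0 (k≈0 zero) , ι≈0⇒≈0 (k≈0 (suc zero))
      where
      k : Vector Carrier 2
      k = pair (ι a) (ι b)
      k≈0 : ∀ i → k i ≈ 0#
      k≈0 = independent′ k (λ { zero → ι-nucleus a ; (suc zero) → ι-nucleus b })
        (trans (+-congˡ (+-identityʳ _)) eq)
        where
        open IsLeftNuclearBasis basis renaming (independent to independent′)

-- Diagonalization of the right nucleus

-- κ parametrizes the right nucleus by its eigenvalues on w₂.
record DiagonalBasis (m : ℕ) {L : FiniteField a b (2 ℕ.^ m)} {S : Semifield c ℓ} (x+x≈0 : IsCharTwo S)
  (Λ : LeftScalars L S) : Set (a ⊔ b ⊔ c ⊔ ℓ) where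
  private
    module L = FiniteField L
  open Semifield S
  open LeftScalars Λ
  open ScalarProperties x+x≈0 Λ using (Independent)
  open Exp L.semiring using (_^_)
  field
    s         : ℕ
    s<m       : s ℕ.< m
    κ         : L.Carrier → Carrier
    κ-cong    : ∀ {a b} → a L.≈ b → κ a ≈ κ b
    κ-+       : ∀ a b → κ (a L.+ b) ≈ κ a + κ b
    κ-nucleus : ∀ a x y → (x * y) * κ a ≈ x * (y * κ a)
    w₁ w₂     : Carrier
    basis     : Independent w₁ w₂
    w₁-κ      : ∀ a → w₁ * κ a ≈ ι (a ^ (2 ℕ.^ s)) * w₁
    w₂-κ      : ∀ a → w₂ * κ a ≈ ι a * w₂

module Diagonalization {m} {L L′ : FiniteField a b (2 ℕ.^ m)} {S : Semifield c ℓ} (x+x≈0 : IsCharTwo S)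
  (Λ : LeftScalars L S) (P : LeftScalars L′ (opposite S))
  (size : HasSize (Semifield.setoid S) (2 ℕ.^ m ℕ.* 2 ℕ.^ m)) where

  private
    module L = FiniteField L
    module L′ = FiniteField L′
    module PP = ScalarProperties {S = opposite S} x+x≈0 P
  open Semifield S hiding (zero)
  open SemifieldProperties S x+x≈0
  open LeftScalars Λ
  open LeftScalars P using () renaming
    (ι to κ; ι-cong to κ-cong; ι-+ to κ-+; ι-* to κ-*; ι-1 to κ-1; ι-nucleus to κ-nucleus)
  open ScalarProperties x+x≈0 Λ
  open SetoidReasoning setoid

  n : ℕ
  n = ℕ.pred (2 ℕ.^ m)

  q≡1+n : 2 ℕ.^ m ≡ suc n
  q≡1+n = 2^≡1+pred m

  private
    module LP = FieldProperties L q≡1+n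
    module LP′ = FieldProperties L′ q≡1+n
    module L2 = LP.Char2 m ≡.refl
    module EV = Eigenvectors L q≡1+n leftModule
    module ML = PolynomialFunctions L leftModule

  IsCommonEigenvector : Carrier → Set (a ⊔ ℓ)
  IsCommonEigenvector w = ∀ u → ∃[ e ] w * κ u ≈ ι e * w

  module _ {p} {W : Pred Carrier p} (W-isSubmodule : ML.IsSubmodule W) (W? : Decidable W) where

    private
      module S′ = Inverse L′.size

      R : Fin (2 ℕ.^ m) → Carrier → Carrier
      R i v = v * κ (S′.from i)

      R-linear : ∀ i → EV.IsLinear (R i)
      R-linear i = record
        { cong   = *-congʳ
        ; +-homo = λ x y → distribʳ (κ (S′.from i)) x y
        ; *-homo = λ e v → sym (ι-nucleus e v (κ (S′.from i)))
        }

      R-commute : ∀ i j → EV.Commute (R i) (R j)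
      R-commute i j v = begin
        (v * κ (S′.from j)) * κ (S′.from i)    ≈⟨ κ-nucleus (S′.from i) (κ (S′.from j)) v ⟩
        v * (κ (S′.from j) * κ (S′.from i))    ≈⟨ *-congˡ (κ-* (S′.from i) (S′.from j)) ⟨
        v * κ (S′.from i L′.* S′.from j)       ≈⟨ *-congˡ (κ-cong (L′.*-comm (S′.from i) (S′.from j))) ⟩
        v * κ (S′.from j L′.* S′.from i)       ≈⟨ *-congˡ (κ-* (S′.from j) (S′.from i)) ⟩
        v * (κ (S′.from i) * κ (S′.from j))    ≈⟨ κ-nucleus (S′.from j) (κ (S′.from i)) v ⟨
        (v * κ (S′.from i)) * κ (S′.from j)    ∎

      R-period : ∀ i → (∀ v → R i v ≈ 0#) ⊎ (∀ v → fold v (R i) n ≈ v)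
      R-period i with S′.from i LP′.≟ L′.0#
      ... | yes u≈0 = inj₁ λ v → trans (*-congˡ (trans (κ-cong u≈0) PP.ι-0)) (zeroʳ v)
      ... | no u≉0  = inj₂ λ v → trans (iterate v n)
              (trans (*-congˡ (trans (κ-cong (LP′.fermat u≉0)) κ-1)) (*-identityʳ v))
        where
        u : L′.Carrier
        u = S′.from i
        iterate : ∀ v k → fold v (R i) k ≈ v * κ (u LP′.^ k)
        iterate v zero    = sym (trans (*-congˡ κ-1) (*-identityʳ v))
        iterate v (suc k) = begin
          fold v (R i) k * κ u            ≈⟨ *-congʳ (iterate v k) ⟩
          (v * κ (u LP′.^ k)) * κ u       ≈⟨ κ-nucleus u (κ (u LP′.^ k)) v ⟩
          v * (κ (u LP′.^ k) * κ u)       ≈⟨ *-congˡ (κ-* u (u LP′.^ k)) ⟨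
          v * κ (u LP′.^ suc k)           ∎

    commonEigenvector : ∀ {v} → ¬ W v → ∃[ w ] ¬ W w × IsCommonEigenvector w
    commonEigenvector v∉W with w , w∉W , eigen ← EV.simultaneousEigenvector W-isSubmodule W? R R-linear R-commute R-period v∉W =
      w , w∉W , λ u → proj₁ (eigen (S′.to u)) ,
        trans (*-congˡ (κ-cong (L′.sym (S′.strictlyInverseʳ u)))) (proj₂ (eigen (S′.to u)))

  module Eigenvalue {w} (w≉0 : ¬ w ≈ 0#) (eigen : IsCommonEigenvector w) where

    σ : L′.Carrier → L.Carrier
    σ u = proj₁ (eigen u)

    σ-spec : ∀ u → w * κ u ≈ ι (σ u) * w
    σ-spec u = proj₂ (eigen u)

    σ-cong : ∀ {u v} → u L′.≈ v → σ u L.≈ σ v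
    σ-cong eq = ι-injective (*-cancelʳ w≉0 (trans (sym (σ-spec _)) (trans (*-congˡ (κ-cong eq)) (σ-spec _))))

    σ-+ : ∀ u v → σ (u L′.+ v) L.≈ σ u L.+ σ v
    σ-+ u v = ι-injective (*-cancelʳ w≉0 (begin
      ι (σ (u L′.+ v)) * w           ≈⟨ σ-spec _ ⟨
      w * κ (u L′.+ v)               ≈⟨ *-congˡ (κ-+ u v) ⟩
      w * (κ u + κ v)                ≈⟨ distribˡ _ _ _ ⟩
      w * κ u + w * κ v              ≈⟨ +-cong (σ-spec u) (σ-spec v) ⟩
      ι (σ u) * w + ι (σ v) * w      ≈⟨ distribʳ _ _ _ ⟨
      (ι (σ u) + ι (σ v)) * w        ≈⟨ *-congʳ (ι-+ _ _) ⟨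
      ι (σ u L.+ σ v) * w            ∎))

    σ-* : ∀ u v → σ (u L′.* v) L.≈ σ u L.* σ v
    σ-* u v = ι-injective (*-cancelʳ w≉0 (begin
      ι (σ (u L′.* v)) * w           ≈⟨ *-congʳ (ι-cong (σ-cong (L′.*-comm u v))) ⟩
      ι (σ (v L′.* u)) * w           ≈⟨ σ-spec _ ⟨
      w * κ (v L′.* u)               ≈⟨ *-congˡ (κ-* v u) ⟩
      w * (κ u * κ v)                ≈⟨ κ-nucleus v (κ u) w ⟨
      (w * κ u) * κ v                ≈⟨ *-congʳ (σ-spec u) ⟩
      (ι (σ u) * w) * κ v            ≈⟨ ι-nucleus (σ u) w (κ v) ⟨
      ι (σ u) * (w * κ v)            ≈⟨ *-congˡ (σ-spec v) ⟩
      ι (σ u) * (ι (σ v) * w)        ≈⟨ ι-nucleus (σ u) (ι (σ v)) w ⟩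
      (ι (σ u) * ι (σ v)) * w        ≈⟨ *-congʳ (ι-* _ _) ⟨
      ι (σ u L.* σ v) * w            ∎))

    σ-1 : σ L′.1# L.≈ L.1#
    σ-1 = ι-injective (*-cancelʳ w≉0 (trans (sym (σ-spec _)) (trans (*-congˡ κ-1)
      (trans (*-identityʳ w) (trans (sym (*-identityˡ w)) (*-congʳ (sym ι-1)))))))

    σ-injective : ∀ {u v} → σ u L.≈ σ v → u L′.≈ v
    σ-injective eq = PP.ι-injective (*-cancelˡ w≉0 (trans (σ-spec _) (trans (*-congʳ (ι-cong eq)) (sym (σ-spec _)))))

    σ-surjective : ∀ e → ∃[ u ] σ u L.≈ e
    σ-surjective = injective⇒surjective L′.size L.size σ σ-injective

  ¬allInLine : ∀ {w} → ¬ w ≈ 0# → ¬ (∀ x → Line w x)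
  ¬allInLine {w} w≉0 all = ℕₚ.<⇒≢ q<q² (hasSize-unique L-size size)
    where
    L-size : HasSize setoid (2 ℕ.^ m)
    L-size = hasSize-bijection L.size (λ e → ι e * w) (λ eq → *-congʳ (ι-cong eq)) (λ eq → ι-injective (*-cancelʳ w≉0 eq)) all
    q<q² : 2 ℕ.^ m ℕ.< 2 ℕ.^ m ℕ.* 2 ℕ.^ m
    q<q² = ℕₚ.m<m*n (2 ℕ.^ m) (2 ℕ.^ m) {{ℕₚ.m^n≢0 2 m}} (≡.subst (1 ℕ.<_) (≡.sym q≡1+n) (s≤s LP.1≤n))

  outsideLine : ∀ {w} → ¬ w ≈ 0# → ∃[ v ] ¬ Line w v
  outsideLine {w} w≉0 with ∃? (λ eq v∉ → v∉ ∘ ML.IsSubmodule.resp (line-isSubmodule w) (sym eq)) (λ v → ¬? (line? w v))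
  ... | yes found = found
  ... | no none   = contradiction (λ x → decidable-stable (line? w x) (λ x∉ → none (x , x∉))) (¬allInLine w≉0)

  diagonalBasis : DiagonalBasis m x+x≈0 Λ
  diagonalBasis
    -- The submodules to be avoided are 0 for `w₁` and the line through `w₁` for `w₂`, which makes
    -- the two eigenvectors independent.
    with w₁ , w₁≉0 , eigen₁ ← commonEigenvector ML.zero-isSubmodule (_≟ 0#) 1≉0
    with v , v∉ ← outsideLine w₁≉0
    with w₂ , w₂∉ , eigen₂ ← commonEigenvector (line-isSubmodule w₁) (line? w₁) v∉ =
    finish frobenius
    where
    w₂≉0 : ¬ w₂ ≈ 0#
    w₂≉0 w₂≈0 = w₂∉ (ML.IsSubmodule.resp (line-isSubmodule w₁) (sym w₂≈0) (ML.IsSubmodule.0-closed (line-isSubmodule w₁)))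
    module E₁ = Eigenvalue w₁≉0 eigen₁
    module E₂ = Eigenvalue w₂≉0 eigen₂
    σ₂⁻¹ : L.Carrier → L′.Carrier
    σ₂⁻¹ e = proj₁ (E₂.σ-surjective e)
    σ₂-σ₂⁻¹ : ∀ e → E₂.σ (σ₂⁻¹ e) L.≈ e
    σ₂-σ₂⁻¹ e = proj₂ (E₂.σ-surjective e)
    σ₂⁻¹-cong : ∀ {d e} → d L.≈ e → σ₂⁻¹ d L′.≈ σ₂⁻¹ e
    σ₂⁻¹-cong eq = E₂.σ-injective (L.trans (σ₂-σ₂⁻¹ _) (L.trans eq (L.sym (σ₂-σ₂⁻¹ _))))
    σ₂⁻¹-+ : ∀ d e → σ₂⁻¹ (d L.+ e) L′.≈ σ₂⁻¹ d L′.+ σ₂⁻¹ e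
    σ₂⁻¹-+ d e = E₂.σ-injective (L.trans (σ₂-σ₂⁻¹ _) (L.sym (L.trans (E₂.σ-+ _ _) (L.+-cong (σ₂-σ₂⁻¹ d) (σ₂-σ₂⁻¹ e)))))
    σ₂⁻¹-* : ∀ d e → σ₂⁻¹ (d L.* e) L′.≈ σ₂⁻¹ d L′.* σ₂⁻¹ e
    σ₂⁻¹-* d e = E₂.σ-injective (L.trans (σ₂-σ₂⁻¹ _) (L.sym (L.trans (E₂.σ-* _ _) (L.*-cong (σ₂-σ₂⁻¹ d) (σ₂-σ₂⁻¹ e)))))
    σ₂⁻¹-1 : σ₂⁻¹ L.1# L′.≈ L′.1#
    σ₂⁻¹-1 = E₂.σ-injective (L.trans (σ₂-σ₂⁻¹ _) (L.sym E₂.σ-1))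
    -- Each eigenvalue map goes from `L′` to `L`; only the composite of one with the inverse of the
    -- other is an automorphism of `L`.
    frobenius : ∃[ s ] s ℕ.< m × (∀ e → E₁.σ (σ₂⁻¹ e) L.≈ e LP.^ (2 ℕ.^ s))
    frobenius = L2.automorphism≈frobenius (E₁.σ ∘ σ₂⁻¹) (E₁.σ-cong ∘ σ₂⁻¹-cong)
      (λ d e → L.trans (E₁.σ-cong (σ₂⁻¹-+ d e)) (E₁.σ-+ _ _))
      (λ d e → L.trans (E₁.σ-cong (σ₂⁻¹-* d e)) (E₁.σ-* _ _))
      (L.trans (E₁.σ-cong σ₂⁻¹-1) E₁.σ-1)
    finish : ∃[ s ] s ℕ.< m × (∀ e → E₁.σ (σ₂⁻¹ e) L.≈ e LP.^ (2 ℕ.^ s)) → DiagonalBasis m x+x≈0 Λ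
    finish (s , s<m , eq) = record
      { s         = s
      ; s<m       = s<m
      ; κ         = κ ∘ σ₂⁻¹
      ; κ-cong    = κ-cong ∘ σ₂⁻¹-cong
      ; κ-+       = λ d e → trans (κ-cong (σ₂⁻¹-+ d e)) (κ-+ _ _)
      ; κ-nucleus = λ e x y → κ-nucleus (σ₂⁻¹ e) y x
      ; w₁        = w₁
      ; w₂        = w₂
      ; basis     = independent w₁≉0 w₂∉
      ; w₁-κ      = λ e → trans (E₁.σ-spec (σ₂⁻¹ e)) (*-congʳ (ι-cong (eq e)))
      ; w₂-κ      = λ e → trans (E₂.σ-spec (σ₂⁻¹ e)) (*-congʳ (ι-cong (σ₂-σ₂⁻¹ e)))
      }

-- From a diagonal basis to B(2,m,s,0,t)

module _ (R : CommutativeRing c ℓ) where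
  open CommutativeRing R
  open SetoidReasoning setoid

  expandBilinear : ∀ a b p₁ p₂ p₃ p₄ c d →
    a * (p₁ * c + p₃ * d) + b * (p₂ * c + p₄ * d) ≈ p₁ * a * c + p₂ * b * c + p₃ * a * d + p₄ * b * d
  expandBilinear a b p₁ p₂ p₃ p₄ c d = begin
    a * (p₁ * c + p₃ * d) + b * (p₂ * c + p₄ * d)
      ≈⟨ +-cong (distribˡ _ _ _) (distribˡ _ _ _) ⟩
    (a * (p₁ * c) + a * (p₃ * d)) + (b * (p₂ * c) + b * (p₄ * d))
      ≈⟨ CommutativeSemigroupProperties.interchange +-commutativeSemigroup _ _ _ _ ⟩
    (a * (p₁ * c) + b * (p₂ * c)) + (a * (p₃ * d) + b * (p₄ * d))
      ≈⟨ +-cong (+-cong (arrange a p₁ c) (arrange b p₂ c)) (+-cong (arrange a p₃ d) (arrange b p₄ d)) ⟩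
    (p₁ * a * c + p₂ * b * c) + (p₃ * a * d + p₄ * b * d)
      ≈⟨ +-assoc _ _ _ ⟨
    p₁ * a * c + p₂ * b * c + p₃ * a * d + p₄ * b * d ∎
    where
    arrange : ∀ x p z → x * (p * z) ≈ p * x * z
    arrange x p z = trans (sym (*-assoc _ _ _)) (*-congʳ (*-comm x p))

module FromDiagonalBasis {m} {L : FiniteField a b (2 ℕ.^ m)} {S : Semifield c ℓ} (x+x≈0 : IsCharTwo S)
  (Λ : LeftScalars L S) (Δ : DiagonalBasis m x+x≈0 Λ)
  (size : HasSize (Semifield.setoid S) (2 ℕ.^ m ℕ.* 2 ℕ.^ m)) where

  private
    module L = FiniteField L
  open Semifield S hiding (zero)
  open SemifieldProperties S x+x≈0
  open LeftScalars Λ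
  open ScalarProperties x+x≈0 Λ
  open DiagonalBasis Δ
  open Exp L.semiring using (_^_; ^-homo-*)
  open SetoidReasoning setoid

  ^σ : L.Carrier → L.Carrier
  ^σ e = e ^ (2 ℕ.^ s)

  ι-pull : ∀ d e x → ι d * (ι e * x) ≈ ι (d L.* e) * x
  ι-pull d e x = trans (ι-nucleus d (ι e) x) (*-congʳ (sym (ι-* d e)))

  combination-κ : ∀ a b e → combination w₁ w₂ (a , b) * κ e ≈ combination w₁ w₂ (a L.* ^σ e , b L.* e)
  combination-κ a b e = begin
    (ι a * w₁ + ι b * w₂) * κ e                       ≈⟨ distribʳ _ _ _ ⟩
    (ι a * w₁) * κ e + (ι b * w₂) * κ e               ≈⟨ +-cong (ι-nucleus a w₁ (κ e)) (ι-nucleus b w₂ (κ e)) ⟨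
    ι a * (w₁ * κ e) + ι b * (w₂ * κ e)               ≈⟨ +-cong (*-congˡ (w₁-κ e)) (*-congˡ (w₂-κ e)) ⟩
    ι a * (ι (^σ e) * w₁) + ι b * (ι e * w₂)          ≈⟨ +-cong (ι-pull a (^σ e) w₁) (ι-pull b e w₂) ⟩
    ι (a L.* ^σ e) * w₁ + ι (b L.* e) * w₂            ∎

  π : Carrier → L.Carrier × L.Carrier
  π x = proj₁ (spans basis size x)

  π₁ π₂ : Carrier → L.Carrier
  π₁ x = proj₁ (π x)
  π₂ x = proj₂ (π x)

  π-spec : ∀ x → combination w₁ w₂ (π x) ≈ x
  π-spec x = proj₂ (spans basis size x)

  π-unique : ∀ {x a b} → combination w₁ w₂ (a , b) ≈ x → π₁ x L.≈ a × π₂ x L.≈ b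
  π-unique eq = combination-injective basis (trans (π-spec _) (sym eq))

  π-cong : ∀ {x y} → x ≈ y → π₁ x L.≈ π₁ y × π₂ x L.≈ π₂ y
  π-cong eq = π-unique (trans (π-spec _) (sym eq))

  π-+ : ∀ x y → π₁ (x + y) L.≈ π₁ x L.+ π₁ y × π₂ (x + y) L.≈ π₂ x L.+ π₂ y
  π-+ x y = π-unique (trans (combination-+ _ _ _ _) (+-cong (π-spec x) (π-spec y)))

  π-ι : ∀ d x → π₁ (ι d * x) L.≈ d L.* π₁ x × π₂ (ι d * x) L.≈ d L.* π₂ x
  π-ι d x = π-unique (trans (sym (combination-* d _ _)) (*-congˡ (π-spec x)))

  π-κ : ∀ x e → π₁ (x * κ e) L.≈ π₁ x L.* ^σ e × π₂ (x * κ e) L.≈ π₂ x L.* e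
  π-κ x e = π-unique (trans (sym (combination-κ _ _ e)) (*-congʳ (π-spec x)))

  -- If s = 0, then L lies in the right nucleus and commutes with everything, which makes
  -- S = L + L e associative.
  module _ (s≡0 : s ≡ 0) (¬associative : ¬ (∀ x → InLeftNucleus S x)) where

    private
      central : ∀ x d → x * κ d ≈ ι d * x
      central x d = begin
        x * κ d                                             ≈⟨ *-congʳ (π-spec x) ⟨
        combination w₁ w₂ (π x) * κ d                       ≈⟨ combination-κ _ _ d ⟩
        combination w₁ w₂ (π₁ x L.* ^σ d , π₂ x L.* d)      ≈⟨ combination-cong (L.trans (L.*-congˡ ^σd) (L.*-comm _ _)) (L.*-comm _ _) ⟩
        combination w₁ w₂ (d L.* π₁ x , d L.* π₂ x)         ≈⟨ combination-* d _ _ ⟨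
        ι d * combination w₁ w₂ (π x)                       ≈⟨ *-congˡ (π-spec x) ⟩
        ι d * x                                             ∎
        where
        ^σd : ^σ d L.≈ d
        ^σd = ≡.subst (λ s → d ^ (2 ℕ.^ s) L.≈ d) (≡.sym s≡0) (L.*-identityʳ d)

      κ≈ι : ∀ d → κ d ≈ ι d
      κ≈ι d = trans (sym (*-identityˡ _)) (trans (central 1# d) (*-identityʳ _))

      ι-comm : ∀ x d → x * ι d ≈ ι d * x
      ι-comm x d = trans (*-congˡ (sym (κ≈ι d))) (central x d)

      ι-rightNucleus : ∀ x y d → (x * y) * ι d ≈ x * (y * ι d)
      ι-rightNucleus x y d = trans (*-congˡ (sym (κ≈ι d))) (trans (κ-nucleus d x y) (*-congˡ (*-congˡ (κ≈ι d))))

      ι-front : ∀ x d y → x * (ι d * y) ≈ ι d * (x * y)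
      ι-front x d y = begin
        x * (ι d * y)    ≈⟨ *-congˡ (ι-comm y d) ⟨
        x * (y * ι d)    ≈⟨ ι-rightNucleus x y d ⟨
        (x * y) * ι d    ≈⟨ ι-comm (x * y) d ⟩
        ι d * (x * y)    ∎

      module _ (e : Carrier) (decompose : ∀ x → ∃[ p ] combination 1# e p ≈ x) where

        scalar+ : ∀ x → ∃[ d ] ∃[ f ] x ≈ ι d + ι f * e
        scalar+ x = let (d , f) , eq = decompose x in d , f , trans (sym eq) (+-congʳ (*-identityʳ _))

        -- The associator of `e`, `y`, `z` is linear in `y` and `z` over the central scalars and
        -- vanishes if `y` or `z` is a scalar. As 1 and `e` span, everything reduces to this case
        -- `y = z = e`, where `e * e` is expanded instead.
        alternative : e * (e * e) ≈ (e * e) * e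
        alternative with d , f , eq ← scalar+ (e * e) = begin
          e * (e * e)               ≈⟨ *-congˡ eq ⟩
          e * (ι d + ι f * e)       ≈⟨ distribˡ _ _ _ ⟩
          e * ι d + e * (ι f * e)   ≈⟨ +-cong (ι-comm e d) (ι-front e f e) ⟩
          ι d * e + ι f * (e * e)   ≈⟨ +-congˡ (ι-nucleus f e e) ⟩
          ι d * e + (ι f * e) * e   ≈⟨ distribʳ _ _ _ ⟨
          (ι d + ι f * e) * e       ≈⟨ *-congʳ eq ⟨
          (e * e) * e               ∎

        flexible : ∀ y → e * (y * e) ≈ (e * y) * e
        flexible y with d , f , eq ← scalar+ y = begin
          e * (y * e)                            ≈⟨ *-congˡ (*-congʳ eq) ⟩
          e * ((ι d + ι f * e) * e)              ≈⟨ *-congˡ (distribʳ _ _ _) ⟩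
          e * (ι d * e + (ι f * e) * e)          ≈⟨ distribˡ _ _ _ ⟩
          e * (ι d * e) + e * ((ι f * e) * e)    ≈⟨ +-cong (ι-front e d e) (*-congˡ (sym (ι-nucleus f e e))) ⟩
          ι d * (e * e) + e * (ι f * (e * e))    ≈⟨ +-cong (ι-nucleus d e e) (ι-front e f (e * e)) ⟩
          (ι d * e) * e + ι f * (e * (e * e))    ≈⟨ +-cong (*-congʳ (sym (ι-comm e d))) (*-congˡ alternative) ⟩
          (e * ι d) * e + ι f * ((e * e) * e)    ≈⟨ +-congˡ (ι-nucleus f (e * e) e) ⟩
          (e * ι d) * e + (ι f * (e * e)) * e    ≈⟨ +-congˡ (*-congʳ (ι-front e f e)) ⟨
          (e * ι d) * e + (e * (ι f * e)) * e    ≈⟨ distribʳ _ _ _ ⟨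
          (e * ι d + e * (ι f * e)) * e          ≈⟨ *-congʳ (distribˡ _ _ _) ⟨
          (e * (ι d + ι f * e)) * e              ≈⟨ *-congʳ (*-congˡ eq) ⟨
          (e * y) * e                            ∎

        e-nucleus : InLeftNucleus S e
        e-nucleus y z with d , f , eq ← scalar+ z = begin
          e * (y * z)                                    ≈⟨ *-congˡ (*-congˡ eq) ⟩
          e * (y * (ι d + ι f * e))                      ≈⟨ *-congˡ (distribˡ _ _ _) ⟩
          e * (y * ι d + y * (ι f * e))                  ≈⟨ distribˡ _ _ _ ⟩
          e * (y * ι d) + e * (y * (ι f * e))            ≈⟨ +-cong (sym (ι-rightNucleus e y d)) (*-congˡ (ι-front y f e)) ⟩
          (e * y) * ι d + e * (ι f * (y * e))            ≈⟨ +-congˡ (ι-front e f (y * e)) ⟩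
          (e * y) * ι d + ι f * (e * (y * e))            ≈⟨ +-congˡ (*-congˡ (flexible y)) ⟩
          (e * y) * ι d + ι f * ((e * y) * e)            ≈⟨ +-congˡ (ι-front (e * y) f e) ⟨
          (e * y) * ι d + (e * y) * (ι f * e)            ≈⟨ distribˡ _ _ _ ⟨
          (e * y) * (ι d + ι f * e)                      ≈⟨ *-congˡ eq ⟨
          (e * y) * z                                    ∎

      -- An element outside the left nucleus lies outside the line of scalars, so it forms a basis
      -- together with 1, and `e-nucleus` applies to it.
      nuclear : ∀ x → ¬ ¬ InLeftNucleus S x
      nuclear x x∉N = x∉N (e-nucleus x (spans (independent 1≉0 x∉L) size))
        where
        x∉L : ¬ Line 1# x
        x∉L (d , eq) = x∉N (N.resp (trans (sym (*-identityʳ _)) eq) (ι-nucleus d))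
          where module N = IsSubsemifield (LeftNucleus.isSubsemifield S x+x≈0)

    s≡0⇒⊥ : ⊥
    s≡0⇒⊥ = ¬associative (λ x → decidable-stable (N.P? x) (nuclear x))
      where module N = IsSubsemifield (LeftNucleus.isSubsemifield S x+x≈0)

  π-0 : π₁ 0# L.≈ L.0# × π₂ 0# L.≈ L.0#
  π-0 = π-unique (trans (+-cong (trans (*-congʳ ι-0) (zeroˡ w₁)) (trans (*-congʳ ι-0) (zeroˡ w₂))) (+-identityʳ 0#))

  π-w₂ : π₂ w₂ L.≈ L.1#
  π-w₂ = proj₂ (π-unique (trans (+-cong (trans (*-congʳ ι-0) (zeroˡ w₁)) (trans (*-congʳ ι-1) (*-identityˡ w₂))) (+-identityˡ w₂)))

  -- The coordinates (c, d) of a right factor y are dictated by the second component ad + bc: for x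
  -- = a w₁ + b w₂ the second coordinate of x y is a π₂(w₁ y) + b π₂(w₂ y).
  γ : Carrier → L.Carrier × L.Carrier
  γ y = π₂ (w₂ * y) , π₂ (w₁ * y)

  -- For nonzero `y` some `x` satisfies `x * y ≈ w₂`, whose second coordinate is 1.
  π₂-nondegenerate : ∀ {y} → (∀ x → π₂ (x * y) L.≈ L.0#) → y ≈ 0#
  π₂-nondegenerate {y} zero-on with y ≟ 0#
  ... | yes y≈0 = y≈0
  ... | no y≉0  = let x , xy≈w₂ = injective⇒surjective size size (_* y) (*-cancelʳ y≉0) w₂ in
    contradiction (L.trans (L.sym π-w₂) (L.trans (L.sym (proj₂ (π-cong xy≈w₂))) (zero-on x))) L.1≉0

  π₂-combination-* : ∀ a b y → π₂ (combination w₁ w₂ (a , b) * y) L.≈ a L.* π₂ (w₁ * y) L.+ b L.* π₂ (w₂ * y)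
  π₂-combination-* a b y = L.trans (proj₂ (π-cong (trans (distribʳ _ _ _)
      (+-cong (sym (ι-nucleus a w₁ y)) (sym (ι-nucleus b w₂ y))))))
    (L.trans (proj₂ (π-+ _ _)) (L.+-cong (proj₂ (π-ι a _)) (proj₂ (π-ι b _))))

  γ-injective : ∀ {y z} → proj₁ (γ y) L.≈ proj₁ (γ z) × proj₂ (γ y) L.≈ proj₂ (γ z) → y ≈ z
  γ-injective {y} {z} (eq₂ , eq₁) = +≈0⇒≈ (π₂-nondegenerate λ x →
    L.trans (proj₂ (π-cong (*-congʳ (sym (π-spec x))))) (L.trans (π₂-combination-* _ _ _)
      (L.trans (L.+-cong (L.trans (L.*-congˡ (vanish w₁ eq₁)) (L.zeroʳ _)) (L.trans (L.*-congˡ (vanish w₂ eq₂)) (L.zeroʳ _)))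
        (L.+-identityʳ _))))
    where
    vanish : ∀ w → π₂ (w * y) L.≈ π₂ (w * z) → π₂ (w * (y + z)) L.≈ L.0#
    vanish w eq = L.trans (proj₂ (π-cong (distribˡ w y z))) (L.trans (proj₂ (π-+ _ _))
      (L.trans (L.+-congʳ eq) (L-x+x≈0 _)))

  γ-surjective : ∀ p → ∃[ y ] proj₁ (γ y) L.≈ proj₁ p × proj₂ (γ y) L.≈ proj₂ p
  γ-surjective = injective⇒surjective {B = ×-setoid L.setoid L.setoid} size (hasSize-× L.size L.size) γ γ-injective

  -- The basis over the right nucleus that is dual to the two components of `γ`.
  u₁ u₂ : Carrier
  u₁ = proj₁ (γ-surjective (L.1# , L.0#))
  u₂ = proj₁ (γ-surjective (L.0# , L.1#))

  γu₁ : π₂ (w₂ * u₁) L.≈ L.1# × π₂ (w₁ * u₁) L.≈ L.0#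
  γu₁ = proj₂ (γ-surjective (L.1# , L.0#))

  γu₂ : π₂ (w₂ * u₂) L.≈ L.0# × π₂ (w₁ * u₂) L.≈ L.1#
  γu₂ = proj₂ (γ-surjective (L.0# , L.1#))

  rightCombination : L.Carrier × L.Carrier → Carrier
  rightCombination (c , d) = u₁ * κ c + u₂ * κ d

  rightCombination-cong : ∀ {c d c′ d′} → c L.≈ c′ → d L.≈ d′ → rightCombination (c , d) ≈ rightCombination (c′ , d′)
  rightCombination-cong p q = +-cong (*-congˡ (κ-cong p)) (*-congˡ (κ-cong q))

  rightCombination-+ : ∀ c d c′ d′ →
    rightCombination (c L.+ c′ , d L.+ d′) ≈ rightCombination (c , d) + rightCombination (c′ , d′)
  rightCombination-+ c d c′ d′ = trans
    (+-cong (trans (*-congˡ (κ-+ c c′)) (distribˡ _ _ _)) (trans (*-congˡ (κ-+ d d′)) (distribˡ _ _ _)))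
    (interchange _ _ _ _)

  product : ∀ x c d →
    π₁ (x * rightCombination (c , d)) L.≈ π₁ (x * u₁) L.* ^σ c L.+ π₁ (x * u₂) L.* ^σ d ×
    π₂ (x * rightCombination (c , d)) L.≈ π₂ (x * u₁) L.* c L.+ π₂ (x * u₂) L.* d
  product x c d = L.trans (proj₁ expand) (L.trans (proj₁ (π-+ _ _)) (L.+-cong (proj₁ (π-κ _ c)) (proj₁ (π-κ _ d)))) ,
                  L.trans (proj₂ expand) (L.trans (proj₂ (π-+ _ _)) (L.+-cong (proj₂ (π-κ _ c)) (proj₂ (π-κ _ d))))
    where
    expand = π-cong (trans (distribˡ x (u₁ * κ c) (u₂ * κ d)) (+-cong (sym (κ-nucleus c x u₁)) (sym (κ-nucleus d x u₂))))

  γ-rightCombination : ∀ c d → π₂ (w₂ * rightCombination (c , d)) L.≈ c × π₂ (w₁ * rightCombination (c , d)) L.≈ d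
  γ-rightCombination c d =
    L.trans (proj₂ (product w₂ c d)) (L.trans (L.+-cong (L.*-congʳ (proj₁ γu₁)) (L.*-congʳ (proj₁ γu₂)))
      (L.trans (L.+-cong (L.*-identityˡ c) (L.zeroˡ d)) (L.+-identityʳ c))) ,
    L.trans (proj₂ (product w₁ c d)) (L.trans (L.+-cong (L.*-congʳ (proj₂ γu₁)) (L.*-congʳ (proj₂ γu₂)))
      (L.trans (L.+-cong (L.zeroˡ c) (L.*-identityˡ d)) (L.+-identityˡ d)))

  -- The first coordinates of the products of basis vectors, in the order of the terms ac^σ, bc^σ,
  -- ad^σ, bd^σ. The exponent σ arises because `κ e` acts on first coordinates as multiplication by
  -- `^σ e`.
  quadruple : Quadruple L.Carrier
  quadruple = [ π₁ (w₁ * u₁) , π₁ (w₂ * u₁) , π₁ (w₁ * u₂) , π₁ (w₂ * u₂) ]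

  open Quadruple quadruple
  open RawRingWithoutOne (B m L s quadruple) using () renaming (_*_ to _∘′_)

  π-combination-* : ∀ a b y → π₁ (combination w₁ w₂ (a , b) * y) L.≈ a L.* π₁ (w₁ * y) L.+ b L.* π₁ (w₂ * y) ×
                              π₂ (combination w₁ w₂ (a , b) * y) L.≈ a L.* π₂ (w₁ * y) L.+ b L.* π₂ (w₂ * y)
  π-combination-* a b y =
    L.trans (proj₁ expand) (L.trans (proj₁ (π-+ _ _)) (L.+-cong (proj₁ (π-ι a _)) (proj₁ (π-ι b _)))) ,
    π₂-combination-* a b y
    where
    expand = π-cong (trans (distribʳ y (ι a * w₁) (ι b * w₂)) (+-cong (sym (ι-nucleus a w₁ y)) (sym (ι-nucleus b w₂ y))))

  isotopic-product : ∀ x y → let z = combination w₁ w₂ x * rightCombination y in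
    π₁ z L.≈ proj₁ (x ∘′ y) × π₂ z L.≈ proj₂ (x ∘′ y)
  isotopic-product (a , b) (c , d) =
    L.trans (proj₁ (π-combination-* a b y)) (L.trans
        (L.+-cong (L.*-congˡ (proj₁ (product w₁ c d))) (L.*-congˡ (proj₁ (product w₂ c d))))
        (expandBilinear L.commutativeRing a b p₁ p₂ p₃ p₄ (^σ c) (^σ d))) ,
    L.trans (proj₂ (π-combination-* a b y)) (L.+-cong (L.*-congˡ (proj₂ (γ-rightCombination c d))) (L.*-congˡ (proj₁ (γ-rightCombination c d))))
    where
    y = rightCombination (c , d)

  L--x≈x : ∀ e → L.- e L.≈ e
  L--x≈x e = L-+≈0⇒≈ (L.-‿inverseˡ e)

  isotopic : Isotopic rawRingWithoutOne (B m L s quadruple)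
  isotopic = record
    { α₁ = combination w₁ w₂
    ; α₂ = rightCombination
    ; β  = π
    ; α₁-isGroupIsomorphism = record
      { isGroupMonomorphism = record
        { isGroupHomomorphism = record
          { isMonoidHomomorphism = record
            { isMagmaHomomorphism = record
              { isRelHomomorphism = record { cong = λ (p , q) → combination-cong p q }
              ; homo = λ (a , b) (a′ , b′) → combination-+ a b a′ b′ }
            ; ε-homo = trans (+-cong (trans (*-congʳ ι-0) (zeroˡ w₁)) (trans (*-congʳ ι-0) (zeroˡ w₂))) (+-identityʳ 0#) }
          ; ⁻¹-homo = λ (a , b) → trans (combination-cong (L--x≈x a) (L--x≈x b)) (sym (-x≈x _)) }
        ; injective = combination-injective basis }
      ; surjective = λ x → π x , λ (p , q) → trans (combination-cong p q) (π-spec x) }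
    ; α₂-isGroupIsomorphism = record
      { isGroupMonomorphism = record
        { isGroupHomomorphism = record
          { isMonoidHomomorphism = record
            { isMagmaHomomorphism = record
              { isRelHomomorphism = record { cong = λ (p , q) → rightCombination-cong p q }
              ; homo = λ (c , d) (c′ , d′) → rightCombination-+ c d c′ d′ }
            ; ε-homo = trans (rightCombination-cong (L.sym (L.+-identityʳ L.0#)) (L.sym (L.+-identityʳ L.0#)))
                         (trans (rightCombination-+ _ _ _ _) (x+x≈0 _)) }
          ; ⁻¹-homo = λ (c , d) → trans (rightCombination-cong (L--x≈x c) (L--x≈x d)) (sym (-x≈x _)) }
        ; injective = λ {(c , d)} {(c′ , d′)} eq →
            L.trans (L.sym (proj₁ (γ-rightCombination c d))) (L.trans (proj₂ (π-cong (*-congˡ eq))) (proj₁ (γ-rightCombination c′ d′))) ,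
            L.trans (L.sym (proj₂ (γ-rightCombination c d))) (L.trans (proj₂ (π-cong (*-congˡ eq))) (proj₂ (γ-rightCombination c′ d′))) }
      ; surjective = λ y → γ y , λ (p , q) → trans (rightCombination-cong p q) (γ-injective (γ-rightCombination _ _)) }
    ; β-isGroupIsomorphism = record
      { isGroupMonomorphism = record
        { isGroupHomomorphism = record
          { isMonoidHomomorphism = record
            { isMagmaHomomorphism = record
              { isRelHomomorphism = record { cong = π-cong }
              ; homo = π-+ }
            ; ε-homo = π-0 }
          ; ⁻¹-homo = λ x → let p , q = π-cong (-x≈x x) in
              L.trans p (L.sym (L--x≈x _)) , L.trans q (L.sym (L--x≈x _)) }
        ; injective = λ (p , q) → trans (sym (π-spec _)) (trans (combination-cong p q) (π-spec _)) }
      ; surjective = λ (a , b) → combination w₁ w₂ (a , b) , λ eq → π-unique (sym eq) }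
    ; isotopism = isotopic-product
    }

  -- Both conditions come from the absence of zero divisors. The product of w₁ and u₁ has
  -- coordinates (p₁, 0). The product (x, 1) ∘ (x, 1) has the polynomial at x as its first
  -- component, and its second one is x + x = 0.
  legitimate : Legitimate m L s quadruple
  legitimate = record
    { p₁≉0 = λ p₁≈0 → nonZero-product w₁≉0 u₁≉0 (p₁≈0 , proj₂ γu₁)
    ; noRoot = λ x eq → nonZero-product (x1≉0 x) (rx1≉0 x)
        ( L.trans (proj₁ (isotopic-product (x , L.1#) (x , L.1#))) (L.trans (L.sym (same x)) eq)
        , L.trans (proj₂ (isotopic-product (x , L.1#) (x , L.1#))) (L.trans (L.+-cong (L.*-identityʳ x) (L.*-identityˡ x)) (L-x+x≈0 x)) )
    }
    where
    nonZero-product : ∀ {x y} → ¬ x ≈ 0# → ¬ y ≈ 0# → ¬ (π₁ (x * y) L.≈ L.0# × π₂ (x * y) L.≈ L.0#)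
    nonZero-product x≉0 y≉0 (p , q) = *-nonZero x≉0 y≉0 (trans (sym (π-spec _)) (trans (combination-cong p q)
      (trans (+-cong (trans (*-congʳ ι-0) (zeroˡ w₁)) (trans (*-congʳ ι-0) (zeroˡ w₂))) (+-identityʳ 0#))))
    w₁≉0 : ¬ w₁ ≈ 0#
    w₁≉0 w₁≈0 = L.1≉0 (proj₁ (basis L.1# L.0# (trans (+-cong (trans (*-congˡ w₁≈0) (zeroʳ _)) (trans (*-congʳ ι-0) (zeroˡ _))) (+-identityʳ 0#))))
    u₁≉0 : ¬ u₁ ≈ 0#
    u₁≉0 u₁≈0 = L.1≉0 (L.trans (L.sym (proj₁ γu₁)) (L.trans (proj₂ (π-cong (trans (*-congˡ u₁≈0) (zeroʳ _)))) (proj₂ π-0)))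
    x1≉0 : ∀ x → ¬ combination w₁ w₂ (x , L.1#) ≈ 0#
    x1≉0 x eq = L.1≉0 (proj₂ (basis x L.1# eq))
    rx1≉0 : ∀ x → ¬ rightCombination (x , L.1#) ≈ 0#
    rx1≉0 x eq = L.1≉0 (L.trans (L.sym (proj₂ (γ-rightCombination x L.1#)))
      (L.trans (proj₂ (π-cong (trans (*-congˡ eq) (zeroʳ _)))) (proj₂ π-0)))
    σ = 2 ℕ.^ s
    1^ : ∀ k → L.1# ^ k L.≈ L.1#
    1^ zero    = L.refl
    1^ (suc k) = L.trans (L.*-identityˡ _) (1^ k)
    same : ∀ x → p₁ L.* x ^ (σ ℕ.+ 1) L.+ p₂ L.* x ^ σ L.+ p₃ L.* x L.+ p₄ L.≈ proj₁ ((x , L.1#) ∘′ (x , L.1#))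
    same x = L.+-cong (L.+-cong (L.+-cong
        (L.trans (L.*-congˡ (L.trans (^-homo-* x σ 1) (L.trans (L.*-congˡ (L.*-identityʳ x)) (L.*-comm _ _)))) (L.sym (L.*-assoc _ _ _)))
        (L.*-congʳ (L.sym (L.*-identityʳ _))))
        (L.sym (L.trans (L.*-congˡ (1^ σ)) (L.*-identityʳ _))))
        (L.sym (L.trans (L.*-congˡ (1^ σ)) (L.trans (L.*-identityʳ _) (L.*-identityʳ _))))

-- Nuclei of semifields isotopic to B(2,m,s,0,t)

right⇒oppositeLeft : (S : Semifield c ℓ) → HasRightNuclearDimension S 2 → HasLeftNuclearDimension (opposite S) 2
right⇒oppositeLeft S (e , basis) = e , record
  { spanning    = λ x → let k , k-nucleus , eq = spanning x in k , (λ i y w → sym (k-nucleus i w y)) , eq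
  ; independent = λ k k-nucleus → independent k (λ i x y → sym (k-nucleus i y x))
  }
  where
  open Semifield S
  open IsRightNuclearBasis basis

oppositeLeft⇒right : (S : Semifield c ℓ) → HasLeftNuclearDimension (opposite S) 2 → HasRightNuclearDimension S 2
oppositeLeft⇒right S (e , basis) = e , record
  { spanning    = λ x → let k , k-nucleus , eq = spanning x in k , (λ i x y → sym (k-nucleus i y x)) , eq
  ; independent = λ k k-nucleus → independent k (λ i y w → sym (k-nucleus i w y))
  }
  where
  open Semifield S
  open IsLeftNuclearBasis basis

module _ {q} {L : FiniteField a b q} {S : Semifield c ℓ} (x+x≈0 : IsCharTwo S) (Λ : LeftScalars L S)
  (size : HasSize (Semifield.setoid S) (q ℕ.* q)) (¬associative : ¬ (∀ x → InLeftNucleus S x)) where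

  open Semifield S hiding (zero)
  open SemifieldProperties S x+x≈0
  open LeftScalars Λ
  open ScalarProperties x+x≈0 Λ
  private
    module N = IsSubsemifield (LeftNucleus.isSubsemifield S x+x≈0)

    inverse-nucleus : ∀ {k z} → ¬ k ≈ 0# → InLeftNucleus S k → k * z ≈ 1# → InLeftNucleus S z
    inverse-nucleus {k} {z} k≉0 k-nucleus kz≈1 y w = *-cancelˡ k≉0
      (trans (k-nucleus z (y * w)) (trans (*-congʳ kz≈1) (trans (*-identityˡ _) (sym
        (trans (k-nucleus (z * y) w) (*-congʳ (trans (k-nucleus z y) (trans (*-congʳ kz≈1) (*-identityˡ y)))))))))

    quotient-nucleus : ∀ {k d e} → ¬ k ≈ 0# → InLeftNucleus S k → InLeftNucleus S d → k * e ≈ d → InLeftNucleus S e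
    quotient-nucleus {k} {d} {e} k≉0 k-nucleus d-nucleus ke≈d =
      let z , kz≈1 = rightInverse k≉0 in
      N.resp (*-cancelˡ k≉0 (trans (k-nucleus z d) (trans (*-congʳ kz≈1) (trans (*-identityˡ d) (sym ke≈d)))))
        (N.*-closed (inverse-nucleus k≉0 k-nucleus kz≈1) d-nucleus)

    outside : ∃[ e ] ¬ InLeftNucleus S e
    outside with ∃? (λ eq e∉ → e∉ ∘ N.resp (sym eq)) (λ e → ¬? (N.P? e))
    ... | yes found = found
    ... | no none   = contradiction (λ x → decidable-stable (N.P? x) (λ x∉ → none (x , x∉))) ¬associative

  -- The basis consists of 1 and an element e outside the nucleus. They span already over the copy
  -- of `L`, by counting. They are independent over the whole nucleus, since a relation would
  -- express e as a quotient of nuclear elements.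
  leftNuclearDimension : HasLeftNuclearDimension S 2
  leftNuclearDimension with e , e∉N ← outside = basis e , record
    { spanning    = λ x → let (d , f) , eq = spans (independent 1≉0 (e∉L e∉N)) size x in
        (λ { zero → ι d ; (suc zero) → ι f }) , (λ { zero → ι-nucleus d ; (suc zero) → ι-nucleus f }) ,
        trans (+-congˡ (+-identityʳ _)) eq
    ; independent = λ k k-nucleus eq → nuclear-independent e∉N (k-nucleus zero) (k-nucleus (suc zero))
        (trans (+-cong (sym (*-identityʳ _)) (sym (+-identityʳ _))) eq)
    }
    where
    basis : Carrier → Vector Carrier 2
    basis e zero       = 1#
    basis e (suc zero) = e
    e∉L : ∀ {e} → ¬ InLeftNucleus S e → ¬ Line 1# e
    e∉L e∉N (d , eq) = e∉N (N.resp (trans (sym (*-identityʳ _)) eq) (ι-nucleus d))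
    nuclear-independent : ∀ {e} → ¬ InLeftNucleus S e → ∀ {k : Vector Carrier 2} → InLeftNucleus S (k zero) →
      InLeftNucleus S (k (suc zero)) → k zero + k (suc zero) * e ≈ 0# → ∀ i → k i ≈ 0#
    nuclear-independent {e} e∉N {k} k₀-nucleus k₁-nucleus eq with k (suc zero) ≟ 0#
    ... | no k₁≉0  = contradiction (quotient-nucleus k₁≉0 k₁-nucleus k₀-nucleus (sym (+≈0⇒≈ eq))) e∉N
    ... | yes k₁≈0 = λ where
      zero       → trans (sym (+-identityʳ _)) (trans (+-congˡ (trans (sym (zeroˡ e)) (*-congʳ (sym k₁≈0)))) eq)
      (suc zero) → k₁≈0

-- The maps g d and D d form an autotopism of S with trivial second component; evaluation at y = 1
-- shows that it is left multiplication by g d 1, an element of the left nucleus.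
module Autotopism {q} (L : FiniteField a b q) (S : Semifield c ℓ) {a′ b′} (V : Setoid a′ b′) where
  private
    module L = FiniteField L
    module V = Setoid V
  open Semifield S

  module _ (_+ᵛ_ : V.Carrier → V.Carrier → V.Carrier)
    (β : Carrier → V.Carrier) (β-cong : ∀ {x y} → x ≈ y → β x V.≈ β y) (β-injective : ∀ {x y} → β x V.≈ β y → x ≈ y)
    (β-+ : ∀ x y → β (x + y) V.≈ (β x +ᵛ β y))
    (D : L.Carrier → V.Carrier → V.Carrier) (D-cong : ∀ {d e u v} → d L.≈ e → u V.≈ v → D d u V.≈ D e v)
    (D-+ : ∀ d e v → D (d L.+ e) v V.≈ (D d v +ᵛ D e v)) (D-* : ∀ d e v → D (d L.* e) v V.≈ D d (D e v))
    (D-1 : ∀ v → D L.1# v V.≈ v)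
    (+ᵛ-cong : ∀ {u v u′ v′} → u V.≈ v → u′ V.≈ v′ → (u +ᵛ u′) V.≈ (v +ᵛ v′))
    (g : L.Carrier → Carrier → Carrier) (g-spec : ∀ d x y → β (g d x * y) V.≈ D d (β (x * y))) where

    private
      ι : L.Carrier → Carrier
      ι d = g d 1#

      ι-spec : ∀ d y → β (ι d * y) V.≈ D d (β y)
      ι-spec d y = V.trans (g-spec d 1# y) (D-cong L.refl (β-cong (*-identityˡ y)))

      g≈ι : ∀ d x → g d x ≈ ι d * x
      g≈ι d x = β-injective (V.trans (β-cong (sym (*-identityʳ _))) (V.trans (g-spec d x 1#)
        (V.trans (D-cong L.refl (β-cong (*-identityʳ x))) (V.sym (ι-spec d x)))))

      β-ι : ∀ d → β (ι d) V.≈ D d (β 1#)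
      β-ι d = V.trans (β-cong (sym (*-identityʳ _))) (ι-spec d 1#)

    scalars : Σ[ Λ ∈ LeftScalars L S ] (∀ d y → β (LeftScalars.ι Λ d * y) V.≈ D d (β y))
    scalars = record
      { ι         = ι
      ; ι-cong    = λ eq → β-injective (V.trans (β-ι _) (V.trans (D-cong eq V.refl) (V.sym (β-ι _))))
      ; ι-+       = λ d e → β-injective (V.trans (β-ι _) (V.trans (D-+ d e _)
                      (V.sym (V.trans (β-+ _ _) (+ᵛ-cong (β-ι d) (β-ι e))))))
      ; ι-*       = λ d e → β-injective (V.trans (β-ι _) (V.trans (D-* d e _)
                      (V.sym (V.trans (ι-spec d (ι e)) (D-cong L.refl (β-ι e))))))
      ; ι-1       = β-injective (V.trans (β-ι _) (D-1 _))
      ; ι-nucleus = λ d y w → β-injective (V.trans (ι-spec d (y * w)) (V.sym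
                      (V.trans (β-cong (*-cong (sym (g≈ι d y)) refl)) (g-spec d y w))))
      } , ι-spec

-- If S were associative, it would be a field by Wedderburn's theorem, and the scalars on the left and
-- on the right would be the same elements, as all of them are roots of t^q - t.
module _ {m} {L : FiniteField a b (2 ℕ.^ m)} {S : Semifield c ℓ} (x+x≈0 : IsCharTwo S)
  (Λ : LeftScalars L S) (P : LeftScalars L (opposite S)) where

  private
    module L = FiniteField L
  open Semifield S hiding (zero)
  open LeftScalars Λ
  open LeftScalars P using () renaming (ι to κ; ι-cong to κ-cong; ι-* to κ-*; ι-1 to κ-1)
  open ScalarProperties x+x≈0 Λ

  private
    module PP = ScalarProperties {S = opposite S} x+x≈0 P

    n : ℕ
    n = ℕ.pred (2 ℕ.^ m)

    q≡1+n : 2 ℕ.^ m ≡ suc n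
    q≡1+n = 2^≡1+pred m

    module LP = FieldProperties L q≡1+n

  ¬associative : ∀ {u} → (∀ d → ¬ (∀ x → ι d * x ≈ x * κ u)) → ¬ (∀ x → InLeftNucleus S x)
  ¬associative {u} ¬same associative = 1≉0 (trans (sym f0≈1)
    (FP.tooManyRoots FP.zero-isSubmodule f-poly points (λ {i} {j} → points-injective i j) f-root 0#))
    where
    *-assoc : ∀ x y z → (x * y) * z ≈ x * (y * z)
    *-assoc x y z = sym (associative x y z)
    *-comm : ∀ x y → x * y ≈ y * x
    *-comm = wedderburn S x+x≈0 *-assoc
    F : FiniteField c ℓ (proj₁ finite)
    F = SemifieldProperties.Associative.finiteField S x+x≈0 *-assoc *-comm (proj₂ finite)
    module FP = PolynomialFunctions F TensorUnit.leftModule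
    open import Algebra.Properties.Semiring.Exp (FiniteField.semiring F) using () renaming (_^_ to _^ᶠ_)
    u≉0 : u L.≉ L.0#
    u≉0 u≈0 = ¬same L.0# λ x → trans (*-congʳ ι-0) (trans (zeroˡ x) (sym (trans (*-congˡ (trans (κ-cong u≈0) PP.ι-0)) (zeroʳ x))))
    ι-^ : ∀ d k → ι (d LP.^ k) ≈ ι d ^ᶠ k
    ι-^ d zero    = ι-1
    ι-^ d (suc k) = trans (ι-* _ _) (*-congˡ (ι-^ d k))
    κ-^ : ∀ d k → κ (d LP.^ k) ≈ κ d ^ᶠ k
    κ-^ d zero    = κ-1
    κ-^ d (suc k) = trans (κ-* _ _) (trans (*-comm _ _) (*-congˡ (κ-^ d k)))
    f : Carrier → Carrier
    f x = x ^ᶠ n * 1# + 1# * 1#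
    f-poly : FP.IsPolynomial (suc n) f
    f-poly = FP.isPolynomial-+ (FP.isPolynomial-monomial n 1#) (FP.isPolynomial-weaken (s≤s z≤n) (FP.isPolynomial-monomial 0 1#))
    f-root′ : ∀ {x} → x ^ᶠ n ≈ 1# → f x ≈ 0#
    f-root′ eq = trans (+-congʳ (*-congʳ eq)) (x+x≈0 _)
    -- `κ u` joins the images under `ι` of the `n` nonzero scalars as one further root of x^n + 1, a
    -- polynomial with `suc n` coefficients and value 1 at 0.
    points : Vector Carrier (suc n)
    points zero    = κ u
    points (suc i) = ι (LP.avoiding L.0# i)
    κu≉ι : ∀ d → ¬ κ u ≈ ι d
    κu≉ι d eq = ¬same d λ x → trans (*-comm _ _) (*-congˡ (sym eq))
    points-injective : ∀ i j → points i ≈ points j → i ≡ j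
    points-injective zero    zero    eq = ≡.refl
    points-injective zero    (suc j) eq = contradiction eq (κu≉ι _)
    points-injective (suc i) zero    eq = contradiction (sym eq) (κu≉ι _)
    points-injective (suc i) (suc j) eq = ≡.cong suc (LP.avoiding-injective L.0# (ι-injective eq))
    f-root : ∀ i → f (points i) ≈ 0#
    f-root zero    = f-root′ (trans (sym (κ-^ u n)) (trans (κ-cong (LP.fermat u≉0)) κ-1))
    f-root (suc i) = f-root′ (trans (sym (ι-^ _ n)) (trans (ι-cong (LP.fermat (LP.avoiding-≉ L.0# i))) ι-1))
    f0≈1 : f 0# ≈ 1#
    f0≈1 = trans (+-cong (trans (*-identityʳ _) (0^ LP.1≤n)) (*-identityˡ 1#)) (+-identityˡ 1#)
      where
      0^ : ∀ {k} → 1 ℕ.≤ k → 0# ^ᶠ k ≈ 0#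
      0^ (s≤s _) = zeroˡ _

-- From an isotopism to the nuclei

module FromIsotopism (S : Semifield c ℓ) {m s} (s<2m : s ℕ.< 2 ℕ.* m) (s≢0 : s ≢ 0) (s≢m : s ≢ m)
  (L : FiniteField 0ℓ 0ℓ (2 ℕ.^ m)) (t : Quadruple (FiniteField.Carrier L))
  (I : Isotopic (Semifield.rawRingWithoutOne S) (B m L s t)) where

  private
    module L = FiniteField L
    module R = RawRingWithoutOne (B m L s t)

    n : ℕ
    n = ℕ.pred (2 ℕ.^ m)

    q≡1+n : 2 ℕ.^ m ≡ suc n
    q≡1+n = 2^≡1+pred m

    module LP = FieldProperties L q≡1+n
    module L2 = LP.Char2 m ≡.refl
  open Semifield S hiding (zero)
  open Isotopic I
  open Quadruple t
  private
    module A₁ = IsGroupIsomorphism α₁-isGroupIsomorphism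
    module A₂ = IsGroupIsomorphism α₂-isGroupIsomorphism
    module Bβ = IsGroupIsomorphism β-isGroupIsomorphism

    V : Setoid 0ℓ 0ℓ
    V = ×-setoid L.setoid L.setoid
    module V = Setoid V

    ^σ : L.Carrier → L.Carrier
    ^σ e = e LP.^ (2 ℕ.^ s)

    x+x≈0 : IsCharTwo S
    x+x≈0 x = Bβ.injective (V.trans (Bβ.∙-homo x x) (V.trans (L2.x+x≈0 _ , L2.x+x≈0 _) (V.sym Bβ.ε-homo)))

    α₁⁻¹ α₂⁻¹ : Carrier → L.Carrier × L.Carrier
    α₁⁻¹ x = proj₁ (A₁.surjective x)
    α₂⁻¹ x = proj₁ (A₂.surjective x)

    α₁-α₁⁻¹ : ∀ x → α₁ (α₁⁻¹ x) ≈ x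
    α₁-α₁⁻¹ x = proj₂ (A₁.surjective x) V.refl

    α₂-α₂⁻¹ : ∀ x → α₂ (α₂⁻¹ x) ≈ x
    α₂-α₂⁻¹ x = proj₂ (A₂.surjective x) V.refl

    size : HasSize setoid (2 ℕ.^ m ℕ.* 2 ℕ.^ m)
    size = hasSize-bijection {A = V} (hasSize-× L.size L.size) α₁ A₁.⟦⟧-cong A₁.injective (λ x → α₁⁻¹ x , α₁-α₁⁻¹ x)

    pullˡ : ∀ e p a c → p L.* (e L.* a) L.* c L.≈ e L.* (p L.* a L.* c)
    pullˡ e p a c = L.trans (L.*-congʳ (L.trans (L.sym (L.*-assoc p e a)) (L.trans (L.*-congʳ (L.*-comm p e)) (L.*-assoc e p a))))
      (L.*-assoc e (p L.* a) c)

    pullʳ : ∀ e x c → x L.* (e L.* c) L.≈ e L.* (x L.* c)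
    pullʳ e x c = L.trans (L.sym (L.*-assoc x e c)) (L.trans (L.*-congʳ (L.*-comm x e)) (L.*-assoc e x c))

    factor₂ : ∀ e {x y x′ y′} → x′ L.≈ e L.* x → y′ L.≈ e L.* y → x′ L.+ y′ L.≈ e L.* (x L.+ y)
    factor₂ e p q = L.trans (L.+-cong p q) (L.sym (L.distribˡ e _ _))

    scaleˡ scaleʳ : L.Carrier → V.Carrier → V.Carrier
    scaleˡ e (x , y) = e L.* x , e L.* y
    scaleʳ e (x , y) = ^σ e L.* x , e L.* y

    semilinearˡ : ∀ e x y → (scaleˡ e x R.* y) V.≈ scaleˡ e (x R.* y)
    semilinearˡ e (a , b) (c , d) =
      factor₂ e (factor₂ e (factor₂ e (pullˡ e p₁ a (^σ c)) (pullˡ e p₂ b (^σ c))) (pullˡ e p₃ a (^σ d))) (pullˡ e p₄ b (^σ d)) ,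
      factor₂ e (L.*-assoc e a d) (L.*-assoc e b c)

    semilinearʳ : ∀ e x y → (x R.* scaleˡ e y) V.≈ scaleʳ e (x R.* y)
    semilinearʳ e (a , b) (c , d) =
      factor₂ e′ (factor₂ e′ (factor₂ e′ (pull (p₁ L.* a) c) (pull (p₂ L.* b) c)) (pull (p₃ L.* a) d)) (pull (p₄ L.* b) d) ,
      factor₂ e (pullʳ e a d) (pullʳ e b c)
      where
      e′ : L.Carrier
      e′ = ^σ e
      pull : ∀ x c → x L.* ^σ (e L.* c) L.≈ e′ L.* (x L.* ^σ c)
      pull x c = L.trans (L.*-congˡ (LP.^-distrib-* e c (2 ℕ.^ s))) (pullʳ e′ x (^σ c))

    scaleˡ-cong : ∀ {d e u v} → d L.≈ e → u V.≈ v → scaleˡ d u V.≈ scaleˡ e v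
    scaleˡ-cong eq (p , q) = L.*-cong eq p , L.*-cong eq q

    scaleʳ-cong : ∀ {d e u v} → d L.≈ e → u V.≈ v → scaleʳ d u V.≈ scaleʳ e v
    scaleʳ-cong eq (p , q) = L.*-cong (LP.^-congˡ (2 ℕ.^ s) eq) p , L.*-cong eq q

    isotopism⁻¹ : ∀ x y → β (x * y) V.≈ (α₁⁻¹ x R.* α₂⁻¹ y)
    isotopism⁻¹ x y = V.trans (Bβ.⟦⟧-cong (*-cong (sym (α₁-α₁⁻¹ x)) (sym (α₂-α₂⁻¹ y)))) (isotopism _ _)

    leftScalars = Autotopism.scalars L S V R._+_ β Bβ.⟦⟧-cong Bβ.injective Bβ.∙-homo scaleˡ scaleˡ-cong
      (λ d e v → L.distribʳ _ d e , L.distribʳ _ d e) (λ d e v → L.*-assoc d e _ , L.*-assoc d e _)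
      (λ v → L.*-identityˡ _ , L.*-identityˡ _) (λ (p , q) (p′ , q′) → L.+-cong p p′ , L.+-cong q q′)
      (λ e x → α₁ (scaleˡ e (α₁⁻¹ x)))
      (λ e x y → V.trans (Bβ.⟦⟧-cong (*-cong refl (sym (α₂-α₂⁻¹ y)))) (V.trans (isotopism _ _)
        (V.trans (semilinearˡ e (α₁⁻¹ x) (α₂⁻¹ y)) (scaleˡ-cong L.refl (V.sym (isotopism⁻¹ x y))))))

    rightScalars = Autotopism.scalars L (opposite S) V R._+_ β Bβ.⟦⟧-cong Bβ.injective Bβ.∙-homo scaleʳ scaleʳ-cong
      (λ d e v → L.trans (L.*-congʳ (L2.frobenius-+ s d e)) (L.distribʳ _ _ _) , L.distribʳ _ d e)
      (λ d e v → L.trans (L.*-congʳ (LP.^-distrib-* d e (2 ℕ.^ s))) (L.*-assoc _ _ _) , L.*-assoc d e _)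
      (λ v → L.trans (L.*-congʳ (LP.1^ (2 ℕ.^ s))) (L.*-identityˡ _) , L.*-identityˡ _)
      (λ (p , q) (p′ , q′) → L.+-cong p p′ , L.+-cong q q′)
      (λ e y → α₂ (scaleˡ e (α₂⁻¹ y)))
      (λ e y x → V.trans (Bβ.⟦⟧-cong (*-cong (sym (α₁-α₁⁻¹ x)) refl)) (V.trans (isotopism _ _)
        (V.trans (semilinearʳ e (α₁⁻¹ x) (α₂⁻¹ y)) (scaleʳ-cong L.refl (V.sym (isotopism⁻¹ x y))))))

    ¬frobenius≈id : ¬ (∀ u → ^σ u L.≈ u)
    ¬frobenius≈id all with ℕₚ.<-cmp s m
    ... | tri< s<m _ _ = LP.¬frobenius≈id (ℕₚ.n≢0⇒n>0 s≢0) (ℕₚ.^-monoʳ-< 2 (s≤s (s≤s z≤n)) s<m) all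
    ... | tri≈ _ s≡m _ = s≢m s≡m
    -- Since u^(2^m) = u, the exponent s may be lowered to s - m, which lies strictly between 0 and
    -- m.
    ... | tri> _ _ m<s = LP.¬frobenius≈id {s ℕ.∸ m} (ℕₚ.m<n⇒0<n∸m m<s)
        (ℕₚ.^-monoʳ-< 2 (s≤s (s≤s z≤n)) (ℕₚ.+-cancelˡ-< m _ _ (≡.subst₂ ℕ._<_ (≡.sym s≡) (≡.cong (m ℕ.+_) (ℕₚ.+-identityʳ m)) s<2m)))
        λ u → L.trans (reduce u) (all u)
      where
      s≡ : m ℕ.+ (s ℕ.∸ m) ≡ s
      s≡ = ℕₚ.m+[n∸m]≡n (ℕₚ.<⇒≤ m<s)
      reduce : ∀ u → u LP.^ (2 ℕ.^ (s ℕ.∸ m)) L.≈ ^σ u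
      reduce u = L.trans (LP.^-congˡ (2 ℕ.^ (s ℕ.∸ m)) (L.sym (L.trans (LP.^-congʳ u q≡1+n) (LP.^q u))))
        (L.trans (LP.^-assocʳ u (2 ℕ.^ m) (2 ℕ.^ (s ℕ.∸ m)))
          (LP.^-congʳ u (≡.trans (≡.sym (ℕₚ.^-distribˡ-+-* 2 m (s ℕ.∸ m))) (≡.cong (2 ℕ.^_) s≡))))

    moved : ∃[ u ] ^σ u L.≉ u
    moved with HasSizeProperties.∃? L.size
      (λ eq ≉ eq′ → ≉ (L.trans (LP.^-congˡ (2 ℕ.^ s) eq) (L.trans eq′ (L.sym eq)))) (λ u → ¬? (^σ u LP.≟ u))
    ... | yes found = found
    ... | no none   = contradiction (λ u → decidable-stable (^σ u LP.≟ u) (λ ≉ → none (u , ≉))) ¬frobenius≈id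

    associative⇒⊥ : ¬ (∀ x → InLeftNucleus S x)
    associative⇒⊥ = ¬associative {m = m} x+x≈0 (proj₁ leftScalars) (proj₁ rightScalars)
      (λ d same → proj₂ moved (equal d same))
      where
      u = proj₁ moved
      -- At the preimage of (1, 1) the left scalar d produces (d, d) and the right scalar u produces
      -- (u^σ, u), so their agreement would give u^σ = u.
      x = proj₁ (Bβ.surjective (L.1# , L.1#))
      βx : β x V.≈ (L.1# , L.1#)
      βx = proj₂ (Bβ.surjective (L.1# , L.1#)) refl
      equal : ∀ d → (∀ x → (LeftScalars.ι (proj₁ leftScalars) d * x) ≈ (x * LeftScalars.ι (proj₁ rightScalars) u)) → ^σ u L.≈ u
      equal d same = L.trans (L.sym (L.*-identityʳ _)) (L.trans (L.sym (proj₁ eq)) (L.trans (proj₂ eq) (L.*-identityʳ u)))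
        where
        eq : scaleˡ d (L.1# , L.1#) V.≈ scaleʳ u (L.1# , L.1#)
        eq = V.trans (scaleˡ-cong L.refl (V.sym βx)) (V.trans (V.sym (proj₂ leftScalars d x))
          (V.trans (Bβ.⟦⟧-cong (same x)) (V.trans (proj₂ rightScalars u x) (scaleʳ-cong L.refl βx))))

  hasCharacteristic2 : HasCharacteristic S 2
  hasCharacteristic2 = record
    { positive = s≤s z≤n
    ; n·1≈0    = trans (+-cong refl (+-identityʳ 1#)) (x+x≈0 1#)
    ; minimal  = λ { (suc zero) _ _ eq → 1≉0 (trans (sym (+-identityʳ 1#)) eq) ; (suc (suc k)) _ (s≤s (s≤s ())) _ }
    }

  hasLeftNuclearDimension2 : HasLeftNuclearDimension S 2
  hasLeftNuclearDimension2 = leftNuclearDimension x+x≈0 (proj₁ leftScalars) size associative⇒⊥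

  hasRightNuclearDimension2 : HasRightNuclearDimension S 2
  hasRightNuclearDimension2 = oppositeLeft⇒right S
    (leftNuclearDimension {S = opposite S} x+x≈0 (proj₁ rightScalars) size
      λ associative → associative⇒⊥ λ x y w → sym (associative w y x))

-- From the nuclei to an isotopism

square-injective : ∀ {a b} → a ℕ.* a ≡ b ℕ.* b → a ≡ b
square-injective {a} {b} eq with ℕₚ.<-cmp a b
... | tri< a<b _ _ = contradiction eq (ℕₚ.<⇒≢ (ℕₚ.*-mono-< a<b a<b))
... | tri≈ _ a≡b _ = a≡b
... | tri> _ _ b<a = contradiction (≡.sym eq) (ℕₚ.<⇒≢ (ℕₚ.*-mono-< b<a b<a))

2^-injective : ∀ {a b} → 2 ℕ.^ a ≡ 2 ℕ.^ b → a ≡ b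
2^-injective {a} {b} eq with ℕₚ.<-cmp a b
... | tri< a<b _ _ = contradiction eq (ℕₚ.<⇒≢ (ℕₚ.^-monoʳ-< 2 (s≤s (s≤s z≤n)) a<b))
... | tri≈ _ a≡b _ = a≡b
... | tri> _ _ b<a = contradiction (≡.sym eq) (ℕₚ.<⇒≢ (ℕₚ.^-monoʳ-< 2 (s≤s (s≤s z≤n)) b<a))

module ToIsotopism (S : Semifield c ℓ) (characteristic : HasCharacteristic S 2)
  (left : HasLeftNuclearDimension S 2) (right : HasRightNuclearDimension S 2) where

  open Semifield S hiding (zero)

  x+x≈0 : IsCharTwo S
  x+x≈0 x = trans (+-cong (sym (*-identityˡ x)) (sym (*-identityˡ x))) (trans (sym (distribʳ x 1# 1#))
    (trans (*-cong (trans (+-cong refl (sym (+-identityʳ 1#))) (HasCharacteristic.n·1≈0 characteristic)) refl) (zeroˡ x)))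

  Result : Set (Level.suc 0ℓ ⊔ c ⊔ ℓ)
  Result = ∃[ m ] ∃[ s ] (1 ℕ.≤ m) × (s ℕ.< 2 ℕ.* m) × (s ≢ 0) × (s ≢ m) ×
    (Σ[ L ∈ FiniteField 0ℓ 0ℓ (2 ℕ.^ m) ] Σ[ t ∈ Quadruple (FiniteField.Carrier L) ]
      Legitimate m L s t × Isotopic rawRingWithoutOne (B m L s t))

  fromDiagonalBasis : ∀ {m} {L : FiniteField 0ℓ 0ℓ (2 ℕ.^ m)} (Λ : LeftScalars L S) →
    ¬ (∀ x → InLeftNucleus S x) → HasSize setoid (2 ℕ.^ m ℕ.* 2 ℕ.^ m) → DiagonalBasis m x+x≈0 Λ → Result
  fromDiagonalBasis {m} {L} Λ ¬assoc size Δ =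
    -- The bound s < m from the diagonal basis yields 1 ≤ m, s < 2m and s ≠ m together.
    m , s , ℕₚ.≤-trans (s≤s z≤n) s<m , ℕₚ.<-≤-trans s<m (ℕₚ.m≤m+n m _) , (λ s≡0 → s≡0⇒⊥ s≡0 ¬assoc) , ℕₚ.<⇒≢ s<m ,
    L , quadruple , legitimate , isotopic
    where
    open DiagonalBasis Δ using (s; s<m)
    open FromDiagonalBasis {m = m} x+x≈0 Λ Δ size

  fromScalars : ∀ {m} {L L′ : FiniteField 0ℓ 0ℓ (2 ℕ.^ m)} (Λ : LeftScalars L S) →
    (∀ {x} → InLeftNucleus S x → ∃[ d ] LeftScalars.ι Λ d ≈ x) → LeftScalars L′ (opposite S) →
    HasSize setoid (2 ℕ.^ m ℕ.* 2 ℕ.^ m) → Result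
  fromScalars {m} {L} {L′} Λ onto P size = fromDiagonalBasis Λ
    -- If the left nucleus were all of `S`, every element would be a scalar multiple of 1, leaving
    -- only q elements instead of q².
    (λ associative → D.¬allInLine 1≉0 λ x → let d , eq = onto (associative x) in d , trans (*-identityʳ _) eq)
    size D.diagonalBasis
    where
    module D = Diagonalization {m = m} {L = L} {L′ = L′} x+x≈0 Λ P size

  -- Both scalar fields have the order of `S` as their squared order, so their exponents agree and
  -- may be unified.
  fromTwoSidedScalars : ∀ {m m′} {L : FiniteField 0ℓ 0ℓ (2 ℕ.^ m)} {L′ : FiniteField 0ℓ 0ℓ (2 ℕ.^ m′)} (Λ : LeftScalars L S) →
    (∀ {x} → InLeftNucleus S x → ∃[ d ] LeftScalars.ι Λ d ≈ x) → LeftScalars L′ (opposite S) →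
    HasSize setoid (2 ℕ.^ m ℕ.* 2 ℕ.^ m) → HasSize setoid (2 ℕ.^ m′ ℕ.* 2 ℕ.^ m′) → Result
  fromTwoSidedScalars {m} {m′} Λ onto P size size′
    with ≡.refl ← 2^-injective {m} {m′} (square-injective (hasSize-unique {A = setoid} size size′)) =
    fromScalars {m} Λ onto P size

  result : Result
  result =
    let m , L , Λ , onto = LeftNucleus.scalars S x+x≈0
        m′ , L′ , P , onto′ = LeftNucleus.scalars (opposite S) x+x≈0
    in fromTwoSidedScalars {m} {m′} {L} {L′} Λ onto P
      (LeftNucleus.hasSize-square S x+x≈0 Λ onto left)
      (LeftNucleus.hasSize-square (opposite S) x+x≈0 P onto′ (right⇒oppositeLeft S right))

open import Data.Nat.Base using (ℕ; _≤_; _<_; _*_; _^_)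

proposition7 : ∀ {c ℓ} (S : Semifield c ℓ) →
    (∃[ m ] ∃[ s ]
    (1 ≤ m) × (s < 2 * m) × (s ≢ 0) × (s ≢ m) ×
    (Σ[ L ∈ FiniteField 0ℓ 0ℓ (2 ^ m) ]
    Σ[ t ∈ Quadruple (FiniteField.Carrier L) ]
    Legitimate m L s t × Isotopic (Semifield.rawRingWithoutOne S) (B m L s t)))
    ⇔
    (HasCharacteristic S 2 × HasLeftNuclearDimension S 2 × HasRightNuclearDimension S 2)
proposition7 S = mk⇔
  (λ (m , s , 1≤m , s<2m , s≢0 , s≢m , L , t , legitimate , isotopic) →
    let open FromIsotopism S s<2m s≢0 s≢m L t isotopic in
    hasCharacteristic2 , hasLeftNuclearDimension2 , hasRightNuclearDimension2)
  (λ (characteristic , left , right) → ToIsotopism.result S characteristic left right)
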